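{- Let $p$ be an odd rational prime, let $\zeta_p$ be a primitive $p$-th root of unity, and let $(1-\zeta_p)$ be the unique prime of $\mathbb{Z}[\zeta_p]$ above $p$. Let $\alpha\in\mathbb{Z}[\zeta_p]$ and suppose that $x^p-\alpha$ is irreducible in $\mathbb{Z}[\zeta_p][x]$. Let $\sqrt[p]{\alpha}$ be a root of $x^p-\alpha$. Then the ring of integers of $\mathbb{Q}(\zeta_p,\sqrt[p]{\alpha})$ is $\mathbb{Z}[\zeta_p][\sqrt[p]{\alpha}]$ if and only if $\alpha$ is square-free as an ideal of $\mathbb{Z}[\zeta_p]$ and the congruence $$\alpha^p\equiv\alpha \pmod{(1-\zeta_p)^2}$$ is not satisfied.
   Context: "$\alpha$ is square-free as an ideal" means that the principal ideal $(\alpha)$ is not divisible by the square of any prime ideal; the unit ideal counts as square-free. -}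

module Defs where

open import Algebra.Apartness.Bundles using (HeytingField; HeytingCommutativeRing)
open import Algebra.Bundles using (CommutativeRing; RawRing; RawSemiring; Semiring)
open import Algebra.Morphism.Structures using (IsRingMonomorphism)
import Algebra.Definitions.RawSemiring as RawSemiringDefs
import Algebra.Morphism.RingMonomorphism as RingMonomorphism
open import Data.Integer.Base using (ℤ; +_; -[1+_]; 1ℤ)
open import Data.List.Base using (List; []; _∷_; _∷ʳ_; map)
open import Data.Nat.Base using (ℕ; zero; suc; _<_)
open import Data.Product.Base using (Σ; ∃; _×_; _,_; proj₁)
open import Data.Sum.Base using (_⊎_)
open import Level using (Level; _⊔_) renaming (suc to lsuc)
open import Relation.Binary.PropositionalEquality.Core using (_≡_)
open import Relation.Nullary.Negation.Core using (¬_)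
open import Relation.Unary using (Pred; _≐_; _∩_; _∪_; ｛_｝)

module Ideals {c ℓ} (R : CommutativeRing c ℓ) where
  open CommutativeRing R
  open Semiring semiring using (rawSemiring)
  open RawSemiringDefs rawSemiring using (_∣_)
  open RawSemiringDefs rawSemiring public using () renaming (_^_ to _^ᴿ_)

  Subset : Set (lsuc (c ⊔ ℓ))
  Subset = Pred Carrier (c ⊔ ℓ)

  record IsIdeal (I : Subset) : Set (c ⊔ ℓ) where
    field
      resp : ∀ {x y} → x ≈ y → I x → I y
      0∈   : I 0#
      +∈   : ∀ {x y} → I x → I y → I (x + y)
      *∈   : ∀ r {x} → I x → I (r * x)

  record IsPrimeIdeal (P : Subset) : Set (c ⊔ ℓ) where
    field
      isIdeal : IsIdeal P
      proper  : ¬ P 1#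
      prime   : ∀ {x y} → P (x * y) → P x ⊎ P y

  ⟨_⟩ : Carrier → Subset
  ⟨ a ⟩ x = a ∣ x

  -- Finite sums of products; closure under negation and under
  -- multiplication by R is inherited from the factors when these are ideals.
  infixl 7 _·_
  data _·_ (I J : Subset) : Pred Carrier (c ⊔ ℓ) where
    resp : ∀ {x y} → x ≈ y → (I · J) x → (I · J) y
    prod : ∀ {x y} → I x → J y → (I · J) (x * y)
    0∈   : (I · J) 0#
    +∈   : ∀ {x y} → (I · J) x → (I · J) y → (I · J) (x + y)

  infix 4 _∣ⁱ_
  _∣ⁱ_ : Subset → Subset → Set (lsuc (c ⊔ ℓ))
  I ∣ⁱ J = ∃ λ (K : Subset) → IsIdeal K × (J ≐ I · K)

  SquareFreeAsIdeal : Carrier → Set (lsuc (c ⊔ ℓ))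
  SquareFreeAsIdeal a =
    ∀ (P : Subset) → IsPrimeIdeal P → ¬ (P · P ∣ⁱ ⟨ a ⟩)

  infix 4 _≡_[mod_]
  _≡_[mod_] : Carrier → Carrier → Subset → Set (c ⊔ ℓ)
  x ≡ y [mod I ] = I (x - y)

-- A polynomial is the list of its coefficients, constant term first.
-- Trailing zeros are allowed; equality compares coefficients.
module Polynomials {c ℓ} (R : CommutativeRing c ℓ) where
  private module R = CommutativeRing R

  Poly : Set c
  Poly = List R.Carrier

  coeff : Poly → ℕ → R.Carrier
  coeff []      n       = R.0#
  coeff (a ∷ f) zero    = a
  coeff (a ∷ f) (suc n) = coeff f n

  infix  4 _≈ᴾ_
  infixl 6 _+ᴾ_
  infixl 7 _*ᴾ_

  _≈ᴾ_ : Poly → Poly → Set ℓ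
  f ≈ᴾ g = ∀ n → coeff f n R.≈ coeff g n

  _+ᴾ_ : Poly → Poly → Poly
  []      +ᴾ g       = g
  (a ∷ f) +ᴾ []      = a ∷ f
  (a ∷ f) +ᴾ (b ∷ g) = (a R.+ b) ∷ (f +ᴾ g)

  _*ᴾ_ : Poly → Poly → Poly
  []      *ᴾ g = []
  (a ∷ f) *ᴾ g = map (a R.*_) g +ᴾ (R.0# ∷ (f *ᴾ g))

  constant : R.Carrier → Poly
  constant a = a ∷ []

  X : Poly
  X = R.0# ∷ R.1# ∷ []

  rawSemiring : RawSemiring c ℓ
  rawSemiring = record
    { Carrier = Poly
    ; _≈_     = _≈ᴾ_
    ; _+_     = _+ᴾ_
    ; _*_     = _*ᴾ_
    ; 0#      = []
    ; 1#      = constant R.1#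
    }

  open RawSemiringDefs rawSemiring public
    using (Irreducible) renaming (_^_ to _^ᴾ_)

module FieldDefs {c ℓ₁ ℓ₂} (L : HeytingField c ℓ₁ ℓ₂) where

  commutativeRing : CommutativeRing c ℓ₁
  commutativeRing =
    HeytingCommutativeRing.commutativeRing (HeytingField.heytingCommutativeRing L)

  open CommutativeRing commutativeRing public
    using ( Carrier; _≈_; _+_; _*_; -_; 0#; 1#; refl
          ; rawRing; semiring; isCommutativeRing )
  open Semiring semiring using (rawSemiring)
  open RawSemiringDefs rawSemiring public using (_^_) renaming (_×_ to _×ₙ_)

  CharacteristicZero : Set ℓ₁
  CharacteristicZero = ∀ n → n ×ₙ 1# ≈ 0# → n ≡ 0

  IsPrimitiveRoot : Carrier → ℕ → Set ℓ₁
  IsPrimitiveRoot ζ n =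
    ζ ^ n ≈ 1# × (∀ k → 0 < k → k < n → ¬ (ζ ^ k ≈ 1#))

  data Subring⟨_⟩ {x} (S : Pred Carrier x) : Pred Carrier (c ⊔ ℓ₁ ⊔ x) where
    gen  : ∀ {a} → S a → Subring⟨ S ⟩ a
    resp : ∀ {a b} → a ≈ b → Subring⟨ S ⟩ a → Subring⟨ S ⟩ b
    0∈   : Subring⟨ S ⟩ 0#
    1∈   : Subring⟨ S ⟩ 1#
    +∈   : ∀ {a b} → Subring⟨ S ⟩ a → Subring⟨ S ⟩ b → Subring⟨ S ⟩ (a + b)
    *∈   : ∀ {a b} → Subring⟨ S ⟩ a → Subring⟨ S ⟩ b → Subring⟨ S ⟩ (a * b)
    -∈   : ∀ {a} → Subring⟨ S ⟩ a → Subring⟨ S ⟩ (- a)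

  data Subfield⟨_⟩ {x} (S : Pred Carrier x) : Pred Carrier (c ⊔ ℓ₁ ⊔ x) where
    gen  : ∀ {a} → S a → Subfield⟨ S ⟩ a
    resp : ∀ {a b} → a ≈ b → Subfield⟨ S ⟩ a → Subfield⟨ S ⟩ b
    0∈   : Subfield⟨ S ⟩ 0#
    1∈   : Subfield⟨ S ⟩ 1#
    +∈   : ∀ {a b} → Subfield⟨ S ⟩ a → Subfield⟨ S ⟩ b → Subfield⟨ S ⟩ (a + b)
    *∈   : ∀ {a b} → Subfield⟨ S ⟩ a → Subfield⟨ S ⟩ b → Subfield⟨ S ⟩ (a * b)
    -∈   : ∀ {a} → Subfield⟨ S ⟩ a → Subfield⟨ S ⟩ (- a)
    inv∈ : ∀ {a b} → a * b ≈ 1# → Subfield⟨ S ⟩ a → Subfield⟨ S ⟩ b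

  subring : ∀ {x} → Pred Carrier x → CommutativeRing (c ⊔ ℓ₁ ⊔ x) ℓ₁
  subring {x} S = record
    { isCommutativeRing =
        RingMonomorphism.isCommutativeRing proj₁-mono isCommutativeRing }
    where
    raw : RawRing (c ⊔ ℓ₁ ⊔ x) ℓ₁
    raw = record
      { Carrier = Σ Carrier Subring⟨ S ⟩
      ; _≈_     = λ u v → proj₁ u ≈ proj₁ v
      ; _+_     = λ { (a , p) (b , q) → a + b , +∈ p q }
      ; _*_     = λ { (a , p) (b , q) → a * b , *∈ p q }
      ; -_      = λ { (a , p) → - a , -∈ p }
      ; 0#      = 0# , 0∈
      ; 1#      = 1# , 1∈
      }

    proj₁-mono : IsRingMonomorphism raw rawRing proj₁
    proj₁-mono = record
      { isRingHomomorphism = record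
        { isSemiringHomomorphism = record
          { isNearSemiringHomomorphism = record
            { +-isMonoidHomomorphism = record
              { isMagmaHomomorphism = record
                { isRelHomomorphism = record { cong = λ e → e }
                ; homo = λ _ _ → refl
                }
              ; ε-homo = refl
              }
            ; *-homo = λ _ _ → refl
            }
          ; 1#-homo = refl
          }
        ; -‿homo = λ _ → refl
        }
      ; injective = λ e → e
      }

  fromℤ : ℤ → Carrier
  fromℤ (+ n)      = n ×ₙ 1#
  fromℤ (-[1+ n ]) = - (suc n ×ₙ 1#)

  -- Constant term first.
  evalℤ : List ℤ → Carrier → Carrier
  evalℤ []       x = 0#
  evalℤ (a ∷ as) x = fromℤ a + x * evalℤ as x

  Integral : Pred Carrier ℓ₁
  Integral x = ∃ λ (as : List ℤ) → evalℤ (as ∷ʳ 1ℤ) x ≈ 0#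

  -- The ring of integers of a subfield K of L.
  𝓞 : ∀ {k} → Pred Carrier k → Pred Carrier (ℓ₁ ⊔ k)
  𝓞 K = K ∩ Integral

  ℤ[_] : Carrier → CommutativeRing (c ⊔ ℓ₁) ℓ₁
  ℤ[ ζ ] = subring ｛ ζ ｝

  ℤ[_][_] : Carrier → Carrier → Pred Carrier (c ⊔ ℓ₁)
  ℤ[ ζ ][ θ ] = Subring⟨ Subring⟨ ｛ ζ ｝ ⟩ ∪ ｛ θ ｝ ⟩

  -- In characteristic zero the subfield generated by S contains ℚ.
  ℚ⟮_,_⟯ : Carrier → Carrier → Pred Carrier (c ⊔ ℓ₁)
  ℚ⟮ ζ , θ ⟯ = Subfield⟨ ｛ ζ ｝ ∪ ｛ θ ｝ ⟩

  root : ∀ ζ → CommutativeRing.Carrier ℤ[ ζ ]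
  root ζ = ζ , gen _≡_.refl

{-# OPTIONS --safe #-}

-- Put R = ℤ[ζ], S = R[θ] with θᵖ = α, and λ = 1 - ζ, so that p is λᵖ⁻¹ times a
-- unit. An integral element x of the field is a quotient s / n with s in S,
-- and primes q are removed from n one at a time.
--
-- For q ≠ p, every r in R satisfies r^(qᵖ⁻¹) ≡ r mod q, so R / q is von Neumann
-- regular. The element f = α^(qᵖ⁻¹ - 1) is idempotent mod q. Frobenius shows
-- that f (S / q) is reduced, and on the complement of f each coefficient c of x
-- leads to some cᵖ αᵖ⁻¹ in R. If c were not in R, a primitive idempotent e
-- of R / q with e c ≠ 0 would give a prime P = { x | e x ≡ 0 mod q } with P² ∣ α.
-- For q = p, the element y = θ - α satisfies an Eisenstein equation at λ when
-- αᵖ ≢ α mod λ², and S is λ-maximal by descent on the powers of y.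
--
-- Conversely, suppose S is integrally closed. If (α) = P² J, then for v in P J the
-- element w = v θᵖ⁻¹ / α has w² in S, so w is in S and α ∣ v; hence α lies in
-- α P and 1 in P. If αᵖ ≡ α mod λ², then w = (θ - α)ᵖ⁻¹ / λ also has w² in S, but
-- its leading coefficient 1 / λ is not in R.
--
-- Inverses of nonzero elements of L are only available under a double negation,
-- so a quotient s / n is always given as an element z with n z = s.

module Submission where

open import Defs
open import Algebra.Apartness.Bundles using (HeytingField)
open import Algebra.Bundles using (CommutativeRing; CommutativeSemiring)
import Algebra.Definitions.RawMagma as RawMagma
import Algebra.Definitions.RawSemiring as RawSemiringDefs
import Algebra.Properties.CommutativeSemiring.Binomial
import Algebra.Properties.CommutativeSemiring.Exp
import Algebra.Properties.Ring
import Algebra.Properties.Semiring.Mult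
import Algebra.Properties.Semiring.Mult.TCOptimised
import Algebra.Properties.Semiring.Sum
import Algebra.Solver.Ring
import Algebra.Solver.Ring.AlmostCommutativeRing as ACR
open import Data.Bool.Base using (T)
open import Data.Empty using (⊥; ⊥-elim)
open import Data.Fin.Base as Fin using (Fin; fromℕ; inject₁; toℕ)
open import Data.Fin.Properties using (toℕ-fromℕ; toℕ-inject₁; toℕ<n)
open import Data.Integer.Base as ℤ using (+_; -[1+_]; 0ℤ; 1ℤ; _⊖_; ℤ)
import Data.Integer.DivMod as ℤ
open import Data.Integer.Divisibility.Signed using (divides; ∣ᵤ⇒∣)
import Data.Integer.Properties as ℤ
open import Data.List.Base using (List; []; _++_; _∷_; _∷ʳ_; _∷ʳ′_; cartesianProductWith; concatMap; initLast; length; map; replicate; upTo; zipWith)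
open import Data.List.Membership.Propositional using (_∈_; lose)
open import Data.List.Membership.Propositional.Properties using (∈-++⁻; ∈-cartesianProductWith⁺; ∈-map⁻; ∈-upTo⁺)
open import Data.List.Properties using (length-++; length-map; length-replicate)
open import Data.List.Relation.Unary.All as All using (All; []; _∷_)
import Data.List.Relation.Unary.All.Properties as All
open import Data.List.Relation.Unary.AllPairs using (AllPairs; []; _∷_)
open import Data.List.Relation.Unary.Any using (Any; here; there)
open import Data.Maybe.Base as Maybe using (just; nothing; is-just)
open import Data.Nat.Base as ℕ using (_!; _<_; _∸_; _≤_; suc; s≤s; zero; z≤n; ℕ)
open import Data.Nat.Combinatorics using (_C_; k![n∸k]!∣n!; nCk≡n!/k![n-k]!; nCn≡1)
open import Data.Nat.DivMod using (_%_; _/_; m%n<n; m/n*n≡m; m≡m%n+[m/n]*n)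
open import Data.Nat.Divisibility as ℕ using (_∣_)
open import Data.Nat.ListAction using (product)
open import Data.Nat.Primality using (Prime; euclidsLemma; prime⇒irreducible; prime⇒nonTrivial; prime⇒nonZero; ¬prime[0]; ¬prime[1])
open import Data.Nat.Primality.Factorisation using (PrimeFactorisation; factorise)
import Data.Nat.Properties as ℕ
open import Data.Product.Base using (_,_; _×_; proj₁; proj₂; Σ; ∃)
open import Data.Sum.Base as Sum using (_⊎_; inj₁; inj₂)
open import Data.Vec.N-ary using (N-ary; Eq; curryⁿ; curryⁿ-cong)
open import Function.Bundles using (_⇔_; mk⇔)
open import Level using (_⊔_)
open import Relation.Binary.Consequences using (dec⇒weaklyDec)
open import Relation.Binary.PropositionalEquality.Core as ≡ using (_≡_)
open import Relation.Binary.PropositionalEquality.Properties using (module ≡-Reasoning)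
import Relation.Binary.Reasoning.Setoid
import Relation.Binary.Reflection as Reflection
open import Relation.Nullary.Decidable.Core using (Dec; map′; no; yes)
open import Relation.Nullary.Negation.Core using (contradiction; ¬_)
open import Relation.Unary using (Pred; _∪_; _≐_; _⊆_; ｛_｝)

-- Equality in `L` is not assumed decidable, so factorisation of ideals, norms and valuations give
-- way to elementary devices. An integral equation for z = s / q makes a power of s divisible by q.
-- What matters is therefore that residue rings have no nilpotents, and a power map with fixed
-- points shows this. Decisions are taken in R alone: its elements are integer polynomials in λ with
-- p - 1 independent coefficients, so R / q is a finite list with decidable equality, and a prime
-- above q is found by refining an idempotent along that list. The exponent qᵖ⁻¹ comes from Fermat:
-- it is 1 modulo p, so raising to it fixes ζ. At λ, p-th powers imitate valuations: p divides λᵖ,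
-- so an integer that is λ times an integral element has its p-th power divisible by p. Since R / λ
-- comes from ℤ, αᵖ ≡ α mod λ always holds; failure of the congruence modulo λ² says that (θ - α)ᵖ
-- is λ times an element prime to λ. Irreducibility enters as θ ∉ R, from which the independence of
-- 1, θ, ..., θᵖ⁻¹ over R is derived by rotating a minimal relation.

-- A ring solver with integer coefficients

module IntegerSolver {c ℓ} (B : CommutativeRing c ℓ) where
  open CommutativeRing B
  open Algebra.Properties.Ring ring
    using (-0#≈0#; -‿distribˡ-*; -‿distribʳ-*; -‿involutive; -‿+-comm)
  open Algebra.Properties.Semiring.Mult.TCOptimised semiring
    using () renaming (_×_ to _×′_; ×-homo-+ to ×′-homo-+; ×1-homo-* to ×′1-homo-*)
  open Relation.Binary.Reasoning.Setoid setoid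

  -- With the optimised multiples the numerals 0 and 1 denote 0# and 1# on the nose.
  ⟦_⟧ᶻ : ℤ → Carrier
  ⟦ + n ⟧ᶻ      = n ×′ 1#
  ⟦ -[1+ n ] ⟧ᶻ = - (suc n ×′ 1#)

  ×′-suc : ∀ n → suc n ×′ 1# ≈ 1# + n ×′ 1#
  ×′-suc n = ×′-homo-+ 1# 1 n

  cancel-middle : ∀ a x y → (a + x) - (a + y) ≈ x - y
  cancel-middle a x y = begin
    (a + x) + - (a + y)  ≈⟨ +-cong (+-comm a x) (sym (-‿+-comm a y)) ⟩
    (x + a) + (- a + - y)  ≈⟨ +-assoc x a _ ⟩
    x + (a + (- a + - y))  ≈⟨ +-congˡ (+-assoc a _ _) ⟨
    x + ((a + - a) + - y)  ≈⟨ +-congˡ (+-congʳ (-‿inverseʳ a)) ⟩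
    x + (0# + - y)  ≈⟨ +-congˡ (+-identityˡ _) ⟩
    x - y  ∎

  ⊖-homo : ∀ m n → ⟦ m ⊖ n ⟧ᶻ ≈ m ×′ 1# - n ×′ 1#
  ⊖-homo m zero = begin
    m ×′ 1#  ≈⟨ +-identityʳ _ ⟨
    m ×′ 1# + 0#  ≈⟨ +-congˡ -0#≈0# ⟨
    m ×′ 1# - 0#  ∎
  ⊖-homo zero (suc n) = sym (+-identityˡ _)
  ⊖-homo (suc m) (suc n) = begin
    ⟦ suc m ⊖ suc n ⟧ᶻ  ≡⟨ ≡.cong ⟦_⟧ᶻ (ℤ.[1+m]⊖[1+n]≡m⊖n m n) ⟩
    ⟦ m ⊖ n ⟧ᶻ  ≈⟨ ⊖-homo m n ⟩
    m ×′ 1# - n ×′ 1#  ≈⟨ cancel-middle 1# _ _ ⟨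
    (1# + m ×′ 1#) - (1# + n ×′ 1#)  ≈⟨ +-cong (×′-suc m) (-‿cong (×′-suc n)) ⟨
    suc m ×′ 1# - suc n ×′ 1#  ∎

  +-homoᶻ : ∀ i j → ⟦ i ℤ.+ j ⟧ᶻ ≈ ⟦ i ⟧ᶻ + ⟦ j ⟧ᶻ
  +-homoᶻ (+ m)    (+ n)    = ×′-homo-+ 1# m n
  +-homoᶻ (+ m)    -[1+ n ] = ⊖-homo m (suc n)
  +-homoᶻ -[1+ m ] (+ n)    = trans (⊖-homo n (suc m)) (+-comm _ _)
  +-homoᶻ -[1+ m ] -[1+ n ] = begin
    - (suc (suc (m ℕ.+ n)) ×′ 1#)  ≡⟨ ≡.cong (λ k → - (suc k ×′ 1#)) (≡.sym (ℕ.+-suc m n)) ⟩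
    - ((suc m ℕ.+ suc n) ×′ 1#)  ≈⟨ -‿cong (×′-homo-+ 1# (suc m) (suc n)) ⟩
    - (suc m ×′ 1# + suc n ×′ 1#)  ≈⟨ -‿+-comm _ _ ⟨
    - (suc m ×′ 1#) + - (suc n ×′ 1#)  ∎

  -‿homoᶻ : ∀ i → ⟦ ℤ.- i ⟧ᶻ ≈ - ⟦ i ⟧ᶻ
  -‿homoᶻ (+ zero)  = sym -0#≈0#
  -‿homoᶻ (+ suc n) = refl
  -‿homoᶻ -[1+ n ]  = sym (-‿involutive _)

  *-homo-+ᶻ : ∀ m j → ⟦ + m ℤ.* j ⟧ᶻ ≈ ⟦ + m ⟧ᶻ * ⟦ j ⟧ᶻ
  *-homo-+ᶻ m (+ n) = trans (reflexive (≡.cong ⟦_⟧ᶻ (≡.sym (ℤ.pos-* m n)))) (×′1-homo-* m n)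
  *-homo-+ᶻ m -[1+ n ] = begin
    ⟦ + m ℤ.* (ℤ.- (+ suc n)) ⟧ᶻ  ≡⟨ ≡.cong ⟦_⟧ᶻ (≡.sym (ℤ.neg-distribʳ-* (+ m) (+ suc n))) ⟩
    ⟦ ℤ.- (+ m ℤ.* + suc n) ⟧ᶻ  ≈⟨ -‿homoᶻ (+ m ℤ.* + suc n) ⟩
    - ⟦ + m ℤ.* + suc n ⟧ᶻ  ≈⟨ -‿cong (*-homo-+ᶻ m (+ suc n)) ⟩
    - (⟦ + m ⟧ᶻ * ⟦ + suc n ⟧ᶻ)  ≈⟨ -‿distribʳ-* _ _ ⟩
    ⟦ + m ⟧ᶻ * - ⟦ + suc n ⟧ᶻ  ∎

  *-homoᶻ : ∀ i j → ⟦ i ℤ.* j ⟧ᶻ ≈ ⟦ i ⟧ᶻ * ⟦ j ⟧ᶻ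
  *-homoᶻ (+ m) j = *-homo-+ᶻ m j
  *-homoᶻ -[1+ m ] j = begin
    ⟦ (ℤ.- (+ suc m)) ℤ.* j ⟧ᶻ  ≡⟨ ≡.cong ⟦_⟧ᶻ (≡.sym (ℤ.neg-distribˡ-* (+ suc m) j)) ⟩
    ⟦ ℤ.- (+ suc m ℤ.* j) ⟧ᶻ  ≈⟨ -‿homoᶻ (+ suc m ℤ.* j) ⟩
    - ⟦ + suc m ℤ.* j ⟧ᶻ  ≈⟨ -‿cong (*-homo-+ᶻ (suc m) j) ⟩
    - (⟦ + suc m ⟧ᶻ * ⟦ j ⟧ᶻ)  ≈⟨ -‿distribˡ-* _ _ ⟩
    - ⟦ + suc m ⟧ᶻ * ⟦ j ⟧ᶻ  ∎

  morphism : ℤ.+-*-rawRing ACR.-Raw-AlmostCommutative⟶ ACR.fromCommutativeRing B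
  morphism = record
    { ⟦_⟧    = ⟦_⟧ᶻ
    ; +-homo = +-homoᶻ
    ; *-homo = *-homoᶻ
    ; -‿homo = -‿homoᶻ
    ; 0-homo = refl
    ; 1-homo = refl
    }

  private module Solver = Algebra.Solver.Ring ℤ.+-*-rawRing (ACR.fromCommutativeRing B) morphism
            (λ i j → Maybe.map (λ i≡j → reflexive (≡.cong ⟦_⟧ᶻ i≡j)) (dec⇒weaklyDec ℤ._≟_ i j))

  open Solver hiding (solve)
  open Solver public using (con; _:=_; _:+_; _:*_; _:-_; :-_)
  open Reflection setoid var ⟦_⟧ ⟦_⟧↓ correct using (close)

  Provable : ∀ {n} → Polynomial n × Polynomial n → Set
  Provable (e₁ , e₂) = T (is-just (normalise e₁ ≟N normalise e₂))

  provable⇒≈ : ∀ {n} e₁ e₂ → Provable {n} (e₁ , e₂) → ∀ ρ → ⟦ e₁ ⟧ ρ ≈ ⟦ e₂ ⟧ ρ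
  provable⇒≈ e₁ e₂ _  ρ with normalise e₁ ≟N normalise e₂
  ... | just e₁≈e₂ = prove ρ e₁ e₂ (⟦ e₁≈e₂ ⟧N-cong ρ)
  provable⇒≈ e₁ e₂ () ρ | nothing

  -- Unlike the solver of the library, this one compares normal forms as syntax,
  -- so that they do not become part of the proof terms.
  solve : ∀ n (f : N-ary n (Polynomial n) (Polynomial n × Polynomial n)) {_ : Provable (close n f)} →
          Eq n _≈_ (curryⁿ ⟦ proj₁ (close n f) ⟧) (curryⁿ ⟦ proj₂ (close n f) ⟧)
  solve n f {provable} = curryⁿ-cong _≈_ ⟦ proj₁ (close n f) ⟧ ⟦ proj₂ (close n f) ⟧
    (provable⇒≈ (proj₁ (close n f)) (proj₂ (close n f)) provable)

-- Binomial coefficients and Fermat's little theorem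

prime∤! : ∀ {p} → Prime p → ∀ {k} → k < p → ¬ (p ℕ.∣ k !)
prime∤! pr {zero}  _   d = ℕ.>⇒∤ (ℕ.nonTrivial⇒n>1 _ {{prime⇒nonTrivial pr}}) d
prime∤! pr {suc k} k<p d with euclidsLemma (suc k) (k !) pr d
... | inj₁ d′ = ℕ.>⇒∤ k<p d′
... | inj₂ d′ = prime∤! pr (ℕ.<-trans (ℕ.n<1+n k) k<p) d′

-- `p` divides `p !`, which is `p C k` times `k !` times `(p ∸ k) !`, and neither of these
-- factorials has a factor `p`.
prime∣binomial : ∀ {p} → Prime p → ∀ {k} → 0 < k → k < p → p ℕ.∣ p C k
prime∣binomial {p@(suc m)} pr {k} 0<k k<p
  with euclidsLemma (p C k) (k ! ℕ.* (p ∸ k) !) pr (≡.subst (p ℕ.∣_) p!≡ (ℕ.∣m⇒∣m*n (m !) ℕ.∣-refl))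
  where
  k≤p = ℕ.<⇒≤ k<p
  instance _ = ℕ.m*n≢0 (k !) ((p ∸ k) !) {{k ℕ.!≢0}} {{(p ∸ k) ℕ.!≢0}}
  p!≡ : p ! ≡ (p C k) ℕ.* (k ! ℕ.* (p ∸ k) !)
  p!≡ = ≡.sym (≡.trans (≡.cong (ℕ._* (k ! ℕ.* (p ∸ k) !)) (nCk≡n!/k![n-k]! k≤p)) (m/n*n≡m (k![n∸k]!∣n! k≤p)))
... | inj₁ d = d
... | inj₂ d with euclidsLemma (k !) ((p ∸ k) !) pr d
...   | inj₁ d′ = ⊥-elim (prime∤! pr k<p d′)
...   | inj₂ d′ = ⊥-elim (prime∤! pr (ℕ.∸-monoʳ-< 0<k k≤p) d′)
  where k≤p = ℕ.<⇒≤ k<p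

module Freshman {c ℓ} (B : CommutativeSemiring c ℓ) where
  open CommutativeSemiring B hiding (zero)
  open Algebra.Properties.Semiring.Mult semiring renaming (_×_ to _×ₙ_)
  open Algebra.Properties.Semiring.Sum semiring using (sum; sum-init-last)
  open Algebra.Properties.CommutativeSemiring.Exp B
  open Algebra.Properties.CommutativeSemiring.Binomial B using (binomialTerm; binomial) renaming (theorem to binomial-theorem)
  open Relation.Binary.Reasoning.Setoid setoid

  sum-× : ∀ n {k} (f g : Fin k → Carrier) → (∀ i → f i ≈ n ×ₙ g i) → sum f ≈ n ×ₙ sum g
  sum-× n {zero}  f g e = sym (×-zero n)
    where
    ×-zero : ∀ n → n ×ₙ 0# ≈ 0#
    ×-zero zero    = refl
    ×-zero (suc n) = trans (+-identityˡ _) (×-zero n)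
  sum-× n {suc k} f g e = begin
    f Fin.zero + sum (λ i → f (Fin.suc i))
      ≈⟨ +-cong (e Fin.zero) (sum-× n _ (λ i → g (Fin.suc i)) (λ i → e (Fin.suc i))) ⟩
    n ×ₙ g Fin.zero + n ×ₙ sum (λ i → g (Fin.suc i))  ≈⟨ ×-distrib-+ (g Fin.zero) _ n ⟨
    n ×ₙ sum g  ∎
    where open import Algebra.Properties.CommutativeMonoid.Mult +-commutativeMonoid using (×-distrib-+)

  ×-∣ : ∀ {m n} (d : m ℕ.∣ n) x → n ×ₙ x ≈ m ×ₙ (ℕ.quotient d ×ₙ x)
  ×-∣ {m} {n} d x = begin
    n ×ₙ x  ≡⟨ ≡.cong (_×ₙ x) (ℕ.m∣n⇒n≡m*quotient d) ⟩
    (m ℕ.* ℕ.quotient d) ×ₙ x  ≈⟨ ×-assocˡ x m (ℕ.quotient d) ⟨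
    m ×ₙ (ℕ.quotient d ×ₙ x)  ∎

  -- Keeping the error term `p ×ₙ t` lets one lemma serve several purposes: over ℕ it gives Fermat's
  -- little theorem, in R and S it gives p-th powers up to multiples of p, and in residue rings of
  -- characteristic p the term vanishes.
  freshman : ∀ {p} → Prime p → ∀ x y → ∃ λ t → (x + y) ^ p ≈ x ^ p + y ^ p + p ×ₙ t
  freshman {p@(suc m)} pr x y = sum middle , (begin
    (x + y) ^ p  ≈⟨ binomial-theorem p x y ⟩
    sum (binomialTerm x y p)  ≈⟨ +-congˡ (sum-init-last (λ i → binomialTerm x y p (Fin.suc i))) ⟩
    binomialTerm x y p Fin.zero + (sum (λ i → binomialTerm x y p (Fin.suc (inject₁ i))) + binomialTerm x y p (fromℕ p))
      ≈⟨ +-cong first (+-cong (sum-× p _ middle term-middle) last) ⟩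
    y ^ p + (p ×ₙ sum middle + x ^ p)  ≈⟨ +-congˡ (+-comm _ _) ⟩
    y ^ p + (x ^ p + p ×ₙ sum middle)  ≈⟨ +-assoc _ _ _ ⟨
    y ^ p + x ^ p + p ×ₙ sum middle  ≈⟨ +-congʳ (+-comm _ _) ⟩
    x ^ p + y ^ p + p ×ₙ sum middle  ∎)
    where
    first : binomialTerm x y p Fin.zero ≈ y ^ p
    first = trans (+-identityʳ _) (*-identityˡ _)

    last : binomialTerm x y p (fromℕ p) ≈ x ^ p
    last rewrite toℕ-fromℕ m | nCn≡1 p | ℕ.n∸n≡0 m = trans (+-identityʳ _) (*-identityʳ _)

    divisible : ∀ (i : Fin m) → p ℕ.∣ p C toℕ (Fin.suc (inject₁ i))
    divisible i rewrite toℕ-inject₁ i = prime∣binomial pr (s≤s z≤n) (s≤s (toℕ<n i))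

    middle : Fin m → Carrier
    middle i = ℕ.quotient (divisible i) ×ₙ binomial x y p (Fin.suc (inject₁ i))

    term-middle : ∀ i → binomialTerm x y p (Fin.suc (inject₁ i)) ≈ p ×ₙ middle i
    term-middle i = ×-∣ (divisible i) _

module _ where
  open Freshman ℕ.+-*-commutativeSemiring
  open Algebra.Properties.Semiring.Mult ℕ.+-*-semiring renaming (_×_ to _×ₙ_)

  ×≡* : ∀ m n → m ×ₙ n ≡ m ℕ.* n
  ×≡* zero    n = ≡.refl
  ×≡* (suc m) n = ≡.cong (n ℕ.+_) (×≡* m n)

  open Algebra.Properties.CommutativeSemiring.Exp ℕ.+-*-commutativeSemiring renaming (_^_ to _^ₙ_)

  ^≡^ : ∀ m n → m ^ₙ n ≡ m ℕ.^ n
  ^≡^ m zero    = ≡.refl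
  ^≡^ m (suc n) = ≡.cong (m ℕ.*_) (^≡^ m n)

  fermat : ∀ {p} → Prime p → ∀ n → ∃ λ t → n ℕ.^ p ≡ n ℕ.+ p ℕ.* t
  fermat {suc m} pr zero = 0 , ≡.sym (ℕ.*-zeroʳ m)
  fermat {p} pr (suc n) with fermat pr n | freshman pr 1 n
  ... | t , e | u , e′ = t ℕ.+ u , (begin
      suc n ℕ.^ p  ≡⟨ ^≡^ (suc n) p ⟨
      suc n ^ₙ p  ≡⟨ e′ ⟩
      1 ^ₙ p ℕ.+ n ^ₙ p ℕ.+ p ×ₙ u
        ≡⟨ ≡.cong₂ ℕ._+_ (≡.cong₂ ℕ._+_ (≡.trans (^≡^ 1 p) (ℕ.^-zeroˡ p)) (≡.trans (^≡^ n p) e)) (×≡* p u) ⟩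
      suc (n ℕ.+ p ℕ.* t ℕ.+ p ℕ.* u)  ≡⟨ ≡.cong suc (ℕ.+-assoc n _ _) ⟩
      suc (n ℕ.+ (p ℕ.* t ℕ.+ p ℕ.* u))  ≡⟨ ≡.cong (λ k → suc (n ℕ.+ k)) (ℕ.*-distribˡ-+ p t u) ⟨
      suc n ℕ.+ p ℕ.* (t ℕ.+ u)  ∎)
      where open ≡-Reasoning

  -- Fermat makes n · (nᵖ⁻¹ - 1) a multiple of p, and Euclid's lemma leaves the second factor.
  fermat-unit : ∀ {p} → Prime p → ∀ n .{{_ : ℕ.NonZero n}} → ¬ (p ℕ.∣ n) → ∃ λ j → n ℕ.^ (ℕ.pred p) ≡ 1 ℕ.+ p ℕ.* j
  fermat-unit {p@(suc m)} pr n p∤n with fermat pr n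
  ... | t , e with euclidsLemma n (n ℕ.^ m ∸ 1) pr (ℕ.divides t eq)
    where
    open ≡-Reasoning
    eq : n ℕ.* (n ℕ.^ m ∸ 1) ≡ t ℕ.* p
    eq = begin
      n ℕ.* (n ℕ.^ m ∸ 1)  ≡⟨ ℕ.*-distribˡ-∸ n (n ℕ.^ m) 1 ⟩
      n ℕ.^ p ∸ n ℕ.* 1  ≡⟨ ≡.cong₂ _∸_ e (ℕ.*-identityʳ n) ⟩
      n ℕ.+ p ℕ.* t ∸ n  ≡⟨ ℕ.m+n∸m≡n n _ ⟩
      p ℕ.* t  ≡⟨ ℕ.*-comm p t ⟩
      t ℕ.* p  ∎
  ... | inj₁ d = ⊥-elim (p∤n d)
  ... | inj₂ (ℕ.divides j e′) = j , (≡.trans (≡.sym (ℕ.m+[n∸m]≡n (ℕ.m^n>0 n m))) (≡.cong suc (≡.trans e′ (ℕ.*-comm j p))))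

-- Residue rings and the Frobenius map

module Quotient {c ℓ} (B : CommutativeRing c ℓ) (m : CommutativeRing.Carrier B) where
  open CommutativeRing B
  open IntegerSolver B
  open Relation.Binary.Reasoning.Setoid setoid

  infix 4 _≈ₘ_
  _≈ₘ_ : Carrier → Carrier → Set (c ⊔ ℓ)
  x ≈ₘ y = ∃ λ t → x ≈ y + m * t

  ≈⇒≈ₘ : ∀ {x y} → x ≈ y → x ≈ₘ y
  ≈⇒≈ₘ {x} {y} x≈y = 0# , trans x≈y (solve 2 (λ y m → y := y :+ m :* con 0ℤ) y m)

  -- The carrier and the operations stay those of `B` and only equality becomes coarser, so no
  -- representatives have to be chosen or lifted.
  residueRing : CommutativeRing c (c ⊔ ℓ)
  residueRing = record
    { Carrier = Carrier ; _≈_ = _≈ₘ_ ; _+_ = _+_ ; _*_ = _*_ ; -_ = -_ ; 0# = 0# ; 1# = 1#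
    ; isCommutativeRing = record
      { isRing = record
        { +-isAbelianGroup = record
          { isGroup = record
            { isMonoid = record
              { isSemigroup = record
                { isMagma = record
                  { isEquivalence = record
                    { refl  = ≈⇒≈ₘ refl
                    ; sym   = λ { {x} {y} (t , e) → - t , (begin
                        y  ≈⟨ solve 3 (λ y m t → y := y :+ m :* t :+ m :* (:- t)) y m t ⟩
                        y + m * t + m * - t  ≈⟨ +-congʳ e ⟨
                        x + m * - t  ∎) }
                    ; trans = λ { {x} {y} {z} (t , e) (u , f) → t + u , (begin
                        x  ≈⟨ trans e (+-congʳ f) ⟩
                        z + m * u + m * t
                          ≈⟨ solve 4 (λ z m t u → z :+ m :* u :+ m :* t := z :+ m :* (t :+ u)) z m t u ⟩
                        z + m * (t + u)  ∎) }
                    }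
                  ; ∙-cong = λ { {x} {y} {u} {v} (s , e) (t , f) → s + t , (begin
                      x + u  ≈⟨ +-cong e f ⟩
                      y + m * s + (v + m * t)
                        ≈⟨ solve 5 (λ y v m s t → y :+ m :* s :+ (v :+ m :* t) := y :+ v :+ m :* (s :+ t)) y v m s t ⟩
                      y + v + m * (s + t)  ∎) }
                  }
                ; assoc = λ x y z → ≈⇒≈ₘ (+-assoc x y z)
                }
              ; identity = (λ x → ≈⇒≈ₘ (+-identityˡ x)) , (λ x → ≈⇒≈ₘ (+-identityʳ x))
              }
            ; inverse = (λ x → ≈⇒≈ₘ (-‿inverseˡ x)) , (λ x → ≈⇒≈ₘ (-‿inverseʳ x))
            ; ⁻¹-cong = λ { {x} {y} (t , e) → - t , (begin
                - x  ≈⟨ -‿cong e ⟩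
                - (y + m * t)  ≈⟨ solve 3 (λ y m t → :- (y :+ m :* t) := :- y :+ m :* (:- t)) y m t ⟩
                - y + m * - t  ∎) }
            }
          ; comm = λ x y → ≈⇒≈ₘ (+-comm x y)
          }
        ; *-cong = λ { {x} {y} {u} {v} (s , e) (t , f) → (s * v + y * t + m * (s * t)) , (begin
            x * u  ≈⟨ *-cong e f ⟩
            (y + m * s) * (v + m * t)
              ≈⟨ solve 5 (λ y v m s t → (y :+ m :* s) :* (v :+ m :* t) := y :* v :+ m :* (s :* v :+ y :* t :+ m :* (s :* t))) y v m s t ⟩
            y * v + m * (s * v + y * t + m * (s * t)) ∎) }
        ; *-assoc = λ x y z → ≈⇒≈ₘ (*-assoc x y z)
        ; *-identity = (λ x → ≈⇒≈ₘ (*-identityˡ x)) , (λ x → ≈⇒≈ₘ (*-identityʳ x))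
        ; distrib = (λ x y z → ≈⇒≈ₘ (distribˡ x y z)) , (λ x y z → ≈⇒≈ₘ (distribʳ x y z))
        }
      ; *-comm = λ x y → ≈⇒≈ₘ (*-comm x y)
      }
    }

  open Algebra.Properties.Semiring.Mult semiring renaming (_×_ to _×ₙ_)
  open Algebra.Properties.Semiring.Mult (CommutativeRing.semiring residueRing) using () renaming (_×_ to _×ₘ_)
  open Algebra.Properties.CommutativeSemiring.Exp commutativeSemiring
  open Algebra.Properties.CommutativeSemiring.Exp (CommutativeRing.commutativeSemiring residueRing) using () renaming (_^_ to _^ₘ_)

  ×ₘ≡× : ∀ n x → n ×ₘ x ≡ n ×ₙ x
  ×ₘ≡× zero    x = ≡.refl
  ×ₘ≡× (suc n) x = ≡.cong (λ y → x + y) (×ₘ≡× n x)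

  ^ₘ≡^ : ∀ x n → x ^ₘ n ≡ x ^ n
  ^ₘ≡^ x zero    = ≡.refl
  ^ₘ≡^ x (suc n) = ≡.cong (λ y → x * y) (^ₘ≡^ x n)

module Frobenius {c ℓ} (B : CommutativeRing c ℓ)
  {p : ℕ} (pr : Prime p)
  (char : CommutativeRing._≈_ B
    (Algebra.Properties.Semiring.Mult._×_ (CommutativeRing.semiring B) p (CommutativeRing.1# B))
    (CommutativeRing.0# B)) where
  open CommutativeRing B hiding (zero)
  open Algebra.Properties.Semiring.Mult semiring renaming (_×_ to _×ₙ_)
  open Algebra.Properties.CommutativeSemiring.Exp commutativeSemiring
  open Freshman commutativeSemiring using (freshman)
  open Relation.Binary.Reasoning.Setoid setoid

  p×≈0 : ∀ t → p ×ₙ t ≈ 0#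
  p×≈0 t = begin
    p ×ₙ t  ≈⟨ ×-congʳ p (*-identityˡ t) ⟨
    p ×ₙ (1# * t)  ≈⟨ ×-assoc-* p 1# t ⟨
    (p ×ₙ 1#) * t  ≈⟨ *-congʳ char ⟩
    0# * t  ≈⟨ zeroˡ t ⟩
    0#  ∎

  ^p-homo-+ : ∀ x y → (x + y) ^ p ≈ x ^ p + y ^ p
  ^p-homo-+ x y with freshman pr x y
  ... | t , e = trans e (trans (+-congˡ (p×≈0 t)) (+-identityʳ _))

  ^pᵏ-homo-+ : ∀ k x y → (x + y) ^ (p ℕ.^ k) ≈ x ^ (p ℕ.^ k) + y ^ (p ℕ.^ k)
  ^pᵏ-homo-+ zero    x y = trans (*-identityʳ _) (+-cong (sym (*-identityʳ x)) (sym (*-identityʳ y)))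
  ^pᵏ-homo-+ (suc k) x y = begin
    (x + y) ^ (p ℕ.* p ℕ.^ k)  ≈⟨ ^-assocʳ (x + y) p (p ℕ.^ k) ⟨
    ((x + y) ^ p) ^ (p ℕ.^ k)  ≈⟨ ^-congˡ (p ℕ.^ k) (^p-homo-+ x y) ⟩
    (x ^ p + y ^ p) ^ (p ℕ.^ k)  ≈⟨ ^pᵏ-homo-+ k _ _ ⟩
    (x ^ p) ^ (p ℕ.^ k) + (y ^ p) ^ (p ℕ.^ k)  ≈⟨ +-cong (^-assocʳ x p (p ℕ.^ k)) (^-assocʳ y p (p ℕ.^ k)) ⟩
    x ^ (p ℕ.* p ℕ.^ k) + y ^ (p ℕ.* p ℕ.^ k)  ∎

  module Fixed (f : Carrier) (k : ℕ) where
    Q = p ℕ.^ k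

    -- The weight `f` covers two cases: it is 1 for R modulo q, and for S it is an idempotent power
    -- of α, which cuts out the part of the residue ring where α is invertible.
    IsFixed : Carrier → Set ℓ
    IsFixed x = f * x ^ Q ≈ f * x

    fixed-resp : ∀ {x y} → x ≈ y → IsFixed x → IsFixed y
    fixed-resp x≈y e = trans (*-congˡ (sym (^-congˡ Q x≈y))) (trans e (*-congˡ x≈y))

    0^Q : 0# ^ Q ≈ 0#
    0^Q = 0^ Q {{ℕ.m^n≢0 p k {{prime⇒nonZero pr}}}}
      where
      0^ : ∀ n .{{_ : ℕ.NonZero n}} → 0# ^ n ≈ 0#
      0^ (suc n) = zeroˡ _

    fixed-0 : IsFixed 0#
    fixed-0 = *-congˡ 0^Q

    fixed-1 : IsFixed 1#
    fixed-1 = *-congˡ (1^ Q)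
      where
      1^ : ∀ n → 1# ^ n ≈ 1#
      1^ zero    = refl
      1^ (suc n) = trans (*-identityˡ _) (1^ n)

    fixed-+ : ∀ {x y} → IsFixed x → IsFixed y → IsFixed (x + y)
    fixed-+ {x} {y} e e′ = begin
      f * (x + y) ^ Q  ≈⟨ *-congˡ (^pᵏ-homo-+ k x y) ⟩
      f * (x ^ Q + y ^ Q)  ≈⟨ distribˡ f _ _ ⟩
      f * x ^ Q + f * y ^ Q  ≈⟨ +-cong e e′ ⟩
      f * x + f * y  ≈⟨ distribˡ f x y ⟨
      f * (x + y)  ∎

    fixed-* : ∀ {x y} → IsFixed x → IsFixed y → IsFixed (x * y)
    fixed-* {x} {y} e e′ = begin
      f * (x * y) ^ Q  ≈⟨ *-congˡ (^-distrib-* x y Q) ⟩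
      f * (x ^ Q * y ^ Q)  ≈⟨ *-assoc f _ _ ⟨
      f * x ^ Q * y ^ Q  ≈⟨ *-congʳ e ⟩
      f * x * y ^ Q  ≈⟨ swap f x _ ⟩
      f * y ^ Q * x  ≈⟨ *-congʳ e′ ⟩
      f * y * x  ≈⟨ swap f y x ⟩
      f * x * y  ≈⟨ *-assoc f x y ⟩
      f * (x * y)  ∎
      where
      swap : ∀ a b c → a * b * c ≈ a * c * b
      swap a b c = trans (*-assoc a b c) (trans (*-congˡ (*-comm b c)) (sym (*-assoc a c b)))

    -- `Q` may be even, so the sign is not pulled out of the power. Additivity of the power map on x
    -- + (- x) = 0 gives the value at - x instead.
    fixed-neg : ∀ {x} → IsFixed x → IsFixed (- x)
    fixed-neg {x} e = begin
      f * (- x) ^ Q  ≈⟨ +-identityˡ _ ⟨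
      0# + f * (- x) ^ Q  ≈⟨ +-congʳ (-‿inverseˡ (f * x)) ⟨
      - (f * x) + f * x + f * (- x) ^ Q  ≈⟨ +-assoc _ _ _ ⟩
      - (f * x) + (f * x + f * (- x) ^ Q)  ≈⟨ +-congˡ (+-congʳ e) ⟨
      - (f * x) + (f * x ^ Q + f * (- x) ^ Q)  ≈⟨ +-congˡ (distribˡ f _ _) ⟨
      - (f * x) + f * (x ^ Q + (- x) ^ Q)  ≈⟨ +-congˡ (*-congˡ (^pᵏ-homo-+ k x (- x))) ⟨
      - (f * x) + f * (x + - x) ^ Q  ≈⟨ +-congˡ (*-congˡ (trans (^-congˡ Q (-‿inverseʳ x)) 0^Q)) ⟩
      - (f * x) + f * 0#  ≈⟨ +-congˡ (zeroʳ f) ⟩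
      - (f * x) + 0#  ≈⟨ +-identityʳ _ ⟩
      - (f * x)  ≈⟨ -‿distribʳ-* f x ⟩
      f * - x  ∎
      where open Algebra.Properties.Ring ring using (-‿distribʳ-*)

  fixed⇒regular : ∀ k n x → p ℕ.^ k ≡ suc (suc n) → Fixed.IsFixed 1# k x → x * x ^ suc n ≈ x
  fixed⇒regular k n x eq fixed = begin
    x ^ suc (suc n)  ≡⟨ ≡.cong (x ^_) eq ⟨
    x ^ (p ℕ.^ k)  ≈⟨ *-identityˡ _ ⟨
    1# * x ^ (p ℕ.^ k)  ≈⟨ fixed ⟩
    1# * x  ≈⟨ *-identityˡ x ⟩
    x  ∎

-- Primitive idempotents of a regular residue ring

-- When x · xᴺ⁺¹ = x for all x, every xᴺ⁺¹ is idempotent, and a nonzero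
-- idempotent that absorbs or annihilates each of them is primitive.
module PrimitiveIdempotent {c ℓ} (B : CommutativeRing c ℓ)
  (zero? : (x : CommutativeRing.Carrier B) → Dec (CommutativeRing._≈_ B x (CommutativeRing.0# B)))
  (N : ℕ)
  (regular : (x : CommutativeRing.Carrier B) → CommutativeRing._≈_ B
    (CommutativeRing._*_ B x (Algebra.Properties.CommutativeSemiring.Exp._^_ (CommutativeRing.commutativeSemiring B) x (suc N))) x)
  (elements : List (CommutativeRing.Carrier B))
  (exhaustive : (x : CommutativeRing.Carrier B) → Any (CommutativeRing._≈_ B x) elements)
  where
  open CommutativeRing B hiding (zero)
  open Algebra.Properties.CommutativeSemiring.Exp commutativeSemiring
  open IntegerSolver B
  open Relation.Binary.Reasoning.Setoid setoid

  support : Carrier → Carrier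
  support x = x ^ suc N

  support-idem : ∀ x → support x * support x ≈ support x
  support-idem x = begin
    x * x ^ N * (x * x ^ N)  ≈⟨ solve 2 (λ x y → x :* y :* (x :* y) := x :* (x :* y) :* y) x (x ^ N) ⟩
    x * (x * x ^ N) * x ^ N  ≈⟨ *-congʳ (regular x) ⟩
    x * x ^ N  ∎

  Splits : Carrier → Carrier → Set ℓ
  Splits e x = e * support x ≈ 0# ⊎ e * support x ≈ e

  splits-≤ : ∀ {e e′ x} → e′ * e ≈ e′ → Splits e x → Splits e′ x
  splits-≤ {e} {e′} {x} e′≤e (inj₁ s) = inj₁ (begin
    e′ * support x  ≈⟨ *-congʳ e′≤e ⟨
    e′ * e * support x  ≈⟨ *-assoc _ _ _ ⟩
    e′ * (e * support x)  ≈⟨ *-congˡ s ⟩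
    e′ * 0#  ≈⟨ zeroʳ e′ ⟩
    0#  ∎)
  splits-≤ {e} {e′} {x} e′≤e (inj₂ s) = inj₂ (begin
    e′ * support x  ≈⟨ *-congʳ e′≤e ⟨
    e′ * e * support x  ≈⟨ *-assoc _ _ _ ⟩
    e′ * (e * support x)  ≈⟨ *-congˡ s ⟩
    e′ * e  ≈⟨ e′≤e ⟩
    e′  ∎)

  record Idempotent≤ (e₀ : Carrier) (xs : List Carrier) : Set (c ⊔ ℓ) where
    field
      e      : Carrier
      e≉0    : ¬ (e ≈ 0#)
      idem   : e * e ≈ e
      below  : e * e₀ ≈ e
      splits : All (Splits e) xs

  -- For each listed `x`, `zero?` decides whether the current idempotent annihilates the support of
  -- `x`; if not, their product is a smaller nonzero idempotent that absorbs it. Either property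
  -- passes to all smaller idempotents, so a single pass over the list suffices.
  refine : ∀ xs e₀ → ¬ (e₀ ≈ 0#) → e₀ * e₀ ≈ e₀ → Idempotent≤ e₀ xs
  refine [] e₀ e₀≉0 idem₀ = record { e = e₀ ; e≉0 = e₀≉0 ; idem = idem₀ ; below = idem₀ ; splits = [] }
  refine (x ∷ xs) e₀ e₀≉0 idem₀ with zero? (e₀ * support x)
  ... | yes z = record { e = e ; e≉0 = e≉0 ; idem = idem ; below = below ; splits = splits-≤ below (inj₁ z) ∷ splits }
    where open Idempotent≤ (refine xs e₀ e₀≉0 idem₀)
  ... | no ¬z = record
    { e = e ; e≉0 = e≉0 ; idem = idem
    ; below = trans (*-congʳ (sym below)) (trans (sc e) below)
    ; splits = splits-≤ below (inj₂ e₁x≈e₁) ∷ splits }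
    where
    e₁ = e₀ * support x
    e₁x≈e₁ : e₁ * support x ≈ e₁
    e₁x≈e₁ = trans (*-assoc _ _ _) (*-congˡ (support-idem x))
    e₁e₁≈e₁ : e₁ * e₁ ≈ e₁
    e₁e₁≈e₁ = begin
      e₀ * support x * (e₀ * support x)
        ≈⟨ solve 2 (λ a b → a :* b :* (a :* b) := a :* a :* (b :* b)) e₀ (support x) ⟩
      e₀ * e₀ * (support x * support x)  ≈⟨ *-cong idem₀ (support-idem x) ⟩
      e₁  ∎
    open Idempotent≤ (refine xs e₁ ¬z e₁e₁≈e₁)
    sc : ∀ y → y * e₁ * e₀ ≈ y * e₁
    sc y = begin
      y * (e₀ * support x) * e₀  ≈⟨ solve 3 (λ y a b → y :* (a :* b) :* a := y :* (a :* a :* b)) y e₀ (support x) ⟩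
      y * (e₀ * e₀ * support x)  ≈⟨ *-congˡ (*-congʳ idem₀) ⟩
      y * e₁  ∎

  primitive-idempotent : ∀ {a} → ¬ (a ≈ 0#) → Idempotent≤ (support a) elements
  primitive-idempotent {a} a≉0 = refine elements (support a) support≉0 (support-idem a)
    where
    support≉0 : ¬ (support a ≈ 0#)
    support≉0 s = a≉0 (trans (sym (regular a)) (trans (*-congˡ s) (zeroʳ a)))

  module Primitive {a : Carrier} (ε : Idempotent≤ (support a) elements) where
    open Idempotent≤ ε

    splits-all : ∀ x → Splits e x
    splits-all x = go splits (exhaustive x)
      where
      go : ∀ {xs} → All (Splits e) xs → Any (x ≈_) xs → Splits e x
      go (s ∷ _) (here x≈y) = Sum.map (trans (*-congˡ (^-congˡ (suc N) x≈y))) (trans (*-congˡ (^-congˡ (suc N) x≈y))) s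
      go (_ ∷ ss) (there i) = go ss i

    -- If `e` annihilates the support of `x`, then it annihilates `x`, which is a multiple of its
    -- support. If `e` absorbs the support, then `x` is invertible on the part cut out by `e` and
    -- can be cancelled from `e * (x * y)`.
    annihilator-prime : ∀ {x y} → e * (x * y) ≈ 0# → e * x ≈ 0# ⊎ e * y ≈ 0#
    annihilator-prime {x} {y} exy with splits-all x
    ... | inj₁ s = inj₁ (begin
      e * x  ≈⟨ *-congˡ (regular x) ⟨
      e * (x * support x)  ≈⟨ solve 3 (λ e x s → e :* (x :* s) := e :* s :* x) e x (support x) ⟩
      e * support x * x  ≈⟨ *-congʳ s ⟩
      0# * x  ≈⟨ zeroˡ x ⟩
      0#  ∎)
    ... | inj₂ s = inj₂ (begin
      e * y  ≈⟨ *-congʳ s ⟨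
      e * (x * x ^ N) * y  ≈⟨ solve 4 (λ e x s y → e :* (x :* s) :* y := e :* (x :* y) :* s) e x (x ^ N) y ⟩
      e * (x * y) * x ^ N  ≈⟨ *-congʳ exy ⟩
      0# * x ^ N  ≈⟨ zeroˡ _ ⟩
      0#  ∎)

    a∉annihilator : ¬ (e * a ≈ 0#)
    a∉annihilator ea = e≉0 (begin
      e  ≈⟨ below ⟨
      e * (a * a ^ N)  ≈⟨ *-assoc e a _ ⟨
      e * a * a ^ N  ≈⟨ *-congʳ ea ⟩
      0# * a ^ N  ≈⟨ zeroˡ _ ⟩
      0#  ∎)

-- Square-freeness and divisibility by q

module SquareFreeDivision {c ℓ} (R : CommutativeRing c ℓ)
  (q : CommutativeRing.Carrier R)
  (cancel : ∀ {x y} → CommutativeRing._≈_ R (CommutativeRing._*_ R q x) (CommutativeRing._*_ R q y) → CommutativeRing._≈_ R x y)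
  (zero? : (x : CommutativeRing.Carrier R) → Dec (Quotient._≈ₘ_ R q x (CommutativeRing.0# R)))
  (N : ℕ)
  (regular : (x : CommutativeRing.Carrier R) → Quotient._≈ₘ_ R q
    (CommutativeRing._*_ R x (Algebra.Properties.CommutativeSemiring.Exp._^_
      (CommutativeRing.commutativeSemiring (Quotient.residueRing R q)) x (suc N))) x)
  (elements : List (CommutativeRing.Carrier R))
  (exhaustive : (x : CommutativeRing.Carrier R) → Any (Quotient._≈ₘ_ R q x) elements)
  where
  open CommutativeRing R hiding (zero)
  open Quotient R q
  open Ideals R hiding (_^ᴿ_)
  open Algebra.Properties.CommutativeSemiring.Exp commutativeSemiring
  open IntegerSolver R
  private module Q = CommutativeRing residueRing
  private module I = PrimitiveIdempotent residueRing zero? N regular elements exhaustive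
  open Relation.Binary.Reasoning.Setoid setoid

  cancel^ : ∀ n {x y} → q ^ n * x ≈ q ^ n * y → x ≈ y
  cancel^ zero    eq = trans (sym (*-identityˡ _)) (trans eq (*-identityˡ _))
  cancel^ (suc n) eq = cancel^ n (cancel (trans (sym (*-assoc _ _ _)) (trans eq (*-assoc _ _ _))))

  module _ {a : Carrier} (ε : I.Idempotent≤ (I.support a) elements) where
    open I.Idempotent≤ ε using (e; e≉0; idem)
    open I.Primitive ε using (annihilator-prime; a∉annihilator)

    P : Subset
    P x = e * x ≈ₘ 0#

    P-prime : IsPrimeIdeal P
    P-prime = record
      { isIdeal = record
        { resp = λ x≈y ex → Q.trans (≈⇒≈ₘ (*-congˡ (sym x≈y))) ex
        ; 0∈   = ≈⇒≈ₘ (zeroʳ e)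
        ; +∈   = λ {x} {y} ex ey → Q.trans (Q.distribˡ e x y) (Q.trans (Q.+-cong ex ey) (Q.+-identityˡ _))
        ; *∈   = λ r {x} ex → Q.trans (≈⇒≈ₘ (solve 3 (λ e r x → e :* (r :* x) := r :* (e :* x)) e r x)) (Q.trans (Q.*-congˡ ex) (Q.zeroʳ r))
        }
      ; proper = λ e1 → e≉0 (Q.trans (Q.sym (Q.*-identityʳ e)) e1)
      ; prime  = annihilator-prime
      }
    open IsPrimeIdeal P-prime

    q∈P : P q
    q∈P = e , trans (*-comm e q) (sym (+-identityˡ _))

    prime-^ : ∀ n {x} → P (x ^ n) → P x
    prime-^ zero    p = ⊥-elim (proper p)
    prime-^ (suc n) p with prime p
    ... | inj₁ p′ = p′
    ... | inj₂ p′ = prime-^ n p′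

    prime-cofactor : ∀ m n {x} → P (a ^ m * x ^ n) → P x
    prime-cofactor m n p with prime p
    ... | inj₁ p′ = ⊥-elim (a∉annihilator (prime-^ m p′))
    ... | inj₂ p′ = prime-^ n p′

    module _ {α : Carrier} (γ : Carrier) (e²α : e * (e * α) ≈ q * (q * γ)) where
      u w U : Carrier
      u = 1# - e
      w = e + (u + u + u)
      U = u + (e + e + e)

      u∈P : P u
      u∈P = Q.trans (≈⇒≈ₘ (solve 1 (λ e → e :* (con 1ℤ :- e) := e :- e :* e) e))
            (Q.trans (Q.+-congˡ (Q.-‿cong idem)) (Q.-‿inverseʳ e))

      -- The colon ideal (α) : P², the largest ideal whose product with P² can lie in (α).
      K : Subset
      K x = ∀ y z → P y → P z → ⟨ α ⟩ (x * (y * z))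

      K-ideal : IsIdeal K
      K-ideal = record
        { resp = λ x≈x′ k y z y∈ z∈ → record
            { quotient = ∣.quotient (k y z y∈ z∈) ; equality = trans (∣.equality (k y z y∈ z∈)) (*-congʳ x≈x′) }
        ; 0∈   = λ y z _ _ → record { quotient = 0# ; equality = trans (zeroˡ α) (sym (zeroˡ (y * z))) }
        ; +∈   = λ {x} {x′} k k′ y z y∈ z∈ → record
            { quotient = ∣.quotient (k y z y∈ z∈) + ∣.quotient (k′ y z y∈ z∈)
            ; equality = trans (distribʳ α _ _)
                (trans (+-cong (∣.equality (k y z y∈ z∈)) (∣.equality (k′ y z y∈ z∈))) (sym (distribʳ (y * z) x x′)))
            }
        ; *∈   = λ r {x} k y z y∈ z∈ → record
            { quotient = r * ∣.quotient (k y z y∈ z∈)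
            ; equality = trans (*-assoc r _ α) (trans (*-congˡ (∣.equality (k y z y∈ z∈))) (sym (*-assoc r x (y * z))))
            }
        }
        where module ∣ {x y} = RawMagma._∣ʳ_ {M = *-rawMagma} {x} {y}
      open IsIdeal K-ideal using () renaming (*∈ to K-*∈)

      -- Modulo q², the complementary elements e²w and u²U are the orthogonal
      -- idempotents lifting e and u, because (e + u)³ = 1.
      α-decomposition : q * q * (w * γ) + u * u * (U * α) ≈ α
      α-decomposition = begin
        q * q * (w * γ) + u * u * (U * α)  ≈⟨ solve 5 (λ q w γ e α → let u = con 1ℤ :- e in
                                                          q :* q :* (w :* γ) :+ u :* u :* ((u :+ (e :+ e :+ e)) :* α) :=
                                                          w :* (q :* (q :* γ)) :+ u :* u :* ((u :+ (e :+ e :+ e)) :* α)) q w γ e α ⟩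
        w * (q * (q * γ)) + u * u * (U * α)  ≈⟨ +-congʳ (*-congˡ e²α) ⟨
        w * (e * (e * α)) + u * u * (U * α)  ≈⟨ solve 2 (λ e α → let u = con 1ℤ :- e in
                                                          (e :+ (u :+ u :+ u)) :* (e :* (e :* α)) :+ u :* u :* ((u :+ (e :+ e :+ e)) :* α) := α) e α ⟩
        α  ∎

      -- For `y` and `z` in `P`, both `e * y` and `e * z` are multiples of `q`. Writing q²γ as e²α
      -- therefore exhibits q² · wγyz as q² times a multiple of α, and q² cancels.
      wγ∈K : K (w * γ)
      wγ∈K y z (s , ey) (t , ez) = record { quotient = w * (s * t) ; equality = sym (cancel (cancel (begin
        q * (q * (w * γ * (y * z)))
          ≈⟨ solve 5 (λ q w γ y z → q :* (q :* (w :* γ :* (y :* z))) := q :* (q :* γ) :* (w :* (y :* z))) q w γ y z ⟩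
        q * (q * γ) * (w * (y * z))  ≈⟨ *-congʳ e²α ⟨
        e * (e * α) * (w * (y * z))
          ≈⟨ solve 5 (λ e α w y z → e :* (e :* α) :* (w :* (y :* z)) := w :* α :* (e :* y :* (e :* z))) e α w y z ⟩
        w * α * (e * y * (e * z))  ≈⟨ *-congˡ (*-cong ey ez) ⟩
        w * α * ((0# + q * s) * (0# + q * t))
          ≈⟨ solve 5 (λ w α q s t → w :* α :* ((con 0ℤ :+ q :* s) :* (con 0ℤ :+ q :* t)) := q :* (q :* (w :* (s :* t) :* α))) w α q s t ⟩
        q * (q * (w * (s * t) * α))  ∎))) }

      Uα∈K : K (U * α)
      Uα∈K y z _ _ = record { quotient = U * (y * z) ; equality = solve 4 (λ U α y z → U :* (y :* z) :* α := U :* α :* (y :* z)) U α y z }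

      P²∣α : P · P ∣ⁱ ⟨ α ⟩
      P²∣α = K , K-ideal , to , from
        where
        module ∣ {x y} = RawMagma._∣ʳ_ {M = *-rawMagma} {x} {y}

        to : ∀ {x} → ⟨ α ⟩ x → (P · P · K) x
        to {x} d = resp eq (+∈ (prod (prod q∈P q∈P) (K-*∈ quotient wγ∈K)) (prod (prod u∈P u∈P) (K-*∈ quotient Uα∈K)))
          where
          open ∣ d
          eq : q * q * (quotient * (w * γ)) + u * u * (quotient * (U * α)) ≈ x
          eq = begin
            q * q * (quotient * (w * γ)) + u * u * (quotient * (U * α))
              ≈⟨ solve 5 (λ a t b c d → a :* (t :* b) :+ c :* (t :* d) := t :* (a :* b :+ c :* d)) (q * q) quotient (w * γ) (u * u) (U * α) ⟩
            quotient * (q * q * (w * γ) + u * u * (U * α))  ≈⟨ *-congˡ α-decomposition ⟩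
            quotient * α  ≈⟨ equality ⟩
            x  ∎

        ∣-resp : ∀ {x y} → x ≈ y → ⟨ α ⟩ x → ⟨ α ⟩ y
        ∣-resp x≈y d = record { quotient = ∣.quotient d ; equality = trans (∣.equality d) x≈y }

        ∣-0 : ⟨ α ⟩ 0#
        ∣-0 = record { quotient = 0# ; equality = zeroˡ α }

        ∣-+ : ∀ {x y} → ⟨ α ⟩ x → ⟨ α ⟩ y → ⟨ α ⟩ (x + y)
        ∣-+ d d′ = record { quotient = ∣.quotient d + ∣.quotient d′ ; equality = trans (distribʳ α _ _) (+-cong (∣.equality d) (∣.equality d′)) }

        P²K : ∀ {x k} → (P · P) x → K k → ⟨ α ⟩ (x * k)
        P²K {k = k} (resp x≈y p) k∈ = ∣-resp (*-congʳ x≈y) (P²K p k∈)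
        P²K (prod x∈ y∈)         k∈ = ∣-resp (*-comm _ _) (k∈ _ _ x∈ y∈)
        P²K 0∈                   k∈ = ∣-resp (sym (zeroˡ _)) ∣-0
        P²K (+∈ p p′)            k∈ = ∣-resp (sym (distribʳ _ _ _)) (∣-+ (P²K p k∈) (P²K p′ k∈))

        from : ∀ {x} → (P · P · K) x → ⟨ α ⟩ x
        from (resp x≈y p) = ∣-resp x≈y (from p)
        from (prod p k)   = P²K p k
        from 0∈           = ∣-0
        from (+∈ p p′)    = ∣-+ (from p) (from p′)

    -- The primality of `P` is applied twice. The hypothesis puts aⁿ⁺¹αⁿ in `P` while `a` is not in
    -- it, so eα = qβ. Multiplying the hypothesis by eⁿ and cancelling qⁿ leaves one factor `q`, so
    -- aⁿ⁺¹βⁿ is in `P` as well, and eβ is again a multiple of `q`.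
    square-divides : ∀ n {α} → ∃ (λ t → a ^ suc n * α ^ n ≈ q ^ suc n * t) → P · P ∣ⁱ ⟨ α ⟩
    square-divides n {α} (t , h) = P²∣α (proj₁ eβ) (begin
        e * (e * α)  ≈⟨ *-congˡ (trans (proj₂ eα) (+-identityˡ _)) ⟩
        e * (q * β)  ≈⟨ solve 3 (λ e q β → e :* (q :* β) := q :* (e :* β)) e q β ⟩
        q * (e * β)  ≈⟨ *-congˡ (trans (proj₂ eβ) (+-identityˡ _)) ⟩
        q * (q * proj₁ eβ)  ∎)
      where
      P-q* : ∀ {x} s → x ≈ q * s → P x
      P-q* {x} s x≈qs = e * s , trans (*-congˡ x≈qs) (solve 3 (λ e q s → e :* (q :* s) := con 0ℤ :+ q :* (e :* s)) e q s)

      eα : P α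
      eα = prime-cofactor (suc n) n (P-q* (q ^ n * t) (trans h (*-assoc _ _ _)))
      β = proj₁ eα

      eβ : P β
      eβ = prime-cofactor (suc n) n (P-q* (e ^ n * t) (cancel^ n (begin
        q ^ n * (a ^ suc n * β ^ n)
          ≈⟨ solve 3 (λ x y z → x :* (y :* z) := y :* (x :* z)) (q ^ n) (a ^ suc n) (β ^ n) ⟩
        a ^ suc n * (q ^ n * β ^ n)  ≈⟨ *-congˡ (^-distrib-* q β n) ⟨
        a ^ suc n * (q * β) ^ n  ≈⟨ *-congˡ (^-congˡ n (trans (proj₂ eα) (+-identityˡ _))) ⟨
        a ^ suc n * (e * α) ^ n  ≈⟨ *-congˡ (^-distrib-* e α n) ⟩
        a ^ suc n * (e ^ n * α ^ n)
          ≈⟨ solve 3 (λ x y z → x :* (y :* z) := y :* (x :* z)) (a ^ suc n) (e ^ n) (α ^ n) ⟩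
        e ^ n * (a ^ suc n * α ^ n)  ≈⟨ *-congˡ h ⟩
        e ^ n * (q ^ suc n * t)
          ≈⟨ solve 4 (λ x q y t → x :* (q :* y :* t) := y :* (q :* (x :* t))) (e ^ n) q (q ^ n) t ⟩
        q ^ n * (q * (e ^ n * t))  ∎)))

  squareFree-divides : ∀ n {a α} → SquareFreeAsIdeal α → ∃ (λ t → a ^ suc n * α ^ n ≈ q ^ suc n * t) → a ≈ₘ 0#
  squareFree-divides n {a} sf h with zero? a
  ... | yes a≈0 = a≈0
  ... | no  a≉0 = ⊥-elim (sf (P e) (P-prime e) (square-divides e n h))
    where e = I.primitive-idempotent a≉0

-- Subrings, spans and integral elements

module Adjunction {c ℓ} (B : CommutativeRing c ℓ) where
  open CommutativeRing B hiding (zero)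
  open Algebra.Properties.CommutativeSemiring.Exp commutativeSemiring
  open Algebra.Properties.Ring ring using (-‿distribˡ-*; -1*x≈-x)
  open IntegerSolver B
  open Relation.Binary.Reasoning.Setoid setoid

  ^-comm : ∀ x i j → (x ^ i) ^ j ≈ (x ^ j) ^ i
  ^-comm x i j = trans (^-assocʳ x i j) (trans (reflexive (≡.cong (x ^_) (ℕ.*-comm i j))) (sym (^-assocʳ x j i)))

  record IsSubring {a} (A : Pred Carrier a) : Set (c ⊔ ℓ ⊔ a) where
    field
      resp : ∀ {x y} → x ≈ y → A x → A y
      0∈   : A 0#
      1∈   : A 1#
      +∈   : ∀ {x y} → A x → A y → A (x + y)
      *∈   : ∀ {x y} → A x → A y → A (x * y)
      -∈   : ∀ {x} → A x → A (- x)

    ^∈ : ∀ {x} n → A x → A (x ^ n)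
    ^∈ zero    x∈ = 1∈
    ^∈ (suc n) x∈ = *∈ x∈ (^∈ n x∈)

  data Span {a} (A : Pred Carrier a) : List Carrier → Pred Carrier (c ⊔ ℓ ⊔ a) where
    nil  : ∀ {y} → y ≈ 0# → Span A [] y
    cons : ∀ {v vs a y z} → A a → Span A vs z → y ≈ a * v + z → Span A (v ∷ vs) y

  span-resp : ∀ {a} {A : Pred Carrier a} {vs x y} → x ≈ y → Span A vs x → Span A vs y
  span-resp x≈y (nil e)        = nil (trans (sym x≈y) e)
  span-resp x≈y (cons a∈ z∈ e) = cons a∈ z∈ (trans (sym x≈y) e)

  span-scale : ∀ {a a′} {A : Pred Carrier a} {A′ : Pred Carrier a′} b → (∀ {x} → A x → A′ (b * x)) →
               ∀ {vs y} → Span A vs y → Span A′ vs (b * y)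
  span-scale b f (nil e) = nil (trans (*-congˡ e) (zeroʳ b))
  span-scale b f (cons {v} {a = a} {z = z} a∈ z∈ e) = cons (f a∈) (span-scale b f z∈)
    (trans (*-congˡ e) (solve 4 (λ b a v z → b :* (a :* v :+ z) := b :* a :* v :+ b :* z) b a v z))

  module _ {a} {A : Pred Carrier a} (A-subring : IsSubring A) where
    open IsSubring A-subring

    span-0 : ∀ vs → Span A vs 0#
    span-0 []       = nil refl
    span-0 (v ∷ vs) = cons 0∈ (span-0 vs) (solve 1 (λ v → con 0ℤ := con 0ℤ :* v :+ con 0ℤ) v)

    span-generator : ∀ {vs v} → v ∈ vs → Span A vs v
    span-generator {v ∷ vs} (here ≡.refl) = cons 1∈ (span-0 vs) (solve 1 (λ v → v := con 1ℤ :* v :+ con 0ℤ) v)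
    span-generator {w ∷ vs} {v} (there v∈) = cons 0∈ (span-generator v∈) (solve 2 (λ v w → v := con 0ℤ :* w :+ v) v w)

    span-++ : ∀ vs {ws y} → Span A ws y → Span A (vs ++ ws) y
    span-++ []       y∈ = y∈
    span-++ (v ∷ vs) {y = y} y∈ = cons 0∈ (span-++ vs y∈) (solve 2 (λ v y → y := con 0ℤ :* v :+ y) v y)

    span-++ˡ : ∀ {vs} ws {y} → Span A vs y → Span A (vs ++ ws) y
    span-++ˡ ws (nil e)        = span-resp (sym e) (span-0 ws)
    span-++ˡ ws (cons a∈ z∈ e) = cons a∈ (span-++ˡ ws z∈) e

  module _ {a} {A : Pred Carrier a} (+∈ : ∀ {x y} → A x → A y → A (x + y)) where
    span-+ : ∀ {vs x y} → Span A vs x → Span A vs y → Span A vs (x + y)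
    span-+ (nil e) (nil e′) = nil (trans (+-cong e e′) (+-identityˡ 0#))
    span-+ (cons {v} {a = a} {z = z} a∈ z∈ e) (cons {a = b} {z = w} b∈ w∈ e′) = cons (+∈ a∈ b∈) (span-+ z∈ w∈)
      (trans (+-cong e e′) (solve 5 (λ v a z b w → a :* v :+ z :+ (b :* v :+ w) := (a :+ b) :* v :+ (z :+ w)) v a z b w))

  module Degree {a} {A : Pred Carrier a} (A-subring : IsSubring A) (x : Carrier) where
    open IsSubring A-subring

    -- Deg n y: y is the value at x of a polynomial over A of degree below n.
    data Deg : ℕ → Pred Carrier (c ⊔ ℓ ⊔ a) where
      nil  : ∀ {y} → y ≈ 0# → Deg 0 y
      cons : ∀ {n a y z} → A a → Deg n z → y ≈ a + x * z → Deg (suc n) y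

    deg-resp : ∀ {n y z} → y ≈ z → Deg n y → Deg n z
    deg-resp y≈z (nil e)        = nil (trans (sym y≈z) e)
    deg-resp y≈z (cons a∈ z∈ e) = cons a∈ z∈ (trans (sym y≈z) e)

    deg-0 : ∀ n → Deg n 0#
    deg-0 zero    = nil refl
    deg-0 (suc n) = cons 0∈ (deg-0 n) (solve 1 (λ x → con 0ℤ := con 0ℤ :+ x :* con 0ℤ) x)

    deg-+ : ∀ {n y z} → Deg n y → Deg n z → Deg n (y + z)
    deg-+ (nil e) (nil e′) = nil (trans (+-cong e e′) (+-identityˡ 0#))
    deg-+ (cons {a = a} {z = y} a∈ y∈ e) (cons {a = b} {z = z} b∈ z∈ e′) = cons (+∈ a∈ b∈) (deg-+ y∈ z∈)
      (trans (+-cong e e′) (solve 5 (λ x a y b z → a :+ x :* y :+ (b :+ x :* z) := a :+ b :+ x :* (y :+ z)) x a y b z))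

    deg-scale : ∀ {n b y} → A b → Deg n y → Deg n (b * y)
    deg-scale {b = b} b∈ (nil e) = nil (trans (*-congˡ e) (zeroʳ b))
    deg-scale {b = b} b∈ (cons {a = a} {z = z} a∈ z∈ e) = cons (*∈ b∈ a∈) (deg-scale b∈ z∈)
      (trans (*-congˡ e) (solve 4 (λ b a x z → b :* (a :+ x :* z) := b :* a :+ x :* (b :* z)) b a x z))

    deg-neg : ∀ {n y} → Deg n y → Deg n (- y)
    deg-neg y∈ = deg-resp (-1*x≈-x _) (deg-scale (-∈ 1∈) y∈)

    deg-x* : ∀ {n y} → Deg n y → Deg (suc n) (x * y)
    deg-x* {y = y} y∈ = cons 0∈ y∈ (sym (+-identityˡ (x * y)))

    deg-x^* : ∀ m {n y} → Deg n y → Deg (m ℕ.+ n) (x ^ m * y)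
    deg-x^* zero    y∈ = deg-resp (sym (*-identityˡ _)) y∈
    deg-x^* (suc m) y∈ = deg-resp (sym (*-assoc x _ _)) (deg-x* (deg-x^* m y∈))

    deg-const : ∀ {b} → A b → Deg 1 b
    deg-const {b} b∈ = cons b∈ (nil refl) (solve 2 (λ b x → b := b :+ x :* con 0ℤ) b x)

    deg-suc : ∀ {n y} → Deg n y → Deg (suc n) y
    deg-suc (nil e)        = deg-resp (sym e) (deg-0 1)
    deg-suc (cons a∈ z∈ e) = cons a∈ (deg-suc z∈) e

    deg-weaken : ∀ m {n y} → Deg n y → Deg (m ℕ.+ n) y
    deg-weaken zero    y∈ = y∈
    deg-weaken (suc m) y∈ = deg-suc (deg-weaken m y∈)

    deg-* : ∀ {m n y z} → Deg m y → Deg n z → Deg (m ℕ.+ n) (y * z)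
    deg-* {n = n} {z = z} (nil e) z∈ = deg-resp (sym (trans (*-congʳ e) (zeroˡ z))) (deg-0 n)
    deg-* {suc m} {n} {z = z} (cons {a = a} {z = y} a∈ y∈ e) z∈ =
      deg-resp (sym (trans (*-congʳ e) (solve 4 (λ a x y z → (a :+ x :* y) :* z := a :* z :+ x :* (y :* z)) a x y z)))
        (deg-+ (deg-weaken (suc m) (deg-scale a∈ z∈)) (deg-x* (deg-* y∈ z∈)))

    deg-last : ∀ {n y} → Deg (suc n) y → ∃ λ z → ∃ λ b → Deg n z × A b × y ≈ z + b * x ^ n
    deg-last {zero} (cons {a = a} a∈ (nil z≈0) e) = 0# , a , nil refl , a∈ ,
      trans e (trans (+-congˡ (*-congˡ z≈0)) (solve 2 (λ a x → a :+ x :* con 0ℤ := con 0ℤ :+ a :* con 1ℤ) a x))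
    deg-last {suc n} (cons {a = a} a∈ z∈ e) with deg-last z∈
    ... | w , b , w∈ , b∈ , e′ = a + x * w , b , cons a∈ w∈ refl , b∈ ,
      trans e (trans (+-congˡ (*-congˡ e′)) (solve 5 (λ a x w b t → a :+ x :* (w :+ b :* t) := a :+ x :* w :+ b :* (x :* t)) a x w b (x ^ n)))

    Monic : ℕ → Pred Carrier (c ⊔ ℓ ⊔ a)
    Monic n y = ∃ λ z → Deg n z × y ≈ z + x ^ n

    monic-*deg : ∀ {m n y z} → Monic m y → Deg n z → Deg (m ℕ.+ n) (y * z)
    monic-*deg {m} (w , w∈ , e) z∈ = deg-resp (sym (trans (*-congʳ e) (distribʳ _ _ _))) (deg-+ (deg-* w∈ z∈) (deg-x^* m z∈))

    monic-* : ∀ {m n y z} → Monic m y → Monic n z → Monic (m ℕ.+ n) (y * z)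
    monic-* {m} {n} {y} {z} y-monic@(w , w∈ , e) (v , v∈ , e′) = y * v + x ^ n * w ,
      deg-+ (monic-*deg y-monic v∈) (≡.subst (λ k → Deg k (x ^ n * w)) (ℕ.+-comm n m) (deg-x^* n w∈)) , (begin
        y * z  ≈⟨ *-congˡ e′ ⟩
        y * (v + x ^ n)  ≈⟨ distribˡ y v _ ⟩
        y * v + y * x ^ n  ≈⟨ +-congˡ (*-congʳ e) ⟩
        y * v + (w + x ^ m) * x ^ n
          ≈⟨ solve 4 (λ s w t u → s :+ (w :+ t) :* u := s :+ u :* w :+ t :* u) (y * v) w (x ^ m) (x ^ n) ⟩
        y * v + x ^ n * w + x ^ m * x ^ n  ≈⟨ +-congˡ (^-homo-* x m n) ⟨
        y * v + x ^ n * w + x ^ (m ℕ.+ n)  ∎)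

    monic-1 : Monic 0 1#
    monic-1 = 0# , nil refl , sym (+-identityˡ _)

    monic-^ : ∀ {y} n → Monic 1 y → Monic n (y ^ n)
    monic-^ zero    y∈ = monic-1
    monic-^ (suc n) y∈ = monic-* y∈ (monic-^ n y∈)

    powers : ℕ → List Carrier
    powers zero    = []
    powers (suc n) = 1# ∷ map (x *_) (powers n)

    span-map-x* : ∀ {vs y} → Span A vs y → Span A (map (x *_) vs) (x * y)
    span-map-x* (nil e) = nil (trans (*-congˡ e) (zeroʳ x))
    span-map-x* (cons {v} {a = a} {z = z} a∈ z∈ e) = cons a∈ (span-map-x* z∈)
      (trans (*-congˡ e) (solve 4 (λ x a v z → x :* (a :* v :+ z) := a :* (x :* v) :+ x :* z) x a v z))

    deg⇒span : ∀ {n y} → Deg n y → Span A (powers n) y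
    deg⇒span (nil e) = nil e
    deg⇒span (cons {a = a} a∈ z∈ e) = cons a∈ (span-map-x* (deg⇒span z∈)) (trans e (+-congʳ (sym (*-identityʳ a))))

    deg-power : ∀ n {v} → v ∈ powers n → Deg n v
    deg-power (suc n) (here ≡.refl) = cons 1∈ (deg-0 n) (solve 1 (λ x → con 1ℤ := con 1ℤ :+ x :* con 0ℤ) x)
    deg-power (suc n) (there v∈) with ∈-map⁻ (x *_) v∈
    ... | w , w∈ , ≡.refl = deg-x* (deg-power n w∈)

    -- A monic equation of degree n for x, with xⁿ on one side.
    module Relation {n} (relation : Deg n (x ^ n)) where

      x*-closed : ∀ {y} → Deg n y → Deg n (x * y)
      x*-closed = go relation
        where
        go : ∀ {n y} → Deg n (x ^ n) → Deg n y → Deg n (x * y)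
        go {zero}  _   (nil e) = nil (trans (*-congˡ e) (zeroʳ x))
        go {suc n} rel y∈ with deg-last y∈
        ... | z , b , z∈ , b∈ , e = deg-resp (sym (trans (*-congˡ e) (solve 4 (λ x z b t → x :* (z :+ b :* t) := x :* z :+ b :* (x :* t)) x z b (x ^ n))))
          (deg-+ (deg-x* z∈) (deg-scale b∈ rel))

      -- Multipliers of the module spanned by 1, x, ..., xⁿ⁻¹ form a subring. A ring generated by
      -- multipliers therefore maps this module to itself, and acting on 1 places the ring inside
      -- the module, without any reduction of products of polynomials.
      Multiplier : Pred Carrier (c ⊔ ℓ ⊔ a)
      Multiplier s = ∀ {y} → Deg n y → Deg n (s * y)

      multipliers : IsSubring Multiplier
      multipliers = record
        { resp = λ s≈t m y∈ → deg-resp (*-congʳ s≈t) (m y∈)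
        ; 0∈   = λ y∈ → deg-resp (sym (zeroˡ _)) (deg-0 n)
        ; 1∈   = λ y∈ → deg-resp (sym (*-identityˡ _)) y∈
        ; +∈   = λ m m′ y∈ → deg-resp (sym (distribʳ _ _ _)) (deg-+ (m y∈) (m′ y∈))
        ; *∈   = λ m m′ y∈ → deg-resp (sym (*-assoc _ _ _)) (m (m′ y∈))
        ; -∈   = λ m y∈ → deg-resp (-‿distribˡ-* _ _) (deg-neg (m y∈))
        }

      A-multiplier : ∀ {b} → A b → Multiplier b
      A-multiplier b∈ y∈ = deg-scale b∈ y∈

  module Integrality {a} {A : Pred Carrier a} (A-subring : IsSubring A) where
    open IsSubring A-subring
    open Degree A-subring

    IntegralOver : Pred Carrier (c ⊔ ℓ ⊔ a)
    IntegralOver x = ∃ λ n → Deg x n (x ^ n)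

    Stable : List Carrier → Pred Carrier (c ⊔ ℓ ⊔ a)
    Stable vs x = ∀ {v} → v ∈ vs → Span A vs (x * v)

    stable-span : ∀ {vs x} → Stable vs x → ∀ {y} → Span A vs y → Span A vs (x * y)
    stable-span {vs} {x} st = go st
      where
      go : ∀ {ws} → (∀ {v} → v ∈ ws → Span A vs (x * v)) → ∀ {y} → Span A ws y → Span A vs (x * y)
      go st (nil e) = span-resp (sym (trans (*-congˡ e) (zeroʳ x))) (span-0 A-subring vs)
      go st (cons {v} {a = a} {z = z} a∈ z∈ e) = span-resp
        (sym (trans (*-congˡ e) (solve 4 (λ x a v z → x :* (a :* v :+ z) := a :* (x :* v) :+ x :* z) x a v z)))
        (span-+ +∈ (span-scale a (*∈ a∈) (st (here ≡.refl))) (go (λ v∈ → st (there v∈)) z∈))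

    stable-subring : ∀ vs → IsSubring (Stable vs)
    stable-subring vs = record
      { resp = λ x≈y st v∈ → span-resp (*-congʳ x≈y) (st v∈)
      ; 0∈   = λ v∈ → span-resp (sym (zeroˡ _)) (span-0 A-subring vs)
      ; 1∈   = λ v∈ → span-resp (sym (*-identityˡ _)) (span-generator A-subring v∈)
      ; +∈   = λ st st′ v∈ → span-resp (sym (distribʳ _ _ _)) (span-+ +∈ (st v∈) (st′ v∈))
      ; *∈   = λ st st′ v∈ → span-resp (sym (*-assoc _ _ _)) (stable-span st (st′ v∈))
      ; -∈   = λ st v∈ → span-resp (trans (-1*x≈-x _) (-‿distribˡ-* _ _)) (span-scale (- 1#) (*∈ (-∈ 1∈)) (st v∈))
      }

    -- Gaussian elimination in place of Cayley–Hamilton. Each relation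
    -- xᴺ v = Σ cⱼ vⱼ has deg cⱼ < N, so xᴺ - c₁₁ is monic and clearing it from
    -- the other relations keeps this shape with 2N in place of N.
    module _ (x : Carrier) where

      -- The generator 1 is eliminated last: the only relation then left reads xᴺ · 1 = c · 1, which
      -- is the monic equation sought.
      withUnit : List Carrier → List Carrier
      withUnit vs = vs ++ 1# ∷ []

      eliminate : ∀ vs N → (∀ {v} → v ∈ withUnit vs → Span (Deg x N) (withUnit vs) (x ^ N * v)) → IntegralOver x
      eliminate [] N rows with rows (here ≡.refl)
      ... | cons {a = c} c∈ (nil z≈0) e = N , deg-resp x (sym (begin
              x ^ N  ≈⟨ *-identityʳ _ ⟨
              x ^ N * 1#  ≈⟨ e ⟩
              c * 1# + _  ≈⟨ +-cong (*-identityʳ c) z≈0 ⟩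
              c + 0#  ≈⟨ +-identityʳ c ⟩
              c  ∎)) c∈
      eliminate (w ∷ vs) N rows with rows (here ≡.refl)
      ... | cons {a = c₁₁} {z = z₁} c₁₁∈ z₁∈ e₁ = eliminate vs (N ℕ.+ N) row
        where
        D = x ^ N - c₁₁

        D* : ∀ {b} → Deg x N b → Deg x (N ℕ.+ N) (D * b)
        D* = monic-*deg x (- c₁₁ , deg-neg x c₁₁∈ , +-comm _ _)

        span-single : ∀ {b us v} → v ∈ us → Deg x (N ℕ.+ N) b → Span (Deg x (N ℕ.+ N)) us (b * v)
        span-single {b} {u ∷ us} (here ≡.refl) b∈ = cons b∈ (zeros us) (sym (+-identityʳ _))
          where
          zeros : ∀ us → Span (Deg x (N ℕ.+ N)) us 0#
          zeros []       = nil refl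
          zeros (u ∷ us) = cons (deg-0 x _) (zeros us) (solve 1 (λ u → con 0ℤ := con 0ℤ :* u :+ con 0ℤ) u)
        span-single {b} {u ∷ us} {v} (there v∈) b∈ = cons (deg-0 x _) (span-single v∈ b∈)
          (solve 2 (λ bv u → bv := con 0ℤ :* u :+ bv) (b * v) u)

        row : ∀ {v} → v ∈ withUnit vs → Span (Deg x (N ℕ.+ N)) (withUnit vs) (x ^ (N ℕ.+ N) * v)
        row {v} v∈ with rows (there v∈)
        ... | cons {a = c} {z = z} c∈ z∈ e = span-resp eq
          (span-+ (deg-+ x) (span-single v∈ (deg-x^* x N c₁₁∈))
            (span-+ (deg-+ x) (span-scale c (deg-* x c∈) z₁∈) (span-scale D D* z∈)))
          where
          eq : x ^ N * c₁₁ * v + (c * z₁ + D * z) ≈ x ^ (N ℕ.+ N) * v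
          eq = begin
            x ^ N * c₁₁ * v + (c * z₁ + D * z)
              ≈⟨ solve 7 (λ t k v c zₗ z w → t :* k :* v :+ (c :* zₗ :+ (t :- k) :* z) :=
                   t :* k :* v :+ (c :* ((k :* w :+ zₗ) :- k :* w) :+ (t :- k) :* ((c :* w :+ z) :- c :* w))) (x ^ N) c₁₁ v c z₁ z w ⟩
            x ^ N * c₁₁ * v + (c * ((c₁₁ * w + z₁) - c₁₁ * w) + D * ((c * w + z) - c * w))
              ≈⟨ +-congˡ (+-cong (*-congˡ (+-congʳ e₁)) (*-congˡ (+-congʳ e))) ⟨
            x ^ N * c₁₁ * v + (c * (x ^ N * w - c₁₁ * w) + D * (x ^ N * v - c * w))
              ≈⟨ solve 5 (λ t k v c w → t :* k :* v :+ (c :* (t :* w :- k :* w) :+ (t :- k) :* (t :* v :- c :* w)) := t :* t :* v) (x ^ N) c₁₁ v c w ⟩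
            x ^ N * x ^ N * v  ≈⟨ *-congʳ (^-homo-* x N N) ⟨
            x ^ (N ℕ.+ N) * v  ∎

      stable⇒integral : ∀ {vs} → Span A vs 1# → Stable vs x → IntegralOver x
      stable⇒integral {vs} 1∈vs st = eliminate vs 1 λ v∈ →
        span-resp (*-congʳ (sym (*-identityʳ x))) (constants (span-++ˡ A-subring (1# ∷ []) (row v∈)))
        where
        constants : ∀ {us y} → Span A us y → Span (Deg x 1) us y
        constants (nil e)        = nil e
        constants (cons a∈ z∈ e) = cons (deg-const x a∈) (constants z∈) e

        row : ∀ {v} → v ∈ withUnit vs → Span A vs (x * v)
        row v∈ with ∈-++⁻ vs v∈
        ... | inj₁ v∈vs          = st v∈vs
        ... | inj₂ (here ≡.refl) = stable-span st 1∈vs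

    _⊗_ : List Carrier → List Carrier → List Carrier
    vs ⊗ ws = concatMap (λ v → map (v *_) ws) vs

    span-map* : ∀ v {ws y} → Span A ws y → Span A (map (v *_) ws) (v * y)
    span-map* v = span-map-x* v

    span-⊗ : ∀ {vs ws y} → Span (Span A ws) vs y → Span A (vs ⊗ ws) y
    span-⊗ (nil e) = nil e
    span-⊗ {v ∷ vs} {ws} (cons a∈ z∈ e) = span-resp (sym (trans e (+-congʳ (*-comm _ _))))
      (span-+ +∈ (span-++ˡ A-subring (vs ⊗ ws) (span-map* v a∈)) (span-++ A-subring (map (v *_) ws) (span-⊗ z∈)))

    ∈-⊗ : ∀ {vs ws u} → u ∈ vs ⊗ ws → ∃ λ v → ∃ λ w → v ∈ vs × w ∈ ws × u ≡ v * w
    ∈-⊗ {v ∷ vs} {ws} u∈ with ∈-++⁻ (map (v *_) ws) u∈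
    ... | inj₁ i with ∈-map⁻ (v *_) i
    ...   | w , w∈ , e = v , w , here ≡.refl , w∈ , e
    ∈-⊗ {v ∷ vs} {ws} u∈ | inj₂ i with ∈-⊗ {vs} i
    ...   | v′ , w , v∈ , w∈ , e = v′ , w , there v∈ , w∈ , e

    span-⊗-* : ∀ {vs ws y z} → Span A vs y → Span A ws z → Span A (vs ⊗ ws) (y * z)
    span-⊗-* {ws = ws} {z = z} y∈ z∈ = span-⊗ (span-resp (*-comm z _)
      (span-scale z (λ a∈ → span-resp (*-comm _ z) (span-scale _ (*∈ a∈) z∈)) y∈))

    stable-⊗ˡ : ∀ {vs ws x} → Stable vs x → Stable (vs ⊗ ws) x
    stable-⊗ˡ {vs} st u∈ with ∈-⊗ {vs} u∈
    ... | v , w , v∈ , w∈ , ≡.refl = span-resp (*-assoc _ _ _) (span-⊗-* (st v∈) (span-generator A-subring w∈))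

    stable-⊗ʳ : ∀ {vs ws x} → Stable ws x → Stable (vs ⊗ ws) x
    stable-⊗ʳ {vs} {x = x} st u∈ with ∈-⊗ {vs} u∈
    ... | v , w , v∈ , w∈ , ≡.refl = span-resp (solve 3 (λ x v w → v :* (x :* w) := x :* (v :* w)) x v w)
      (span-⊗-* (span-generator A-subring v∈) (st w∈))

    stable-powers : ∀ {x n} → Deg x n (x ^ n) → Stable (powers x n) x
    stable-powers {x} {n} rel v∈ = deg⇒span x (Relation.x*-closed x rel (deg-power x n v∈))

    span-powers-1 : ∀ {x n} → Deg x n (x ^ n) → Span A (powers x n) 1#
    span-powers-1 {x} {zero}  (nil e) = nil e
    span-powers-1 {x} {suc n} _       = span-generator A-subring (here ≡.refl)

    module _ {x y : Carrier} (x-int : IntegralOver x) (y-int : IntegralOver y) where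
      private
        vs = powers x (proj₁ x-int) ⊗ powers y (proj₁ y-int)

        1∈vs : Span A vs 1#
        1∈vs = span-resp (*-identityˡ 1#) (span-⊗-* {powers x (proj₁ x-int)} (span-powers-1 (proj₂ x-int)) (span-powers-1 (proj₂ y-int)))

        x-stable : Stable vs x
        x-stable = stable-⊗ˡ {powers x (proj₁ x-int)} (stable-powers (proj₂ x-int))

        y-stable : Stable vs y
        y-stable = stable-⊗ʳ {powers x (proj₁ x-int)} (stable-powers (proj₂ y-int))
        module S = IsSubring (stable-subring vs)

      -- Both `x` and `y` stabilise the module spanned by the products xⁱyʲ, and the elements that
      -- stabilise a module form a ring.
      integral-+ : IntegralOver (x + y)
      integral-+ = stable⇒integral (x + y) 1∈vs (S.+∈ x-stable y-stable)

      integral-* : IntegralOver (x * y)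
      integral-* = stable⇒integral (x * y) 1∈vs (S.*∈ x-stable y-stable)

      integral-neg : IntegralOver (- x)
      integral-neg = stable⇒integral (- x) 1∈vs (S.-∈ x-stable)

    integral-A : ∀ {b} → A b → IntegralOver b
    integral-A {b} b∈ = 1 , deg-resp b (sym (*-identityʳ b)) (deg-const b b∈)

    integral-resp : ∀ {x y} → x ≈ y → IntegralOver x → IntegralOver y
    integral-resp {x} {y} x≈y (n , rel) = n , go (^-congˡ n x≈y) rel
      where
      go : ∀ {n u v} → u ≈ v → Deg x n u → Deg y n v
      go u≈v (nil e)        = nil (trans (sym u≈v) e)
      go u≈v (cons a∈ z∈ e) = cons a∈ (go refl z∈) (trans (sym u≈v) (trans e (+-congˡ (*-congʳ x≈y))))

    integral-subring : IsSubring IntegralOver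
    integral-subring = record
      { resp = integral-resp
      ; 0∈   = integral-A 0∈
      ; 1∈   = integral-A 1∈
      ; +∈   = integral-+
      ; *∈   = integral-*
      ; -∈   = λ x-int → integral-neg x-int x-int
      }

    integral-root : ∀ {x} m → IntegralOver (x ^ suc m) → IntegralOver x
    integral-root {x} m (n , rel) = n ℕ.* suc m ,
      ≡.subst (λ k → Deg x (n ℕ.* suc m) (x ^ k)) (ℕ.*-comm (suc m) n) (deg-resp x (^-assocʳ x (suc m) n) (spread rel))
      where
      spread : ∀ {n y} → Deg (x ^ suc m) n y → Deg x (n ℕ.* suc m) y
      spread (nil e) = nil e
      spread {suc n} (cons a∈ z∈ e) = deg-resp x (sym e)
        (deg-+ x (cons a∈ (deg-0 x _) (solve 2 (λ a x → a := a :+ x :* con 0ℤ) _ x)) (deg-x^* x (suc m) (spread z∈)))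

    -- Clearing the denominators of an integral relation for z = s / q.
    numerator-power : ∀ {q s z} → A q → A s → q * z ≈ s → IntegralOver z → ∃ λ n → ∃ λ t → A t × s ^ n ≈ q * t
    numerator-power {q} {s} {z} q∈ s∈ qz≈s (n , rel) with go rel
      where
      go : ∀ {n y} → Deg z n y → ∃ λ t → A t × q ^ n * y ≈ q * t
      go (nil e) = 0# , 0∈ , trans (*-congˡ e) (trans (zeroʳ _) (sym (zeroʳ q)))
      go {suc n} {y} (cons {a = a} {z = w} a∈ w∈ e) with go w∈
      ... | t , t∈ , e′ = q ^ n * a + s * t , +∈ (*∈ (^∈ n q∈) a∈) (*∈ s∈ t∈) , (begin
        q * q ^ n * y  ≈⟨ *-congˡ e ⟩
        q * q ^ n * (a + z * w)
          ≈⟨ solve 5 (λ q u a z w → q :* u :* (a :+ z :* w) := q :* (u :* a) :+ q :* z :* (u :* w)) q (q ^ n) a z w ⟩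
        q * (q ^ n * a) + q * z * (q ^ n * w)  ≈⟨ +-congˡ (*-cong qz≈s e′) ⟩
        q * (q ^ n * a) + s * (q * t)
          ≈⟨ solve 4 (λ q v s t → q :* v :+ s :* (q :* t) := q :* (v :+ s :* t)) q (q ^ n * a) s t ⟩
        q * (q ^ n * a + s * t)  ∎)
    ... | t , t∈ , e = n , t , t∈ , trans (^-congˡ n (sym qz≈s)) (trans (^-distrib-* q z n) e)

  -- Nilpotents and the Frobenius map on a radical

  -- Multiplication by sᵉ⁺¹ fixes `z`, hence so does multiplication by its n-th power, which
  -- contains the factor sⁿ. The separate `z` allows for a weight: it is taken to be `s` in one
  -- application and `f * s` in the other.
  nilpotent-fixed : ∀ {z s} e n → z * s ^ suc e ≈ z → z * s ^ n ≈ 0# → z ≈ 0#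
  nilpotent-fixed {z} {s} e n fixed nilpotent = begin
    z  ≈⟨ iterate n ⟨
    z * (s ^ suc e) ^ n  ≈⟨ *-congˡ (^-distrib-* s (s ^ e) n) ⟩
    z * (s ^ n * (s ^ e) ^ n)  ≈⟨ *-assoc z _ _ ⟨
    z * s ^ n * (s ^ e) ^ n  ≈⟨ *-congʳ nilpotent ⟩
    0# * (s ^ e) ^ n  ≈⟨ zeroˡ _ ⟩
    0#  ∎
    where
    iterate : ∀ n → z * (s ^ suc e) ^ n ≈ z
    iterate zero    = *-identityʳ z
    iterate (suc n) = trans (sym (*-assoc z _ _)) (trans (*-congʳ fixed) (iterate n))

  regular-nilpotent : ∀ s e n → s * s ^ suc e ≈ s → s ^ n ≈ 0# → s ≈ 0#
  regular-nilpotent s e n regular nilpotent = nilpotent-fixed e n regular (trans (*-congˡ nilpotent) (zeroʳ s))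

  fixed-nilpotent : ∀ f s e n → f * s ^ suc (suc e) ≈ f * s → s ^ n ≈ 0# → f * s ≈ 0#
  fixed-nilpotent f s e n fixed nilpotent = nilpotent-fixed e n (trans (*-assoc f s _) fixed)
    (trans (*-congˡ nilpotent) (zeroʳ (f * s)))

  fixed-^ : ∀ x n i → x ^ n ≈ x → x ^ (n ℕ.^ i) ≈ x
  fixed-^ x n zero    _     = *-identityʳ x
  fixed-^ x n (suc i) fixed = trans (sym (^-assocʳ x n (n ℕ.^ i))) (trans (^-congˡ (n ℕ.^ i) fixed) (fixed-^ x n i fixed))

  -- With n = 1 + m j, the element f = αᵐʲ is idempotent when αⁿ = α, and
  -- raising an m-th root θ of α to the n-th power m times multiplies it by f.
  module RadicalFrobenius (m j n : ℕ) {l} (mj≡1+l : m ℕ.* j ≡ suc l) (n≡ : n ≡ suc (m ℕ.* j)) {α θ}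
    (θ^m≈α : θ ^ m ≈ α) (α^n≈α : α ^ n ≈ α) where

    support : Carrier
    support = α ^ (m ℕ.* j)

    θ^n≈ : θ ^ n ≈ θ * α ^ j
    θ^n≈ = begin
      θ ^ n  ≡⟨ ≡.cong (θ ^_) n≡ ⟩
      θ * θ ^ (m ℕ.* j)  ≈⟨ *-congˡ (^-assocʳ θ m j) ⟨
      θ * (θ ^ m) ^ j  ≈⟨ *-congˡ (^-congˡ j θ^m≈α) ⟩
      θ * α ^ j  ∎

    α^j-fixed : (α ^ j) ^ n ≈ α ^ j
    α^j-fixed = trans (^-comm α j n) (^-congˡ j α^n≈α)

    θ^nⁱ≈ : ∀ i → θ ^ (n ℕ.^ i) ≈ θ * (α ^ j) ^ i
    θ^nⁱ≈ zero    = refl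
    θ^nⁱ≈ (suc i) = begin
      θ ^ (n ℕ.* n ℕ.^ i)  ≈⟨ ^-assocʳ θ n (n ℕ.^ i) ⟨
      (θ ^ n) ^ (n ℕ.^ i)  ≈⟨ ^-congˡ (n ℕ.^ i) θ^n≈ ⟩
      (θ * α ^ j) ^ (n ℕ.^ i)  ≈⟨ ^-distrib-* θ (α ^ j) (n ℕ.^ i) ⟩
      θ ^ (n ℕ.^ i) * (α ^ j) ^ (n ℕ.^ i)  ≈⟨ *-cong (θ^nⁱ≈ i) (fixed-^ (α ^ j) n i α^j-fixed) ⟩
      θ * (α ^ j) ^ i * α ^ j  ≈⟨ trans (*-assoc θ _ _) (*-congˡ (*-comm _ _)) ⟩
      θ * (α ^ j * (α ^ j) ^ i)  ∎

    α*support : α * support ≈ α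
    α*support = trans (reflexive (≡.cong (α ^_) (≡.sym n≡))) α^n≈α

    support-idem : support * support ≈ support
    support-idem = begin
      -- Since `m * j` is positive, the first support has a factor `α`, and `α` absorbs the second
      -- one.
      support * support  ≡⟨ ≡.cong (λ i → α ^ i * support) mj≡1+l ⟩
      α * α ^ l * support  ≈⟨ solve 3 (λ a b s → a :* b :* s := a :* s :* b) α (α ^ l) support ⟩
      α * support * α ^ l  ≈⟨ *-congʳ α*support ⟩
      α * α ^ l  ≡⟨ ≡.cong (α ^_) mj≡1+l ⟨
      support  ∎

    support-fixes-θ : support * θ ^ (n ℕ.^ m) ≈ support * θ
    support-fixes-θ = begin
      support * θ ^ (n ℕ.^ m)  ≈⟨ *-congˡ (θ^nⁱ≈ m) ⟩
      support * (θ * (α ^ j) ^ m)  ≈⟨ *-congˡ (*-congˡ (trans (^-comm α j m) (^-assocʳ α m j))) ⟩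
      support * (θ * support)  ≈⟨ solve 2 (λ s t → s :* (t :* s) := s :* s :* t) support θ ⟩
      support * support * θ  ≈⟨ *-congʳ support-idem ⟩
      support * θ  ∎

-- Divisibility of integers

prime∣^ : ∀ {p} → Prime p → ∀ m n → p ℕ.∣ m ℕ.^ n → p ℕ.∣ m
prime∣^ pr m zero    d = ⊥-elim (ℕ.>⇒∤ (ℕ.nonTrivial⇒n>1 _ {{prime⇒nonTrivial pr}}) d)
prime∣^ pr m (suc n) d with euclidsLemma m (m ℕ.^ n) pr d
... | inj₁ d′ = d′
... | inj₂ d′ = prime∣^ pr m n d′

abs-^ : ∀ i n → ℤ.∣ i ℤ.^ n ∣ ≡ ℤ.∣ i ∣ ℕ.^ n
abs-^ i zero    = ≡.refl
abs-^ i (suc n) = ≡.trans (ℤ.abs-* i (i ℤ.^ n)) (≡.cong (ℤ.∣ i ∣ ℕ.*_) (abs-^ i n))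

parity : ∀ n → 2 ℕ.∣ n ⊎ ∃ λ j → n ≡ suc (j ℕ.+ j)
parity zero    = inj₁ (ℕ.divides 0 ≡.refl)
parity (suc n) with parity n
... | inj₁ (ℕ.divides j e) = inj₂ (j , ≡.cong suc (≡.trans e (≡.trans (ℕ.*-comm j 2) (≡.cong (j ℕ.+_) (ℕ.+-identityʳ j)))))
... | inj₂ (j , e) = inj₁ (ℕ.divides (suc j) (≡.cong suc (≡.trans e (≡.cong suc (≡.sym (≡.trans (ℕ.*-comm j 2) (≡.cong (j ℕ.+_) (ℕ.+-identityʳ j))))))))

infix 4 _∣∣_
_∣∣_ : ℕ → ℤ → Set
m ∣∣ i = m ℕ.∣ ℤ.∣ i ∣

n<m^n : ∀ m n → 1 < m → n < m ℕ.^ n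
n<m^n m zero    1<m = s≤s z≤n
n<m^n m (suc n) 1<m = ℕ.<-≤-trans (s≤s (n<m^n m n 1<m)) (ℕ.≤-trans (double (m ℕ.^ n) (ℕ.m^n>0 m n)) (ℕ.*-monoˡ-≤ (m ℕ.^ n) 1<m))
  where
  instance _ = ℕ.>-nonZero (ℕ.<-trans (s≤s z≤n) 1<m)
  double : ∀ x → 0 < x → suc x ≤ 2 ℕ.* x
  double x 0<x = ℕ.+-mono-≤ 0<x (ℕ.≤-reflexive (≡.sym (ℕ.+-identityʳ x)))

allPowers⇒≡0 : ∀ m → 1 < m → ∀ i → (∀ n → m ℕ.^ n ∣∣ i) → i ≡ 0ℤ
-- The exponent ∣i∣ is enough, because its power of `m` exceeds ∣i∣.
allPowers⇒≡0 m 1<m i d = ℤ.∣i∣≡0⇒i≡0 (zero! ℤ.∣ i ∣ (d ℤ.∣ i ∣))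
  where
  zero! : ∀ n → m ℕ.^ n ℕ.∣ n → n ≡ 0
  zero! zero    _ = ≡.refl
  zero! (suc n) e = contradiction (ℕ.∣⇒≤ e) (ℕ.<⇒≱ (n<m^n m (suc n) 1<m))

-- Factors of a difference of powers

module PolynomialFactor {c ℓ} (B : CommutativeRing c ℓ) where
  open CommutativeRing B hiding (zero)
  open Algebra.Properties.CommutativeSemiring.Exp commutativeSemiring
  open Polynomials B
  open IntegerSolver B
  open Relation.Binary.Reasoning.Setoid setoid

  eval : Poly → Carrier → Carrier
  eval []      x = 0#
  eval (a ∷ f) x = a + x * eval f x

  eval-0 : ∀ f x → (∀ n → coeff f n ≈ 0#) → eval f x ≈ 0#
  eval-0 []      x z = refl
  eval-0 (a ∷ f) x z = trans (+-cong (z 0) (trans (*-congˡ (eval-0 f x (λ n → z (suc n)))) (zeroʳ x))) (+-identityˡ 0#)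

  eval-cong : ∀ f g x → f ≈ᴾ g → eval f x ≈ eval g x
  eval-cong []      g       x e = sym (eval-0 g x (λ n → sym (e n)))
  eval-cong (a ∷ f) []      x e = eval-0 (a ∷ f) x e
  eval-cong (a ∷ f) (b ∷ g) x e = +-cong (e 0) (*-congˡ (eval-cong f g x (λ n → e (suc n))))

  eval-+ : ∀ f g x → eval (f +ᴾ g) x ≈ eval f x + eval g x
  eval-+ []      g       x = sym (+-identityˡ _)
  eval-+ (a ∷ f) []      x = sym (+-identityʳ _)
  eval-+ (a ∷ f) (b ∷ g) x = trans (+-congˡ (*-congˡ (eval-+ f g x)))
    (solve 5 (λ a b x f g → a :+ b :+ x :* (f :+ g) := a :+ x :* f :+ (b :+ x :* g)) a b x (eval f x) (eval g x))

  eval-map : ∀ a f x → eval (map (a *_) f) x ≈ a * eval f x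
  eval-map a []      x = sym (zeroʳ a)
  eval-map a (b ∷ f) x = trans (+-congˡ (*-congˡ (eval-map a f x)))
    (solve 4 (λ a b x f → a :* b :+ x :* (a :* f) := a :* (b :+ x :* f)) a b x (eval f x))

  eval-* : ∀ f g x → eval (f *ᴾ g) x ≈ eval f x * eval g x
  eval-* []      g x = sym (zeroˡ _)
  eval-* (a ∷ f) g x = begin
    eval (map (a *_) g +ᴾ (0# ∷ f *ᴾ g)) x  ≈⟨ eval-+ (map (a *_) g) (0# ∷ f *ᴾ g) x ⟩
    eval (map (a *_) g) x + (0# + x * eval (f *ᴾ g) x)
      ≈⟨ +-cong (eval-map a g x) (+-congˡ (*-congˡ (eval-* f g x))) ⟩
    a * eval g x + (0# + x * (eval f x * eval g x))
      ≈⟨ solve 4 (λ a x f g → a :* g :+ (con 0ℤ :+ x :* (f :* g)) := (a :+ x :* f) :* g) a x (eval f x) (eval g x) ⟩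
    (a + x * eval f x) * eval g x  ∎

  private module ᴾ = RawSemiringDefs rawSemiring

  -- The equation q f = 1 is evaluated at a root of `f`. A root thus takes the place of positive
  -- degree as evidence against being a unit, and nothing has to be decided about the vanishing of
  -- coefficients.
  unit-no-root : ∀ {f x} → f ᴾ.∣ constant 1# → eval f x ≈ 0# → 1# ≈ 0#
  unit-no-root {f} {x} (q RawMagma., e) root = begin
    1#  ≈⟨ solve 1 (λ x → con 1ℤ := con 1ℤ :+ x :* con 0ℤ) x ⟩
    eval (constant 1#) x  ≈⟨ eval-cong (q *ᴾ f) (constant 1#) x e ⟨
    eval (q *ᴾ f) x  ≈⟨ eval-* q f x ⟩
    eval q x * eval f x  ≈⟨ *-congˡ root ⟩
    eval q x * 0#  ≈⟨ zeroʳ _ ⟩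
    0#  ∎

  coeff-+ : ∀ f g n → coeff (f +ᴾ g) n ≈ coeff f n + coeff g n
  coeff-+ []      g       n       = sym (+-identityˡ _)
  coeff-+ (a ∷ f) []      n       = sym (+-identityʳ _)
  coeff-+ (a ∷ f) (b ∷ g) zero    = refl
  coeff-+ (a ∷ f) (b ∷ g) (suc n) = coeff-+ f g n

  coeff-map : ∀ a f n → coeff (map (a *_) f) n ≈ a * coeff f n
  coeff-map a []      n       = sym (zeroʳ a)
  coeff-map a (b ∷ f) zero    = refl
  coeff-map a (b ∷ f) (suc n) = coeff-map a f n

  coeff-0 : ∀ n → coeff (0# ∷ []) n ≈ 0#
  coeff-0 zero    = refl
  coeff-0 (suc n) = refl

  linear : Carrier → Poly
  linear b = b ∷ 1# ∷ []

  coeff-linear-zero : ∀ b f → coeff (linear b *ᴾ f) 0 ≈ b * coeff f 0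
  coeff-linear-zero b f = trans (coeff-+ (map (b *_) f) _ 0) (trans (+-congʳ (coeff-map b f 0)) (+-identityʳ _))

  coeff-linear-suc : ∀ b f n → coeff (linear b *ᴾ f) (suc n) ≈ b * coeff f (suc n) + coeff f n
  coeff-linear-suc b f n = begin
    coeff (linear b *ᴾ f) (suc n)  ≈⟨ coeff-+ (map (b *_) f) _ (suc n) ⟩
    coeff (map (b *_) f) (suc n) + coeff (map (1# *_) f +ᴾ (0# ∷ [])) n
      ≈⟨ +-cong (coeff-map b f (suc n)) (coeff-+ (map (1# *_) f) (0# ∷ []) n) ⟩
    b * coeff f (suc n) + (coeff (map (1# *_) f) n + coeff (0# ∷ []) n)
      ≈⟨ +-congˡ (+-cong (trans (coeff-map 1# f n) (*-identityˡ _)) (coeff-0 n)) ⟩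
    b * coeff f (suc n) + (coeff f n + 0#)  ≈⟨ +-congˡ (+-identityʳ _) ⟩
    b * coeff f (suc n) + coeff f n  ∎

  coeff-X^-suc : ∀ n j → coeff (X ^ᴾ suc n) (suc j) ≈ coeff (X ^ᴾ n) j
  coeff-X^-suc n j = trans (coeff-linear-suc 0# (X ^ᴾ n) j) (trans (+-congʳ (zeroˡ _)) (+-identityˡ _))

  coeff-X^-zero : ∀ n → coeff (X ^ᴾ suc n) 0 ≈ 0#
  coeff-X^-zero n = trans (coeff-linear-zero 0# (X ^ᴾ n)) (zeroˡ _)

  module _ (t : Carrier) where
    -- The quotient of Xⁿ⁺¹ - tⁿ⁺¹ by X - t, that is, the sum of the tⁿ⁻ⁱXⁱ.
    cofactor : ℕ → Poly
    cofactor zero    = 1# ∷ []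
    cofactor (suc n) = t ^ suc n ∷ cofactor n

    coeff-cofactor-zero : ∀ n → coeff (cofactor n) 0 ≈ t ^ n
    coeff-cofactor-zero zero    = refl
    coeff-cofactor-zero (suc n) = refl

    coeff-cofactor-suc : ∀ n j → - t * coeff (cofactor n) (suc j) + coeff (cofactor n) j ≈ coeff (X ^ᴾ n) j
    coeff-cofactor-suc zero    zero    = trans (+-congʳ (zeroʳ (- t))) (+-identityˡ 1#)
    coeff-cofactor-suc zero    (suc j) = trans (+-congʳ (zeroʳ (- t))) (+-identityˡ 0#)
    coeff-cofactor-suc (suc n) zero    = begin
      - t * coeff (cofactor n) 0 + t * t ^ n  ≈⟨ +-congʳ (*-congˡ (coeff-cofactor-zero n)) ⟩
      - t * t ^ n + t * t ^ n  ≈⟨ solve 2 (λ t u → :- t :* u :+ t :* u := con 0ℤ) t (t ^ n) ⟩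
      0#  ≈⟨ coeff-X^-zero n ⟨
      coeff (X ^ᴾ suc n) 0  ∎
    coeff-cofactor-suc (suc n) (suc j) = trans (coeff-cofactor-suc n j) (sym (coeff-X^-suc n j))

    factorisation : ∀ n {a} → t ^ suc n ≈ a → (X ^ᴾ suc n) +ᴾ constant (- a) ≈ᴾ linear (- t) *ᴾ cofactor n
    factorisation n {a} e zero = begin
      coeff ((X ^ᴾ suc n) +ᴾ constant (- a)) 0  ≈⟨ coeff-+ (X ^ᴾ suc n) (constant (- a)) 0 ⟩
      coeff (X ^ᴾ suc n) 0 + - a  ≈⟨ +-cong (coeff-X^-zero n) (-‿cong (sym e)) ⟩
      0# + - (t * t ^ n)  ≈⟨ solve 2 (λ t u → con 0ℤ :+ :- (t :* u) := :- t :* u) t (t ^ n) ⟩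
      - t * t ^ n  ≈⟨ *-congˡ (coeff-cofactor-zero n) ⟨
      - t * coeff (cofactor n) 0  ≈⟨ coeff-linear-zero (- t) (cofactor n) ⟨
      coeff (linear (- t) *ᴾ cofactor n) 0  ∎
    factorisation n {a} e (suc j) = begin
      coeff ((X ^ᴾ suc n) +ᴾ constant (- a)) (suc j)  ≈⟨ coeff-+ (X ^ᴾ suc n) (constant (- a)) (suc j) ⟩
      coeff (X ^ᴾ suc n) (suc j) + 0#  ≈⟨ trans (+-identityʳ _) (coeff-X^-suc n j) ⟩
      coeff (X ^ᴾ n) j  ≈⟨ coeff-cofactor-suc n j ⟨
      - t * coeff (cofactor n) (suc j) + coeff (cofactor n) j  ≈⟨ coeff-linear-suc (- t) (cofactor n) j ⟨
      coeff (linear (- t) *ᴾ cofactor n) (suc j)  ∎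

    eval-cofactor : ∀ n x → (x - t) * eval (cofactor n) x ≈ x ^ suc n - t ^ suc n
    eval-cofactor zero    x = solve 2 (λ x t → (x :- t) :* (con 1ℤ :+ x :* con 0ℤ) := x :* con 1ℤ :- t :* con 1ℤ) x t
    eval-cofactor (suc n) x = begin
      (x - t) * (t ^ suc n + x * eval (cofactor n) x)
        ≈⟨ solve 4 (λ x t u e → (x :- t) :* (u :+ x :* e) := (x :- t) :* u :+ x :* ((x :- t) :* e)) x t (t ^ suc n) (eval (cofactor n) x) ⟩
      (x - t) * t ^ suc n + x * ((x - t) * eval (cofactor n) x)  ≈⟨ +-congˡ (*-congˡ (eval-cofactor n x)) ⟩
      (x - t) * t ^ suc n + x * (x ^ suc n - t ^ suc n)
        ≈⟨ solve 4 (λ x t u v → (x :- t) :* u :+ x :* (v :- u) := x :* v :- t :* u) x t (t ^ suc n) (x ^ suc n) ⟩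
      x * x ^ suc n - t * t ^ suc n  ∎

    eval-linear : eval (linear (- t)) t ≈ 0#
    eval-linear = solve 1 (λ t → :- t :+ t :* (con 1ℤ :+ t :* con 0ℤ) := con 0ℤ) t

    -- The factor X - t has the root `t` and its cofactor the root `x`, so neither can be a unit of
    -- a nontrivial polynomial ring.
    irreducible⇒no-power : ∀ n {a} → t ^ suc n ≈ a → Irreducible ((X ^ᴾ suc n) +ᴾ constant (- a)) →
                           ∀ {x} → eval (cofactor n) x ≈ 0# → 1# ≈ 0#
    irreducible⇒no-power n e irr root = go (ᴾ.Irreducible.split-∣1 irr (factorisation n e))
      where
      go : linear (- t) ᴾ.∣ constant 1# ⊎ cofactor n ᴾ.∣ constant 1# → 1# ≈ 0#
      go (inj₁ d) = unit-no-root d eval-linear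
      go (inj₂ d) = unit-no-root d root

-- Integers and integral elements in a field of characteristic zero

module FieldTheory {c ℓ₁ ℓ₂} (L : HeytingField c ℓ₁ ℓ₂) (char0 : FieldDefs.CharacteristicZero L) where
  open FieldDefs L using
    ( commutativeRing; _×ₙ_; fromℤ; evalℤ; Integral; IsPrimitiveRoot; gen; subring; Subring⟨_⟩; Subfield⟨_⟩
    ; ℤ[_]; ℤ[_][_]; ℚ⟮_,_⟯; 𝓞)
  open CommutativeRing commutativeRing hiding (zero)
  open HeytingField L using (tight; #⇒invertible)
  open Algebra.Properties.CommutativeSemiring.Exp commutativeSemiring
  open Algebra.Properties.Ring ring using (-0#≈0#; x∙y⁻¹≈ε⇒x≈y)
  open IntegerSolver commutativeRing
  open Adjunction commutativeRing
  open Relation.Binary.Reasoning.Setoid setoid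

  -- By tightness equality is the negation of apartness. This is what permits inverses and case
  -- distinctions inside the proof of an equation.
  ≈-stable : ∀ {x y} → ¬ ¬ (x ≈ y) → x ≈ y
  ≈-stable {x} {y} ¬¬e = proj₁ (tight x y) λ x#y → ¬¬e λ e → proj₂ (tight x y) e x#y

  ¬¬-inverse : ∀ {x} → ¬ (x ≈ 0#) → ¬ ¬ (∃ λ y → x * y ≈ 1#)
  ¬¬-inverse {x} x≉0 ¬inv = x≉0 (proj₁ (tight x 0#) λ x#0 → let (y , _ , e) = #⇒invertible x#0 in
    ¬inv (y , trans (*-congʳ (solve 1 (λ x → x := x :- con 0ℤ) x)) e))

  noZeroDivisors : ∀ {x y} → ¬ (x ≈ 0#) → x * y ≈ 0# → y ≈ 0#
  noZeroDivisors {x} {y} x≉0 xy≈0 = ≈-stable λ y≉0 → ¬¬-inverse x≉0 λ (x⁻¹ , e) → y≉0 (begin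
    y  ≈⟨ *-identityʳ y ⟨
    y * 1#  ≈⟨ *-congˡ e ⟨
    y * (x * x⁻¹)  ≈⟨ solve 3 (λ x x⁻¹ y → y :* (x :* x⁻¹) := x :* y :* x⁻¹) x x⁻¹ y ⟩
    x * y * x⁻¹  ≈⟨ *-congʳ xy≈0 ⟩
    0# * x⁻¹  ≈⟨ zeroˡ x⁻¹ ⟩
    0#  ∎)

  *-cancelˡ : ∀ {x y z} → ¬ (x ≈ 0#) → x * y ≈ x * z → y ≈ z
  *-cancelˡ {x} {y} {z} x≉0 e = x∙y⁻¹≈ε⇒x≈y y z (noZeroDivisors x≉0 (begin
    x * (y - z)  ≈⟨ solve 3 (λ x y z → x :* (y :- z) := x :* y :- x :* z) x y z ⟩
    x * y - x * z  ≈⟨ +-congʳ e ⟩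
    x * z - x * z  ≈⟨ -‿inverseʳ _ ⟩
    0#  ∎))

  1≉0 : ¬ (1# ≈ 0#)
  1≉0 e = contradiction (char0 1 (trans (+-identityʳ 1#) e)) λ ()

  ^-≉0 : ∀ {x} n → ¬ (x ≈ 0#) → ¬ (x ^ n ≈ 0#)
  ^-≉0 zero    x≉0 e = 1≉0 e
  ^-≉0 (suc n) x≉0 e = ^-≉0 n x≉0 (noZeroDivisors x≉0 e)

  ι : ℕ → Carrier
  ι n = n ×ₙ 1#

  ι≉0 : ∀ n .{{_ : ℕ.NonZero n}} → ¬ (ι n ≈ 0#)
  ι≉0 (suc n) e = contradiction (char0 (suc n) e) λ ()

  ×ᵤ≈⟦⟧ : ∀ n → ι n ≈ ⟦ + n ⟧ᶻ
  ×ᵤ≈⟦⟧ n = Algebra.Properties.Semiring.Mult.TCOptimised.×ᵤ≈× semiring n 1#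

  fromℤ≈⟦⟧ : ∀ i → fromℤ i ≈ ⟦ i ⟧ᶻ
  fromℤ≈⟦⟧ (+ n)    = ×ᵤ≈⟦⟧ n
  fromℤ≈⟦⟧ -[1+ n ] = -‿cong (×ᵤ≈⟦⟧ (suc n))

  fromℤ-+ : ∀ i j → fromℤ (i ℤ.+ j) ≈ fromℤ i + fromℤ j
  fromℤ-+ i j = trans (fromℤ≈⟦⟧ (i ℤ.+ j)) (trans (+-homoᶻ i j) (sym (+-cong (fromℤ≈⟦⟧ i) (fromℤ≈⟦⟧ j))))

  fromℤ-* : ∀ i j → fromℤ (i ℤ.* j) ≈ fromℤ i * fromℤ j
  fromℤ-* i j = trans (fromℤ≈⟦⟧ (i ℤ.* j)) (trans (*-homoᶻ i j) (sym (*-cong (fromℤ≈⟦⟧ i) (fromℤ≈⟦⟧ j))))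

  fromℤ-neg : ∀ i → fromℤ (ℤ.- i) ≈ - fromℤ i
  fromℤ-neg i = trans (fromℤ≈⟦⟧ (ℤ.- i)) (trans (-‿homoᶻ i) (sym (-‿cong (fromℤ≈⟦⟧ i))))

  fromℤ-1 : fromℤ 1ℤ ≈ 1#
  fromℤ-1 = +-identityʳ 1#

  fromℤ-^ : ∀ i n → fromℤ (i ℤ.^ n) ≈ fromℤ i ^ n
  fromℤ-^ i zero    = fromℤ-1
  fromℤ-^ i (suc n) = trans (fromℤ-* i (i ℤ.^ n)) (*-congˡ (fromℤ-^ i n))

  fromℤ≈0 : ∀ i → fromℤ i ≈ 0# → i ≡ 0ℤ
  fromℤ≈0 (+ n)    e = ≡.cong +_ (char0 n e)
  fromℤ≈0 -[1+ n ] e = contradiction (char0 (suc n) (trans (solve 1 (λ x → x := :- (:- x)) _) (trans (-‿cong e) -0#≈0#))) λ ()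

  fromℤ-injective : ∀ i j → fromℤ i ≈ fromℤ j → i ≡ j
  fromℤ-injective i j e = ℤ.i-j≡0⇒i≡j i j (fromℤ≈0 (i ℤ.- j) (begin
    fromℤ (i ℤ.- j)  ≈⟨ fromℤ-+ i (ℤ.- j) ⟩
    fromℤ i + fromℤ (ℤ.- j)  ≈⟨ +-cong e (fromℤ-neg j) ⟩
    fromℤ j - fromℤ j  ≈⟨ -‿inverseʳ _ ⟩
    0#  ∎))

  ι-* : ∀ m n → ι (m ℕ.* n) ≈ ι m * ι n
  ι-* = Algebra.Properties.Semiring.Mult.×1-homo-* semiring

  ι-^ : ∀ m n → ι (m ℕ.^ n) ≈ ι m ^ n
  ι-^ m zero    = fromℤ-1
  ι-^ m (suc n) = trans (ι-* m (m ℕ.^ n)) (*-congˡ (ι-^ m n))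

  module _ where
    open FieldDefs L using (resp; 0∈; 1∈; +∈; *∈; -∈)

    subring-isSubring : ∀ {x} (S : Pred Carrier x) → IsSubring Subring⟨ S ⟩
    subring-isSubring S = record { resp = resp ; 0∈ = 0∈ ; 1∈ = 1∈ ; +∈ = +∈ ; *∈ = *∈ ; -∈ = -∈ }

    subring-least : ∀ {x a} {S : Pred Carrier x} {A : Pred Carrier a} → IsSubring A → S ⊆ A → Subring⟨ S ⟩ ⊆ A
    subring-least A S⊆A (gen s)    = S⊆A s
    subring-least A S⊆A (resp e d) = IsSubring.resp A e (subring-least A S⊆A d)
    subring-least A S⊆A 0∈         = IsSubring.0∈ A
    subring-least A S⊆A 1∈         = IsSubring.1∈ A
    subring-least A S⊆A (+∈ d d′)  = IsSubring.+∈ A (subring-least A S⊆A d) (subring-least A S⊆A d′)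
    subring-least A S⊆A (*∈ d d′)  = IsSubring.*∈ A (subring-least A S⊆A d) (subring-least A S⊆A d′)
    subring-least A S⊆A (-∈ d)     = IsSubring.-∈ A (subring-least A S⊆A d)

  Int : Pred Carrier ℓ₁
  Int x = ∃ λ i → x ≈ fromℤ i

  int-subring : IsSubring Int
  int-subring = record
    { resp = λ x≈y (i , e) → i , trans (sym x≈y) e
    ; 0∈   = 0ℤ , refl
    ; 1∈   = 1ℤ , sym fromℤ-1
    ; +∈   = λ (i , e) (j , e′) → i ℤ.+ j , trans (+-cong e e′) (sym (fromℤ-+ i j))
    ; *∈   = λ (i , e) (j , e′) → i ℤ.* j , trans (*-cong e e′) (sym (fromℤ-* i j))
    ; -∈   = λ (i , e) → ℤ.- i , trans (-‿cong e) (sym (fromℤ-neg i))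
    }

  module _ {a} {A : Pred Carrier a} (A-subring : IsSubring A) where
    private module A∈ = IsSubring A-subring

    ι∈ : ∀ n → A (ι n)
    ι∈ zero    = A∈.0∈
    ι∈ (suc n) = A∈.+∈ A∈.1∈ (ι∈ n)

    fromℤ∈ : ∀ i → A (fromℤ i)
    fromℤ∈ (+ n)    = ι∈ n
    fromℤ∈ -[1+ n ] = A∈.-∈ (ι∈ (suc n))

    int∈ : Int ⊆ A
    int∈ (i , e) = A∈.resp (sym e) (fromℤ∈ i)

  open Integrality int-subring public

  evalℤ-∷ʳ : ∀ as x → evalℤ (as ∷ʳ 1ℤ) x ≈ evalℤ as x + x ^ length as
  evalℤ-∷ʳ []       x = trans (+-cong fromℤ-1 (zeroʳ x)) (+-comm _ _)
  evalℤ-∷ʳ (a ∷ as) x = trans (+-congˡ (*-congˡ (evalℤ-∷ʳ as x)))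
    (solve 4 (λ a x e t → a :+ x :* (e :+ t) := a :+ x :* e :+ x :* t) (fromℤ a) x (evalℤ as x) (x ^ length as))

  evalℤ-deg : ∀ as x → Degree.Deg int-subring x (length as) (evalℤ as x)
  evalℤ-deg []       x = Degree.nil refl
  evalℤ-deg (a ∷ as) x = Degree.cons (a , refl) (evalℤ-deg as x) refl

  integral⇒ : ∀ {x} → Integral x → IntegralOver x
  integral⇒ {x} (as , e) = length as , Degree.deg-resp int-subring x eq (Degree.deg-neg int-subring x (evalℤ-deg as x))
    where
    eq : - evalℤ as x ≈ x ^ length as
    eq = begin
      - evalℤ as x  ≈⟨ +-identityˡ _ ⟨
      0# - evalℤ as x  ≈⟨ +-congʳ (trans (sym (evalℤ-∷ʳ as x)) e) ⟨
      evalℤ as x + x ^ length as - evalℤ as x  ≈⟨ solve 2 (λ u v → u :+ v :- u := v) _ _ ⟩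
      x ^ length as  ∎

  deg⇒evalℤ : ∀ {x n y} → Degree.Deg int-subring x n y → ∃ λ as → length as ≡ n × y ≈ evalℤ as x
  deg⇒evalℤ (Degree.nil e) = [] , ≡.refl , e
  deg⇒evalℤ (Degree.cons (i , a≈i) z∈ e) with deg⇒evalℤ z∈
  ... | as , l , e′ = i ∷ as , ≡.cong suc l , trans e (+-cong a≈i (*-congˡ e′))

  ⇒integral : ∀ {x} → IntegralOver x → Integral x
  ⇒integral {x} (n , rel) with deg⇒evalℤ (Degree.deg-neg int-subring x rel)
  ... | as , ≡.refl , e = as , trans (evalℤ-∷ʳ as x) (trans (+-congʳ (sym e)) (-‿inverseˡ _))

  extendScalars : ∀ {a} {A : Pred Carrier a} (A-subring : IsSubring A) {x} → IntegralOver x → Integrality.IntegralOver A-subring x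
  extendScalars A-subring {x} (n , rel) = n , go rel
    where
    go : ∀ {n y} → Degree.Deg int-subring x n y → Degree.Deg A-subring x n y
    go (Degree.nil e)        = Degree.nil e
    go (Degree.cons a∈ z∈ e) = Degree.cons (int∈ A-subring a∈) (go z∈) e

  fromℤ≈ι* : ∀ p i j → fromℤ i ≈ ι p * fromℤ j → p ℕ.∣ ℤ.∣ i ∣
  fromℤ≈ι* p i j e = ℕ.divides ℤ.∣ j ∣ (≡.trans (≡.cong ℤ.∣_∣ i≡pj) (≡.trans (ℤ.abs-* (+ p) j) (ℕ.*-comm p _)))
    where
    i≡pj : i ≡ + p ℤ.* j
    i≡pj = fromℤ-injective i _ (trans e (sym (fromℤ-* (+ p) j)))

  -- The rational root theorem: clearing denominators shows that `p` divides a power of `i`.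
  integral-fraction : ∀ {p} → Prime p → ∀ {z} i → ι p * z ≈ fromℤ i → IntegralOver z → p ℕ.∣ ℤ.∣ i ∣
  integral-fraction {p} pr i e z-int with numerator-power (+ p , refl) (i , refl) e z-int
  ... | n , t , (j , t≈j) , e′ = prime∣^ pr ℤ.∣ i ∣ n (≡.subst (p ℕ.∣_) (abs-^ i n)
    (fromℤ≈ι* p (i ℤ.^ n) j (trans (fromℤ-^ i n) (trans e′ (*-congˡ t≈j)))))

  integral-fraction-^ : ∀ {p} → Prime p → ∀ {z} i n → ι p * z ≈ fromℤ i ^ n → IntegralOver z → p ℕ.∣ ℤ.∣ i ∣
  integral-fraction-^ {p} pr i n e z-int = prime∣^ pr ℤ.∣ i ∣ n (≡.subst (p ℕ.∣_) (abs-^ i n)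
    (integral-fraction pr (i ℤ.^ n) (trans e (sym (fromℤ-^ i n))) z-int))

  -- The lowest nonzero coefficient of an integral equation for `s` is a multiple of `s`; zeros
  -- below it are removed by cancelling `s`. The coefficients are integers, so the search for it
  -- needs no decision in `L`.
  nonzero-multiple : ∀ {a} {A : Pred Carrier a} → IsSubring A → ∀ {s} → A s → ¬ (s ≈ 0#) → IntegralOver s →
    ∃ λ m → ∃ λ t → ℕ.NonZero m × A t × s * t ≈ ι m
  nonzero-multiple {A = A} A-subring {s} s∈ s≉0 s-int = go (proj₁ (⇒integral s-int)) (proj₂ (⇒integral s-int))
    where
    open IsSubring A-subring renaming (resp to A-resp; 0∈ to A-0∈; 1∈ to A-1∈; +∈ to A-+∈; *∈ to A-*∈; -∈ to A--∈)

    evalℤ∈ : ∀ as → A (evalℤ as s)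
    evalℤ∈ []       = A-0∈
    evalℤ∈ (a ∷ as) = A-+∈ (fromℤ∈ A-subring a) (A-*∈ s∈ (evalℤ∈ as))

    go : ∀ as → evalℤ (as ∷ʳ 1ℤ) s ≈ 0# → ∃ λ m → ∃ λ t → ℕ.NonZero m × A t × s * t ≈ ι m
    go [] e = contradiction (trans (sym (trans (+-cong fromℤ-1 (zeroʳ s)) (+-identityʳ 1#))) e) 1≉0
    go (+ zero ∷ as) e = go as (noZeroDivisors s≉0 (trans (sym (+-identityˡ _)) e))
    go (+ suc n ∷ as) e = suc n , - evalℤ (as ∷ʳ 1ℤ) s , _ , A--∈ (evalℤ∈ (as ∷ʳ 1ℤ)) , (begin
      s * - E  ≈⟨ solve 3 (λ s e a → s :* (:- e) := a :- (a :+ s :* e)) s E (ι (suc n)) ⟩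
      ι (suc n) - (ι (suc n) + s * E)  ≈⟨ +-congˡ (trans (-‿cong e) -0#≈0#) ⟩
      ι (suc n) + 0#  ≈⟨ +-identityʳ _ ⟩
      ι (suc n)  ∎)
      where E = evalℤ (as ∷ʳ 1ℤ) s
    go (-[1+ n ] ∷ as) e = suc n , evalℤ (as ∷ʳ 1ℤ) s , _ , evalℤ∈ (as ∷ʳ 1ℤ) , (begin
      s * E  ≈⟨ solve 3 (λ s e a → s :* e := a :+ (:- a :+ s :* e)) s E (ι (suc n)) ⟩
      ι (suc n) + (- ι (suc n) + s * E)  ≈⟨ +-congˡ e ⟩
      ι (suc n) + 0#  ≈⟨ +-identityʳ _ ⟩
      ι (suc n)  ∎)
      where E = evalℤ (as ∷ʳ 1ℤ) s

  -- Synthetic division and counting of roots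

  -- horner a as x = Σᵢ asᵢ xⁱ + a xⁿ, where n is the length of as.
  horner : Carrier → List Carrier → Carrier → Carrier
  horner a []       x = a
  horner a (b ∷ bs) x = b + x * horner a bs x

  module _ (a r : Carrier) where
    -- Horner's scheme: the intermediate values of the evaluation at `r` are the coefficients of the
    -- quotient by x - r.
    synthetic : Carrier → List Carrier → List Carrier
    synthetic b []       = []
    synthetic b (c ∷ bs) = horner a (c ∷ bs) r ∷ synthetic c bs

    length-synthetic : ∀ b bs → length (synthetic b bs) ≡ length bs
    length-synthetic b []       = ≡.refl
    length-synthetic b (c ∷ bs) = ≡.cong suc (length-synthetic c bs)

    synthetic-division : ∀ b bs x → horner a (b ∷ bs) x ≈ (x - r) * horner a (synthetic b bs) x + horner a (b ∷ bs) r
    synthetic-division b []       x = solve 4 (λ a r b x → b :+ x :* a := (x :- r) :* a :+ (b :+ r :* a)) a r b x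
    synthetic-division b (c ∷ bs) x = begin
      b + x * horner a (c ∷ bs) x  ≈⟨ +-congˡ (*-congˡ (synthetic-division c bs x)) ⟩
      b + x * ((x - r) * q + v)
        ≈⟨ solve 5 (λ r b x q v → b :+ x :* ((x :- r) :* q :+ v) := (x :- r) :* (v :+ x :* q) :+ (b :+ r :* v)) r b x q v ⟩
      (x - r) * (v + x * q) + (b + r * v)  ∎
      where
      q = horner a (synthetic c bs) x
      v = horner a (c ∷ bs) r

  ∏[_-_] : Carrier → List Carrier → Carrier
  ∏[ x - [] ]     = 1#
  ∏[ x - r ∷ rs ] = (x - r) * ∏[ x - rs ]

  -- The leading coefficient is a parameter with two uses. With 1 the lemma factors the cyclotomic
  -- polynomial; with 0 it says that a polynomial with more distinct roots than its degree vanishes.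
  root-factorisation : ∀ a as rs → length as ≡ length rs → AllPairs (λ r s → ¬ (r ≈ s)) rs →
                       All (λ r → horner a as r ≈ 0#) rs → ∀ x → horner a as x ≈ a * ∏[ x - rs ]
  root-factorisation a []       []       _   _                _            x = sym (*-identityʳ a)
  root-factorisation a (b ∷ bs) (r ∷ rs) len (r≉ ∷ distinct) (r-root ∷ roots) x = begin
    horner a (b ∷ bs) x  ≈⟨ synthetic-division a r b bs x ⟩
    (x - r) * horner a (synthetic a r b bs) x + horner a (b ∷ bs) r  ≈⟨ +-cong (*-congˡ IH) r-root ⟩
    (x - r) * (a * ∏[ x - rs ]) + 0#
      ≈⟨ solve 4 (λ x r a π → (x :- r) :* (a :* π) :+ con 0ℤ := a :* ((x :- r) :* π)) x r a ∏[ x - rs ] ⟩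
    a * ((x - r) * ∏[ x - rs ])  ∎
    where
    root′ : ∀ {s} → ¬ (r ≈ s) → horner a (b ∷ bs) s ≈ 0# → horner a (synthetic a r b bs) s ≈ 0#
    root′ {s} r≉s s-root = noZeroDivisors (λ s-r≈0 → r≉s (sym (x∙y⁻¹≈ε⇒x≈y s r s-r≈0))) (begin
      (s - r) * horner a (synthetic a r b bs) s  ≈⟨ +-identityʳ _ ⟨
      (s - r) * horner a (synthetic a r b bs) s + 0#  ≈⟨ +-congˡ r-root ⟨
      (s - r) * horner a (synthetic a r b bs) s + horner a (b ∷ bs) r  ≈⟨ synthetic-division a r b bs s ⟨
      horner a (b ∷ bs) s  ≈⟨ s-root ⟩
      0#  ∎)
    IH : horner a (synthetic a r b bs) x ≈ a * ∏[ x - rs ]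
    IH = root-factorisation a (synthetic a r b bs) rs (≡.trans (length-synthetic a r b bs) (ℕ.suc-injective len)) distinct
      (All.zipWith (λ (r≉s , e) → root′ r≉s e) (r≉ , roots)) x

  -- Residue rings of subrings of the field

  module SubringRing {x} (G : Pred Carrier x) where
    open FieldDefs L using (resp; 0∈; 1∈; +∈; *∈; -∈)
    private
      𝔹 = subring G
      module 𝔹 = CommutativeRing 𝔹
      module 𝔹^ = Algebra.Properties.CommutativeSemiring.Exp 𝔹.commutativeSemiring
      module 𝔹× = Algebra.Properties.Semiring.Mult 𝔹.semiring
      G-subring = subring-isSubring G

    proj₁-^ : ∀ s n → proj₁ (s 𝔹^.^ n) ≡ proj₁ s ^ n
    proj₁-^ s zero    = ≡.refl
    proj₁-^ s (suc n) = ≡.cong (λ y → proj₁ s * y) (proj₁-^ s n)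

    proj₁-× : ∀ n s → proj₁ (n 𝔹×.× s) ≡ n ×ₙ proj₁ s
    proj₁-× zero    s = ≡.refl
    proj₁-× (suc n) s = ≡.cong (λ y → proj₁ s + y) (proj₁-× n s)

    n×≈ι* : ∀ n y → n ×ₙ y ≈ ι n * y
    n×≈ι* n y = sym (trans (×-assoc-* n 1# y) (×-congʳ n (*-identityˡ y)))
      where open Algebra.Properties.Semiring.Mult semiring using (×-assoc-*; ×-congʳ)

    freshman-subring : ∀ {p} → Prime p → ∀ {x y} → Subring⟨ G ⟩ x → Subring⟨ G ⟩ y →
      ∃ λ t → Subring⟨ G ⟩ t × (x + y) ^ p ≈ x ^ p + y ^ p + ι p * t
    freshman-subring {p} pr {x} {y} x∈ y∈ with Freshman.freshman 𝔹.commutativeSemiring pr (x , x∈) (y , y∈)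
    ... | (t , t∈) , e = t , t∈ , (begin
      (x + y) ^ p  ≡⟨ proj₁-^ ((x , x∈) 𝔹.+ (y , y∈)) p ⟨
      proj₁ (((x , x∈) 𝔹.+ (y , y∈)) 𝔹^.^ p)  ≈⟨ e ⟩
      proj₁ ((x , x∈) 𝔹^.^ p) + proj₁ ((y , y∈) 𝔹^.^ p) + proj₁ (p 𝔹×.× (t , t∈))
        ≈⟨ +-cong (+-cong (reflexive (proj₁-^ _ p)) (reflexive (proj₁-^ _ p))) (trans (reflexive (proj₁-× p _)) (n×≈ι* p t)) ⟩
      x ^ p + y ^ p + ι p * t  ∎)

    module Residue {q} (q-prime : Prime q) where

      q′ : 𝔹.Carrier
      q′ = ι q , ι∈ G-subring q

      open Quotient 𝔹 q′ public

      private module R = CommutativeRing residueRing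

      open Algebra.Properties.CommutativeSemiring.Exp R.commutativeSemiring public using () renaming (_^_ to _^ₘ_)

      module Mult = Algebra.Properties.Semiring.Mult R.semiring

      proj₁-^ₘ : ∀ s n → proj₁ (s ^ₘ n) ≡ proj₁ s ^ n
      proj₁-^ₘ s n = ≡.trans (≡.cong proj₁ (^ₘ≡^ s n)) (proj₁-^ s n)

      char : q Mult.× R.1# R.≈ R.0#
      char = 𝔹.1# , (begin
        proj₁ (q Mult.× R.1#)  ≡⟨ ≡.cong proj₁ (×ₘ≡× q 𝔹.1#) ⟩
        proj₁ (q 𝔹×.× 𝔹.1#)  ≡⟨ proj₁-× q 𝔹.1# ⟩
        ι q  ≈⟨ solve 1 (λ q → q := con 0ℤ :+ q :* con 1ℤ) (ι q) ⟩
        0# + ι q * 1#  ∎)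

      open Frobenius residueRing q-prime char public using (module Fixed; fixed⇒regular)

      module _ (f : 𝔹.Carrier) (k : ℕ) where
        open Fixed f k

        -- Equality only sees the underlying element, so being fixed does not depend on the
        -- derivation that puts it in the subring. The induction may therefore build a derivation of
        -- its own and exchange it for the given one at the end.
        fixed-generators⇒fixed : (∀ {g} (g∈ : G g) → IsFixed (g , gen g∈)) → ∀ s → IsFixed s
        fixed-generators⇒fixed fixed (s , s∈) =
          let (d , e) = subring-least fixed-subring (λ {g} g∈ → gen g∈ , fixed g∈) s∈ in
          fixed-resp {s , d} {s , s∈} (≈⇒≈ₘ {s , d} {s , s∈} refl) e
          where
          fixed-subring : IsSubring (λ x → Σ (Subring⟨ G ⟩ x) λ d → IsFixed (x , d))
          fixed-subring = record
            { resp = λ {x} {y} x≈y (d , e) → resp x≈y d , fixed-resp {x , d} {y , resp x≈y d} (≈⇒≈ₘ {x , d} {y , resp x≈y d} x≈y) e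
            ; 0∈   = 0∈ , fixed-0
            ; 1∈   = 1∈ , fixed-1
            ; +∈   = λ (d , e) (d′ , e′) → +∈ d d′ , fixed-+ e e′
            ; *∈   = λ (d , e) (d′ , e′) → *∈ d d′ , fixed-* e e′
            ; -∈   = λ (d , e) → -∈ d , fixed-neg e
            }

      -- Clearing denominators in an integral equation for `z` makes a power of the numerator `s`
      -- divisible by `q`. Where the residue ring is reduced, `s` is then itself divisible by `q`,
      -- so that `z` lies in the subring.
      numerator-nilpotent : ∀ s {z} → IntegralOver z → ι q * z ≈ proj₁ s → ∃ λ n → s ^ₘ n R.≈ R.0#
      numerator-nilpotent (s , s∈) z-int e
        with Integrality.numerator-power G-subring (ι∈ G-subring q) s∈ e (extendScalars G-subring z-int)
      ... | n , t , t∈ , e′ = n , (t , t∈) , trans (reflexive (proj₁-^ₘ (s , s∈) n)) (trans e′ (sym (+-identityˡ _)))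

      quotient∈ : ∀ s {z} → ι q * z ≈ proj₁ s → s R.≈ R.0# → Subring⟨ G ⟩ z
      quotient∈ s {z} e ((t , t∈) , e′) = resp (sym (*-cancelˡ (ι≉0 q {{prime⇒nonZero q-prime}}) (trans e (trans e′ (+-identityˡ _))))) t∈

  primeSteps : ∀ {d} {D : Pred Carrier d} → (∀ {x y} → x ≈ y → D x → D y) →
    (∀ {q} → Prime q → ∀ {z} → IntegralOver z → D (ι q * z) → D z) →
    ∀ n .{{_ : ℕ.NonZero n}} {z} → IntegralOver z → D (ι n * z) → D z
  primeSteps {D = D} D-resp step n z-int = go factors factorsPrime n isFactorisation z-int
    where
    open PrimeFactorisation (factorise n)
    go : ∀ qs → All Prime qs → ∀ n → n ≡ product qs → ∀ {z} → IntegralOver z → D (ι n * z) → D z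
    go []       []         _ ≡.refl z-int d = D-resp (trans (*-congʳ fromℤ-1) (*-identityˡ _)) d
    go (q ∷ qs) (pr ∷ prs) _ ≡.refl {z} z-int d = go qs prs (product qs) ≡.refl z-int
      (step pr (IsSubring.*∈ integral-subring (int∈′ (product qs)) z-int)
        (D-resp (trans (*-congʳ (ι-* q (product qs))) (*-assoc _ _ _)) d))
      where
      int∈′ : ∀ m → IntegralOver (ι m)
      int∈′ = ι∈ integral-subring

  evalℤ-scale : ∀ i cs x → evalℤ (map (i ℤ.*_) cs) x ≈ fromℤ i * evalℤ cs x
  evalℤ-scale i []       x = sym (zeroʳ _)
  evalℤ-scale i (c ∷ cs) x = trans (+-cong (fromℤ-* i c) (*-congˡ (evalℤ-scale i cs x)))
    (solve 4 (λ i c x e → i :* c :+ x :* (i :* e) := i :* (c :+ x :* e)) (fromℤ i) (fromℤ c) x (evalℤ cs x))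

  evalℤ-minus : ∀ i cs ds x → length cs ≡ length ds → evalℤ (zipWith (λ c d → c ℤ.- i ℤ.* d) cs ds) x ≈ evalℤ cs x - fromℤ i * evalℤ ds x
  evalℤ-minus i []       []       x _ = solve 1 (λ i → con 0ℤ := con 0ℤ :- i :* con 0ℤ) (fromℤ i)
  evalℤ-minus i (c ∷ cs) (d ∷ ds) x l = begin
    fromℤ (c ℤ.- i ℤ.* d) + x * evalℤ (zipWith _ cs ds) x
      ≈⟨ +-cong (trans (fromℤ-+ c (ℤ.- (i ℤ.* d))) (+-congˡ (trans (fromℤ-neg (i ℤ.* d)) (-‿cong (fromℤ-* i d)))))
                (*-congˡ (evalℤ-minus i cs ds x (ℕ.suc-injective l))) ⟩
    fromℤ c - fromℤ i * fromℤ d + x * (evalℤ cs x - fromℤ i * evalℤ ds x)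
      ≈⟨ solve 6 (λ c i d x e f → c :- i :* d :+ x :* (e :- i :* f) := c :+ x :* e :- i :* (d :+ x :* f)) (fromℤ c) (fromℤ i) (fromℤ d) x (evalℤ cs x) (evalℤ ds x) ⟩
    fromℤ c + x * evalℤ cs x - fromℤ i * (fromℤ d + x * evalℤ ds x)  ∎

  -- Coefficients with respect to powers of a uniformiser

  -- Independence of the powers of a uniformiser π of p. For ℤ[ζ] it replaces
  -- the irreducibility of the cyclotomic polynomial.
  module _ {a} {A : Pred Carrier a} (A-subring : IsSubring A) {p : ℕ} (1<p : 1 < p)
    {π : Carrier} (π∈ : A π) (π≉0 : ¬ (π ≈ 0#)) {n : ℕ} {v : Carrier} (v∈ : A v) (p≈πⁿv : ι p ≈ π ^ n * v)
    (fraction : ∀ {z} i → A z → π * z ≈ fromℤ i → p ∣∣ i) where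
    open IsSubring A-subring

    private
      E : List ℤ → Carrier
      E cs = evalℤ cs π

    E∈ : ∀ cs → A (E cs)
    E∈ []       = 0∈
    E∈ (c ∷ cs) = +∈ (fromℤ∈ A-subring c) (*∈ π∈ (E∈ cs))

    Divisible : List ℤ → Set
    Divisible cs = ∃ λ ds → length ds ≡ length cs × cs ≡ map (+ p ℤ.*_) ds

    -- The constant coefficient `c` is π times an element of `A`, so `fraction` makes it a multiple
    -- of `p`, which in turn supplies πᵐ⁺¹. Subtracting `c` and cancelling π leaves the same
    -- situation with one power less. The bound m ≤ n is there because `p` supplies only πⁿ.
    divisible-coefficients : ∀ m → m ≤ n → ∀ cs → length cs ≤ m → ∀ {r} → A r → E cs ≈ π ^ m * r → Divisible cs
    divisible-coefficients m       m≤n []       _  _        _ = [] , ≡.refl , ≡.refl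
    divisible-coefficients (suc m) m<n (c ∷ cs) (s≤s l) {r} r∈ e = step (signed (fraction c (+∈ (*∈ (^∈ m π∈) r∈) (-∈ (E∈ cs))) c-fraction))
      where
      c-fraction : π * (π ^ m * r - E cs) ≈ fromℤ c
      c-fraction = begin
        π * (π ^ m * r - E cs)
          ≈⟨ solve 4 (λ p t r e → p :* (t :* r :- e) := p :* t :* r :- p :* e) π (π ^ m) r (E cs) ⟩
        π * π ^ m * r - π * E cs  ≈⟨ +-congʳ e ⟨
        fromℤ c + π * E cs - π * E cs  ≈⟨ solve 2 (λ c e → c :+ e :- e := c) (fromℤ c) (π * E cs) ⟩
        fromℤ c  ∎

      j : ℕ
      j = n ∸ suc m

      p≈ : ι p ≈ π * (π ^ m * (π ^ j * v))
      p≈ = begin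
        ι p  ≈⟨ p≈πⁿv ⟩
        π ^ n * v  ≡⟨ ≡.cong (λ i → π ^ i * v) (ℕ.m+[n∸m]≡n m<n) ⟨
        π ^ (suc m ℕ.+ j) * v  ≈⟨ *-congʳ (^-homo-* π (suc m) j) ⟩
        π * π ^ m * π ^ j * v  ≈⟨ solve 4 (λ p t s v → p :* t :* s :* v := p :* (t :* (s :* v))) π (π ^ m) (π ^ j) v ⟩
        π * (π ^ m * (π ^ j * v))  ∎

      signed : p ∣∣ c → ∃ λ d → c ≡ + p ℤ.* d
      signed d with ∣ᵤ⇒∣ {+ p} {c} d
      ... | divides q eq = q , ≡.trans eq (ℤ.*-comm q (+ p))

      step : (∃ λ d → c ≡ + p ℤ.* d) → Divisible (c ∷ cs)
      step (d , c≡pd) = prepend (divisible-coefficients m (ℕ.<⇒≤ m<n) cs l (+∈ r∈ (-∈ (*∈ (*∈ (^∈ j π∈) v∈) (fromℤ∈ A-subring d)))) E-cs)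
        where
        E-cs : E cs ≈ π ^ m * (r - π ^ j * v * fromℤ d)
        E-cs = *-cancelˡ π≉0 (begin
          π * E cs  ≈⟨ solve 2 (λ c e → e := c :+ e :- c) (fromℤ c) (π * E cs) ⟩
          fromℤ c + π * E cs - fromℤ c
            ≈⟨ +-cong e (-‿cong (trans (reflexive (≡.cong fromℤ c≡pd)) (trans (fromℤ-* (+ p) d) (*-congʳ p≈)))) ⟩
          π * π ^ m * r - π * (π ^ m * (π ^ j * v)) * fromℤ d
            ≈⟨ solve 5 (λ p t r w d → p :* t :* r :- p :* (t :* w) :* d := p :* (t :* (r :- w :* d))) π (π ^ m) r (π ^ j * v) (fromℤ d) ⟩
          π * (π ^ m * (r - π ^ j * v * fromℤ d))  ∎)

        prepend : Divisible cs → Divisible (c ∷ cs)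
        prepend (ds , l , e) = d ∷ ds , ≡.cong suc l , ≡.cong₂ _∷_ c≡pd e

    -- The value 0 is divisible by πⁿ, so all coefficients are multiples of `p`. Dividing them by
    -- `p` gives another relation of the same length, so they are divisible by every power of `p`.
    powers-independent : ∀ cs → length cs ≤ n → E cs ≈ 0# → All (_≡ 0ℤ) cs
    powers-independent cs l e = All.map (allPowers⇒≡0 p 1<p _) (All.tabulate λ c∈ m → All.lookup (powers m cs l e) c∈)
      where
      powers : ∀ m cs → length cs ≤ n → E cs ≈ 0# → All (p ℕ.^ m ∣∣_) cs
      powers zero    cs l e = All.universal (λ c → ℕ.1∣ _) cs
      powers (suc m) cs l e = go (divisible-coefficients n ℕ.≤-refl cs l 0∈ (trans e (sym (zeroʳ _))))
        where
        instance _ = ℕ.>-nonZero (ℕ.<-trans (s≤s z≤n) 1<p)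
        scale : ∀ {ds} → All (p ℕ.^ m ∣∣_) ds → All (p ℕ.^ suc m ∣∣_) (map (+ p ℤ.*_) ds)
        scale []                   = []
        scale {d ∷ ds} (pᵐ∣d ∷ ds∣) = ≡.subst (p ℕ.^ suc m ℕ.∣_) (≡.sym (ℤ.abs-* (+ p) d)) (ℕ.*-monoʳ-∣ p pᵐ∣d) ∷ scale ds∣

        go : Divisible cs → All (p ℕ.^ suc m ∣∣_) cs
        go (ds , l′ , ≡.refl) = scale (powers m ds (ℕ.≤-trans (ℕ.≤-reflexive l′) l)
          (noZeroDivisors (ι≉0 p) (trans (sym (evalℤ-scale (+ p) ds π)) e)))

    -- Independence applied to the coefficients of cs - q ds. This makes divisibility by `q` a
    -- question about integers.
    divides⇒coefficients : ∀ q cs ds → length cs ≤ n → length cs ≡ length ds → E cs ≈ fromℤ (+ q) * E ds → All (q ∣∣_) cs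
    divides⇒coefficients q cs ds l l′ e = go cs ds l′ (powers-independent (zipWith _ cs ds) (ℕ.≤-trans (zip≤ cs ds) l) (begin
      E (zipWith (λ c d → c ℤ.- + q ℤ.* d) cs ds)  ≈⟨ evalℤ-minus (+ q) cs ds π l′ ⟩
      E cs - fromℤ (+ q) * E ds  ≈⟨ +-congʳ e ⟩
      fromℤ (+ q) * E ds - fromℤ (+ q) * E ds  ≈⟨ -‿inverseʳ _ ⟩
      0#  ∎))
      where
      zip≤ : ∀ {f : ℤ → ℤ → ℤ} cs ds → length (zipWith f cs ds) ≤ length cs
      zip≤ []       ds       = z≤n
      zip≤ (c ∷ cs) []       = z≤n
      zip≤ (c ∷ cs) (d ∷ ds) = s≤s (zip≤ cs ds)

      go : ∀ cs ds → length cs ≡ length ds → All (_≡ 0ℤ) (zipWith (λ c d → c ℤ.- + q ℤ.* d) cs ds) → All (q ∣∣_) cs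
      go []       []       _ _        = []
      go (c ∷ cs) (d ∷ ds) l (z ∷ zs) = ℕ.divides ℤ.∣ d ∣ (≡.trans (≡.cong ℤ.∣_∣ (ℤ.i-j≡0⇒i≡j c _ z)) (≡.trans (ℤ.abs-* (+ q) d) (ℕ.*-comm q _))) ∷ go cs ds (ℕ.suc-injective l) zs

  coefficients⇒divides : ∀ q cs {x} → All (q ∣∣_) cs → ∃ λ ds → evalℤ cs x ≈ fromℤ (+ q) * evalℤ ds x
  coefficients⇒divides q []       []        = [] , sym (zeroʳ _)
  coefficients⇒divides q (c ∷ cs) {x} (d ∷ ds∣) with ∣ᵤ⇒∣ {+ q} {c} d | coefficients⇒divides q cs {x} ds∣
  ... | divides i ≡.refl | ds , e = i ∷ ds , trans (+-cong (fromℤ-* i (+ q)) (*-congˡ e))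
    (solve 4 (λ i q x e → i :* q :+ x :* (q :* e) := q :* (i :+ x :* e)) (fromℤ i) (fromℤ (+ q)) x (evalℤ ds x))

  -- Twisting and pseudo-division of polynomials

  horner-∷ʳ : ∀ bs a x → horner 0# (bs ∷ʳ a) x ≈ horner a bs x
  horner-∷ʳ []       a x = trans (+-congˡ (zeroʳ x)) (+-identityʳ a)
  horner-∷ʳ (b ∷ bs) a x = +-congˡ (*-congˡ (horner-∷ʳ bs a x))

  horner-lead : ∀ bs a x → horner a bs x ≈ horner 0# bs x + a * x ^ length bs
  horner-lead []       a x = trans (sym (*-identityʳ a)) (sym (+-identityˡ _))
  horner-lead (b ∷ bs) a x = trans (+-congˡ (*-congˡ (horner-lead bs a x)))
    (solve 5 (λ b x h a t → b :+ x :* (h :+ a :* t) := b :+ x :* h :+ a :* (x :* t)) b x (horner 0# bs x) a (x ^ length bs))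

  horner-zero : ∀ {bs} → All (_≈ 0#) bs → ∀ x → horner 0# bs x ≈ 0#
  horner-zero []       x = refl
  horner-zero (z ∷ zs) x = trans (+-cong z (trans (*-congˡ (horner-zero zs x)) (zeroʳ x))) (+-identityˡ 0#)

  horner-map : ∀ a bs x → horner 0# (map (a *_) bs) x ≈ a * horner 0# bs x
  horner-map a []       x = sym (zeroʳ a)
  horner-map a (b ∷ bs) x = trans (+-congˡ (*-congˡ (horner-map a bs x)))
    (solve 4 (λ a b x h → a :* b :+ x :* (a :* h) := a :* (b :+ x :* h)) a b x (horner 0# bs x))

  -- The coefficients of w · f(z x) - u · f(x), where f has leading
  -- coefficient a and u = w zⁿ, so that the leading terms cancel.
  twist : Carrier → Carrier → Carrier → List Carrier → List Carrier
  twist z w u []       = []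
  twist z w u (b ∷ bs) = (w - u) * b ∷ twist z (w * z) u bs

  length-twist : ∀ z w u bs → length (twist z w u bs) ≡ length bs
  length-twist z w u []       = ≡.refl
  length-twist z w u (b ∷ bs) = ≡.cong suc (length-twist z (w * z) u bs)

  horner-twist : ∀ a z w u bs x → w * z ^ length bs ≈ u → horner 0# (twist z w u bs) x ≈ w * horner a bs (z * x) - u * horner a bs x
  horner-twist a z w u []       x e = begin
    0#  ≈⟨ -‿inverseʳ _ ⟨
    u * a - u * a  ≈⟨ +-congʳ (*-congʳ (trans (sym e) (*-identityʳ w))) ⟩
    w * a - u * a  ∎
  horner-twist a z w u (b ∷ bs) x e = begin
    (w - u) * b + x * horner 0# (twist z (w * z) u bs) x
      ≈⟨ +-congˡ (*-congˡ (horner-twist a z (w * z) u bs x (trans (*-assoc w z _) e))) ⟩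
    (w - u) * b + x * (w * z * g - u * h)
      ≈⟨ solve 7 (λ w u b x z g h → (w :- u) :* b :+ x :* (w :* z :* g :- u :* h) := w :* (b :+ z :* x :* g) :- u :* (b :+ x :* h)) w u b x z g h ⟩
    w * (b + z * x * g) - u * (b + x * h)  ∎
    where
    g = horner a bs (z * x)
    h = horner a bs x

  module _ {ℓ} {A : Pred Carrier ℓ} (A-subring : IsSubring A) where
    open IsSubring A-subring

    twist∈ : ∀ {z w u bs} → A z → A w → A u → All A bs → All A (twist z w u bs)
    twist∈ z∈ w∈ u∈ []         = []
    twist∈ z∈ w∈ u∈ (b∈ ∷ bs∈) = *∈ (+∈ w∈ (-∈ u∈)) b∈ ∷ twist∈ z∈ (*∈ w∈ z∈) u∈ bs∈

    deg⇒horner : ∀ {x n y} → Degree.Deg A-subring x n y → ∃ λ bs → length bs ≡ n × All A bs × y ≈ horner 0# bs x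
    deg⇒horner (Degree.nil e) = [] , ≡.refl , [] , e
    deg⇒horner (Degree.cons {a = a} a∈ z∈ e) with deg⇒horner z∈
    ... | bs , l , bs∈ , e′ = a ∷ bs , ≡.cong suc l , a∈ ∷ bs∈ , trans e (+-congˡ (*-congˡ e′))

    cancelLead : Carrier → Carrier → List Carrier → List Carrier → List Carrier
    cancelLead a t = zipWith (λ c b → a * c - t * b)

    horner-cancelLead : ∀ a t cs bs x → length cs ≡ length bs → horner 0# (cancelLead a t cs bs) x ≈ a * horner t cs x - t * horner a bs x
    horner-cancelLead a t []       []       x _ = solve 2 (λ a t → con 0ℤ := a :* t :- t :* a) a t
    horner-cancelLead a t (c ∷ cs) (b ∷ bs) x l = trans (+-congˡ (*-congˡ (horner-cancelLead a t cs bs x (ℕ.suc-injective l))))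
      (solve 7 (λ a t c b x g h → a :* c :- t :* b :+ x :* (a :* g :- t :* h) := a :* (c :+ x :* g) :- t :* (b :+ x :* h)) a t c b x (horner t cs x) (horner a bs x))

    length-cancelLead : ∀ a t cs bs → length cs ≡ length bs → length (cancelLead a t cs bs) ≡ length bs
    length-cancelLead a t []       []       _ = ≡.refl
    length-cancelLead a t (c ∷ cs) (b ∷ bs) l = ≡.cong suc (length-cancelLead a t cs bs (ℕ.suc-injective l))

    cancelLead∈ : ∀ {a t cs bs} → A a → A t → All A cs → All A bs → All A (cancelLead a t cs bs)
    cancelLead∈ a∈ t∈ []         _          = []
    cancelLead∈ a∈ t∈ (_ ∷ _)    []         = []
    cancelLead∈ a∈ t∈ (c∈ ∷ cs∈) (b∈ ∷ bs∈) = +∈ (*∈ a∈ c∈) (-∈ (*∈ t∈ b∈)) ∷ cancelLead∈ a∈ t∈ cs∈ bs∈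

    module PseudoDivision {a b bs} (a∈ : A a) (b∈ : A b) (bs∈ : All A bs) where
      private
        n = length bs
        G = horner a (b ∷ bs)

      -- The monomial xⁿ⁺ʲ is divided by `G`, of degree n + 1. Each step multiplies by the leading
      -- coefficient `a` instead of dividing by it, since `a` need not be a unit of `A`; this
      -- produces the factor aʲ.
      record Division (j : ℕ) : Set (c ⊔ ℓ₁ ⊔ ℓ) where
        field
          quotient  : List Carrier
          remainder : List Carrier
          quotient-length  : length quotient ≡ j
          remainder-length : length remainder ≡ suc n
          remainder∈       : All A remainder
          identity  : ∀ x → a ^ j * x ^ (n ℕ.+ j) ≈ G x * horner 0# quotient x + horner 0# remainder x

      pseudoDivision : ∀ j → Division j
      pseudoDivision zero = record
        { quotient = [] ; remainder = replicate n 0# ∷ʳ 1#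
        ; quotient-length = ≡.refl
        ; remainder-length = ≡.trans (length-++ (replicate n 0#)) (≡.trans (ℕ.+-comm _ 1) (≡.cong suc (length-replicate n)))
        ; remainder∈ = All.++⁺ (All.replicate⁺ n 0∈) (1∈ ∷ [])
        ; identity = λ x → begin
            1# * x ^ (n ℕ.+ 0)  ≡⟨ ≡.cong (λ i → 1# * x ^ i) (ℕ.+-identityʳ n) ⟩
            1# * x ^ n  ≈⟨ solve 2 (λ t g → con 1ℤ :* t := g :* con 0ℤ :+ t) (x ^ n) (G x) ⟩
            G x * 0# + x ^ n  ≈⟨ +-congˡ (trans (horner-∷ʳ (replicate n 0#) 1# x) (monomial n x)) ⟨
            G x * 0# + horner 0# (replicate n 0# ∷ʳ 1#) x  ∎
        }
        where
        monomial : ∀ n x → horner 1# (replicate n 0#) x ≈ x ^ n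
        monomial zero    x = refl
        monomial (suc n) x = trans (+-identityˡ _) (*-congˡ (monomial n x))
      pseudoDivision (suc j) = step (pseudoDivision j)
        where
        step : Division j → Division (suc j)
        step d = go (initLast remainder) remainder-length remainder∈ identity
          where
          open Division d
          go : ∀ {rs} → Data.List.Base.InitLast rs → length rs ≡ suc n → All A rs →
               (∀ x → a ^ j * x ^ (n ℕ.+ j) ≈ G x * horner 0# quotient x + horner 0# rs x) → Division (suc j)
          -- After multiplication of the identity by `a * x`, the remainder has leading coefficient
          -- `a * t` in the degree of `G`; subtracting `t` times `G` removes it.
          go (rs ∷ʳ′ t) l rs∈ identity = record
            { quotient = t ∷ map (a *_) quotient
            ; remainder = cancelLead a t (0# ∷ rs) (b ∷ bs)
            ; quotient-length = ≡.cong suc (≡.trans (length-map _ quotient) quotient-length)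
            ; remainder-length = length-cancelLead a t (0# ∷ rs) (b ∷ bs) l′
            ; remainder∈ = cancelLead∈ a∈ (All.head (All.++⁻ʳ rs rs∈)) (0∈ ∷ All.++⁻ˡ rs rs∈) (b∈ ∷ bs∈)
            ; identity = λ x → let K = horner 0# quotient x in begin
                a * a ^ j * x ^ (n ℕ.+ suc j)  ≡⟨ ≡.cong (λ i → a * a ^ j * x ^ i) (ℕ.+-suc n j) ⟩
                a * a ^ j * (x * x ^ (n ℕ.+ j))
                  ≈⟨ solve 4 (λ a s x t → a :* s :* (x :* t) := a :* x :* (s :* t)) a (a ^ j) x (x ^ (n ℕ.+ j)) ⟩
                a * x * (a ^ j * x ^ (n ℕ.+ j))  ≈⟨ *-congˡ (trans (identity x) (+-congˡ (horner-∷ʳ rs t x))) ⟩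
                a * x * (G x * K + horner t rs x)
                  ≈⟨ solve 6 (λ a x g k h t → a :* x :* (g :* k :+ h) := g :* (t :+ x :* (a :* k)) :+ (a :* (con 0ℤ :+ x :* h) :- t :* g)) a x (G x) K (horner t rs x) t ⟩
                G x * (t + x * (a * K)) + (a * horner t (0# ∷ rs) x - t * G x)
                  ≈⟨ +-cong (*-congˡ (+-congˡ (*-congˡ (horner-map a quotient x)))) (horner-cancelLead a t (0# ∷ rs) (b ∷ bs) x l′) ⟨
                G x * (t + x * horner 0# (map (a *_) quotient) x) + horner 0# (cancelLead a t (0# ∷ rs) (b ∷ bs)) x  ∎
            }
            where
            l′ : suc (length rs) ≡ suc n
            l′ = ≡.trans (≡.trans (ℕ.+-comm 1 (length rs)) (≡.sym (length-++ rs))) l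

  -- The cyclotomic ring at the prime λ

  module Cyclotomic {k : ℕ} (p-prime : Prime (3 ℕ.+ k)) (p-odd : ¬ (2 ℕ.∣ 3 ℕ.+ k))
    {ζ : Carrier} (ζ-primitive : IsPrimitiveRoot ζ (3 ℕ.+ k)) where

    private
      module 𝔹 = CommutativeRing ℤ[ ζ ]
      module 𝔹^ = Algebra.Properties.CommutativeSemiring.Exp 𝔹.commutativeSemiring

    -- With p = 3 + k, the power λᵖ⁻¹ unfolds to λ · (λ · λᵏ), which displays the factor λ² of `p`.
    p p-1 : ℕ
    p   = 3 ℕ.+ k
    p-1 = 2 ℕ.+ k

    λ₀ : Carrier
    λ₀ = 1# - ζ

    ζ^p≈1 : ζ ^ p ≈ 1#
    ζ^p≈1 = proj₁ ζ-primitive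

    ζ≉0 : ¬ (ζ ≈ 0#)
    ζ≉0 ζ≈0 = 1≉0 (trans (sym ζ^p≈1) (trans (*-congʳ ζ≈0) (zeroˡ _)))

    1^ : ∀ n → 1# ^ n ≈ 1#
    1^ zero    = refl
    1^ (suc n) = trans (*-identityˡ _) (1^ n)

    ζ^-distinct : ∀ {i j} → i < j → j < p → ¬ (ζ ^ j ≈ ζ ^ i)
    ζ^-distinct {i} {j} i<j j<p e = proj₂ ζ-primitive (j ∸ i) (ℕ.m<n⇒0<n∸m i<j) (ℕ.≤-<-trans (ℕ.m∸n≤m j i) j<p)
      (*-cancelˡ (^-≉0 i ζ≉0) (begin
        ζ ^ i * ζ ^ (j ∸ i)  ≈⟨ ^-homo-* ζ i (j ∸ i) ⟨
        ζ ^ (i ℕ.+ (j ∸ i))  ≡⟨ ≡.cong (ζ ^_) (ℕ.m+[n∸m]≡n (ℕ.<⇒≤ i<j)) ⟩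
        ζ ^ j  ≈⟨ e ⟩
        ζ ^ i  ≈⟨ *-identityʳ _ ⟨
        ζ ^ i * 1#  ∎))

    rotations : Carrier → ℕ → List Carrier
    rotations t zero    = []
    rotations t (suc n) = ζ ^ suc n * t ∷ rotations t n

    length-rotations : ∀ t n → length (rotations t n) ≡ n
    length-rotations t zero    = ≡.refl
    length-rotations t (suc n) = ≡.cong suc (length-rotations t n)

    all-rotations : ∀ {a} {A : Pred Carrier a} t n → (∀ i → 0 < i → i ≤ n → A (ζ ^ i * t)) → All A (rotations t n)
    all-rotations t zero    f = []
    all-rotations t (suc n) f = f (suc n) (s≤s z≤n) ℕ.≤-refl ∷ all-rotations t n λ i 0<i i≤n → f i 0<i (ℕ.m≤n⇒m≤1+n i≤n)

    rotations-distinct : ∀ {t} → ¬ (t ≈ 0#) → ∀ n → n < p → AllPairs (λ r s → ¬ (r ≈ s)) (rotations t n)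
    rotations-distinct t≉0 zero    _   = []
    rotations-distinct {t} t≉0 (suc n) n<p =
      all-rotations t n (λ i _ i≤n e → ζ^-distinct (s≤s i≤n) n<p (*-cancelˡ t≉0 (trans (*-comm _ _) (trans e (*-comm _ _)))))
      ∷ rotations-distinct t≉0 n (ℕ.<-trans (ℕ.n<1+n n) n<p)

    geometric : ∀ n x → (x - 1#) * horner 1# (replicate n 1#) x ≈ x ^ suc n - 1#
    geometric zero    x = solve 1 (λ x → (x :- con 1ℤ) :* con 1ℤ := x :* con 1ℤ :- con 1ℤ) x
    geometric (suc n) x = begin
      (x - 1#) * (1# + x * h)
        ≈⟨ solve 2 (λ x h → (x :- con 1ℤ) :* (con 1ℤ :+ x :* h) := x :- con 1ℤ :+ x :* ((x :- con 1ℤ) :* h)) x h ⟩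
      x - 1# + x * ((x - 1#) * h)  ≈⟨ +-congˡ (*-congˡ (geometric n x)) ⟩
      x - 1# + x * (x ^ suc n - 1#)
        ≈⟨ solve 2 (λ x t → x :- con 1ℤ :+ x :* (t :- con 1ℤ) := x :* t :- con 1ℤ) x (x ^ suc n) ⟩
      x * x ^ suc n - 1#  ∎
      where h = horner 1# (replicate n 1#) x

    R : Pred Carrier (c ⊔ ℓ₁)
    R = Subring⟨ ｛ ζ ｝ ⟩

    R-subring : IsSubring R
    R-subring = subring-isSubring ｛ ζ ｝
    module R∈ = IsSubring R-subring

    ζ∈R : R ζ
    ζ∈R = gen ≡.refl

    λ∈R : R λ₀
    λ∈R = R∈.+∈ R∈.1∈ (R∈.-∈ ζ∈R)

    R⊆integral : R ⊆ IntegralOver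
    R⊆integral = subring-least integral-subring λ { ≡.refl → integral-root p-1 (integral-resp (sym ζ^p≈1) (IsSubring.1∈ integral-subring)) }

    -- The cyclotomic polynomial 1 + x + ... + xᵖ⁻¹, factored over its roots ζⁱ and evaluated at 1.
    p≈∏ : ι p ≈ ∏[ 1# - rotations 1# p-1 ]
    p≈∏ = begin
      ι p  ≈⟨ at-1 p-1 ⟨
      horner 1# (replicate p-1 1#) 1#  ≈⟨ root-factorisation 1# (replicate p-1 1#) (rotations 1# p-1)
                                                      (≡.trans (length-replicate p-1) (≡.sym (length-rotations 1# p-1)))
                                                      (rotations-distinct 1≉0 p-1 ℕ.≤-refl)
                                                      (all-rotations 1# p-1 λ i 0<i i≤p-1 → root i 0<i (s≤s i≤p-1)) 1# ⟩
      1# * ∏[ 1# - rotations 1# p-1 ]  ≈⟨ *-identityˡ _ ⟩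
      ∏[ 1# - rotations 1# p-1 ]  ∎
      where
      at-1 : ∀ n → horner 1# (replicate n 1#) 1# ≈ ι (suc n)
      at-1 zero    = sym (+-identityʳ 1#)
      at-1 (suc n) = +-congˡ (trans (*-identityˡ _) (at-1 n))

      root : ∀ i → 0 < i → i < p → horner 1# (replicate p-1 1#) (ζ ^ i * 1#) ≈ 0#
      root i 0<i i<p = noZeroDivisors (λ e → ζ^-distinct 0<i i<p (x∙y⁻¹≈ε⇒x≈y (ζ ^ i) 1# (trans (+-congʳ (sym (*-identityʳ _))) e))) (begin
        (ζ ^ i * 1# - 1#) * horner 1# (replicate p-1 1#) (ζ ^ i * 1#)  ≈⟨ geometric p-1 _ ⟩
        (ζ ^ i * 1#) ^ p - 1#  ≈⟨ +-congʳ (^-congˡ p (*-identityʳ _)) ⟩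
        (ζ ^ i) ^ p - 1#  ≈⟨ +-congʳ (^-comm ζ i p) ⟩
        (ζ ^ p) ^ i - 1#  ≈⟨ +-congʳ (trans (^-congˡ i ζ^p≈1) (1^ i)) ⟩
        1# - 1#  ≈⟨ -‿inverseʳ 1# ⟩
        0#  ∎)

    λ∣1-ζ^ : ∀ i → ∃ λ r → R r × 1# - ζ ^ i * 1# ≈ λ₀ * r
    λ∣1-ζ^ zero    = 0# , R∈.0∈ , solve 1 (λ z → con 1ℤ :- con 1ℤ :* con 1ℤ := (con 1ℤ :- z) :* con 0ℤ) ζ
    λ∣1-ζ^ (suc i) = let (r , r∈ , e) = λ∣1-ζ^ i in 1# + ζ * r , R∈.+∈ R∈.1∈ (R∈.*∈ ζ∈R r∈) , (begin
      1# - ζ * ζ ^ i * 1#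
        ≈⟨ solve 2 (λ z t → con 1ℤ :- z :* t :* con 1ℤ := con 1ℤ :- z :+ z :* (con 1ℤ :- t :* con 1ℤ)) ζ (ζ ^ i) ⟩
      λ₀ + ζ * (1# - ζ ^ i * 1#)  ≈⟨ +-congˡ (*-congˡ e) ⟩
      λ₀ + ζ * (λ₀ * r)  ≈⟨ solve 3 (λ l z r → l :+ z :* (l :* r) := l :* (con 1ℤ :+ z :* r)) λ₀ ζ r ⟩
      λ₀ * (1# + ζ * r)  ∎)

    λ^∣∏ : ∀ n → ∃ λ v → R v × ∏[ 1# - rotations 1# n ] ≈ λ₀ ^ n * v
    λ^∣∏ zero    = 1# , R∈.1∈ , sym (*-identityʳ 1#)
    λ^∣∏ (suc n) = let (r , r∈ , e) = λ∣1-ζ^ (suc n); (v , v∈ , e′) = λ^∣∏ n in r * v , R∈.*∈ r∈ v∈ , trans (*-cong e e′)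
      (solve 4 (λ l r t v → l :* r :* (t :* v) := l :* t :* (r :* v)) λ₀ r (λ₀ ^ n) v)

    λ^p-1∣p : ∃ λ v → R v × ι p ≈ λ₀ ^ p-1 * v
    λ^p-1∣p = let (v , v∈ , e) = λ^∣∏ p-1 in v , v∈ , trans p≈∏ e

    neg-odd-power : ∀ j x → (- x) ^ suc (j ℕ.+ j) ≈ - (x ^ suc (j ℕ.+ j))
    neg-odd-power j x = trans (*-congˡ (even j)) (solve 2 (λ x t → (:- x) :* t := :- (x :* t)) x _)
      where
      even : ∀ j → (- x) ^ (j ℕ.+ j) ≈ x ^ (j ℕ.+ j)
      even j = begin
        (- x) ^ (j ℕ.+ j)  ≈⟨ ^-homo-* (- x) j j ⟩
        (- x) ^ j * (- x) ^ j  ≈⟨ ^-distrib-* (- x) (- x) j ⟨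
        ((- x) * (- x)) ^ j  ≈⟨ ^-congˡ j (solve 1 (λ x → (:- x) :* (:- x) := x :* x) x) ⟩
        (x * x) ^ j  ≈⟨ ^-distrib-* x x j ⟩
        x ^ j * x ^ j  ≈⟨ ^-homo-* x j j ⟨
        x ^ (j ℕ.+ j)  ∎

    neg-^p : ∀ x → (- x) ^ p ≈ - (x ^ p)
    neg-^p x with parity p
    ... | inj₁ 2∣p     = contradiction 2∣p p-odd
    ... | inj₂ (j , e) = ≡.subst (λ n → (- x) ^ n ≈ - (x ^ n)) (≡.sym e) (neg-odd-power j x)

    -- In (1 + (- ζ))ᵖ the two p-th powers cancel because p is odd, and only the multiple of p
    -- remains. Together with `λ^p-1∣p` this stands in for an explicit unit relating p to λᵖ⁻¹.
    p∣λ^p : ∃ λ v → R v × λ₀ ^ p ≈ ι p * v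
    p∣λ^p = let (t , t∈ , e) = SubringRing.freshman-subring ｛ ζ ｝ p-prime R∈.1∈ (R∈.-∈ ζ∈R) in t , t∈ , (begin
      λ₀ ^ p  ≈⟨ e ⟩
      1# ^ p + (- ζ) ^ p + ι p * t  ≈⟨ +-congʳ (+-cong (1^ p) (trans (neg-^p ζ) (-‿cong ζ^p≈1))) ⟩
      1# - 1# + ι p * t  ≈⟨ +-congʳ (-‿inverseʳ 1#) ⟩
      0# + ι p * t  ≈⟨ +-identityˡ _ ⟩
      ι p * t  ∎)

    λ≉0 : ¬ (λ₀ ≈ 0#)
    λ≉0 e = ζ^-distinct {0} {1} (s≤s z≤n) (s≤s (s≤s z≤n)) (trans (*-identityʳ ζ) (sym (x∙y⁻¹≈ε⇒x≈y 1# ζ e)))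

    -- The generator ζ is congruent to 1 modulo λ, so the residues modulo λ are those of integers.
    R-residue : ∀ {r} → R r → ∃ λ i → ∃ λ s → R s × r ≈ fromℤ i + λ₀ * s
    R-residue = subring-least residues λ { ≡.refl → 1ℤ , - 1# , R∈.-∈ R∈.1∈ ,
        trans (solve 1 (λ z → z := con 1ℤ :+ (con 1ℤ :- z) :* (:- con 1ℤ)) ζ) (+-congʳ (sym fromℤ-1)) }
      where
      residues : IsSubring (λ r → ∃ λ i → ∃ λ s → R s × r ≈ fromℤ i + λ₀ * s)
      residues = record
        { resp = λ r≈r′ (i , s , s∈ , e) → i , s , s∈ , trans (sym r≈r′) e
        ; 0∈   = 0ℤ , 0# , R∈.0∈ , solve 1 (λ l → con 0ℤ := con 0ℤ :+ l :* con 0ℤ) λ₀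
        ; 1∈   = 1ℤ , 0# , R∈.0∈ , trans (solve 1 (λ l → con 1ℤ := con 1ℤ :+ l :* con 0ℤ) λ₀) (+-congʳ (sym fromℤ-1))
        ; +∈   = λ (i , s , s∈ , e) (j , t , t∈ , e′) → i ℤ.+ j , s + t , R∈.+∈ s∈ t∈ ,
            trans (+-cong e e′) (trans (solve 5 (λ i s j t l → i :+ l :* s :+ (j :+ l :* t) := i :+ j :+ l :* (s :+ t)) (fromℤ i) s (fromℤ j) t λ₀)
              (+-congʳ (sym (fromℤ-+ i j))))
        ; *∈   = λ (i , s , s∈ , e) (j , t , t∈ , e′) → i ℤ.* j , fromℤ i * t + s * (fromℤ j + λ₀ * t) ,
            R∈.+∈ (R∈.*∈ (fromℤ∈ R-subring i) t∈) (R∈.*∈ s∈ (R∈.+∈ (fromℤ∈ R-subring j) (R∈.*∈ λ∈R t∈))) ,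
            trans (*-cong e e′) (trans (solve 5 (λ i s j t l → (i :+ l :* s) :* (j :+ l :* t) := i :* j :+ l :* (i :* t :+ s :* (j :+ l :* t))) (fromℤ i) s (fromℤ j) t λ₀)
              (+-congʳ (sym (fromℤ-* i j))))
        ; -∈   = λ (i , s , s∈ , e) → ℤ.- i , - s , R∈.-∈ s∈ ,
            trans (-‿cong e) (trans (solve 3 (λ i s l → :- (i :+ l :* s) := :- i :+ l :* (:- s)) (fromℤ i) s λ₀) (+-congʳ (sym (fromℤ-neg i))))
        }

    -- The p-th power of the equation replaces λ by a multiple of p, so iᵖ is p times an integral
    -- element. This serves where a norm or a valuation at λ would otherwise be used.
    λ-fraction : ∀ {z} i → IntegralOver z → λ₀ * z ≈ fromℤ i → p ℕ.∣ ℤ.∣ i ∣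
    λ-fraction {z} i z-int e = let (v , v∈ , e′) = p∣λ^p in
      integral-fraction-^ p-prime i p (begin
        ι p * (v * z ^ p)  ≈⟨ *-assoc _ _ _ ⟨
        ι p * v * z ^ p  ≈⟨ *-congʳ e′ ⟨
        λ₀ ^ p * z ^ p  ≈⟨ ^-distrib-* λ₀ z p ⟨
        (λ₀ * z) ^ p  ≈⟨ ^-congˡ p e ⟩
        fromℤ i ^ p  ∎) (I.*∈ (R⊆integral v∈) (I.^∈ p z-int))
      where module I = IsSubring integral-subring

    λ∣p : ∃ λ v → R v × ι p ≈ λ₀ * v
    λ∣p = let (v , v∈ , e) = λ^p-1∣p in λ₀ ^ suc k * v , R∈.*∈ (R∈.^∈ (suc k) λ∈R) v∈ , trans e (*-assoc _ _ _)

    λ∣fromℤ : ∀ i → p ℕ.∣ ℤ.∣ i ∣ → ∃ λ r → R r × fromℤ i ≈ λ₀ * r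
    λ∣fromℤ (+ n) (ℕ.divides j ≡.refl) = let (v , v∈ , e) = λ∣p in
      ι j * v , R∈.*∈ (ι∈ R-subring j) v∈ ,
      trans (ι-* j p) (trans (*-congˡ e) (solve 3 (λ j l v → j :* (l :* v) := l :* (j :* v)) (ι j) λ₀ v))
    λ∣fromℤ -[1+ n ] (ℕ.divides j eq) = let (v , v∈ , e) = λ∣p in
      - (ι j * v) , R∈.-∈ (R∈.*∈ (ι∈ R-subring j) v∈) ,
      trans (-‿cong (trans (reflexive (≡.cong ι eq)) (trans (ι-* j p) (*-congˡ e)))) (solve 3 (λ j l v → :- (j :* (l :* v)) := l :* (:- (j :* v))) (ι j) λ₀ v)

    λ-nonunit : ∀ {r} → R r → ¬ (λ₀ * r ≈ 1#)
    λ-nonunit r∈ e = ℕ.>⇒∤ (s≤s (s≤s z≤n)) (λ-fraction 1ℤ (R⊆integral r∈) (trans e (sym fromℤ-1)))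

    λ-step : ∀ {d} {D : Pred Carrier d} → IsSubring D → R ⊆ D →
             (∀ {z} → IntegralOver z → D (λ₀ * z) → D z) → ∀ {z} → IntegralOver z → D (ι p * z) → D z
    λ-step {D = D} D-subring R⊆D step {z} z-int d = let (v , v∈ , e) = p∣λ^p in
      go p z-int (DS.resp (begin
        v * (ι p * z)  ≈⟨ solve 3 (λ v p z → v :* (p :* z) := p :* v :* z) v (ι p) z ⟩
        ι p * v * z  ≈⟨ *-congʳ e ⟨
        λ₀ ^ p * z  ∎) (DS.*∈ (R⊆D v∈) d))
      where
      module DS = IsSubring D-subring
      module I = IsSubring integral-subring
      go : ∀ n {z} → IntegralOver z → D (λ₀ ^ n * z) → D z
      go zero    z-int d = DS.resp (*-identityˡ _) d
      go (suc n) {z} z-int d = step z-int (go n (I.*∈ (R⊆integral λ∈R) z-int)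
        (DS.resp (solve 3 (λ l t z → l :* t :* z := t :* (l :* z)) λ₀ (λ₀ ^ n) z) d))

    -- Up to a multiple of λ in R, the numerator λz is an integer. By `λ-fraction` this integer is
    -- divisible by p, hence by λ in R.
    R-λ-closed : ∀ {z} → IntegralOver z → R (λ₀ * z) → R z
    R-λ-closed {z} z-int r∈ = lift (R-residue r∈)
      where
      module I = IsSubring integral-subring
      numerator : ∀ i s → λ₀ * z ≈ fromℤ i + λ₀ * s → λ₀ * (z - s) ≈ fromℤ i
      numerator i s e = begin
        λ₀ * (z - s)  ≈⟨ solve 3 (λ l z s → l :* (z :- s) := l :* z :- l :* s) λ₀ z s ⟩
        λ₀ * z - λ₀ * s  ≈⟨ +-congʳ e ⟩
        fromℤ i + λ₀ * s - λ₀ * s  ≈⟨ solve 2 (λ i t → i :+ t :- t := i) (fromℤ i) (λ₀ * s) ⟩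
        fromℤ i  ∎

      lift : (∃ λ i → ∃ λ s → R s × λ₀ * z ≈ fromℤ i + λ₀ * s) → R z
      lift (i , s , s∈ , e) = divide (λ∣fromℤ i (λ-fraction i (I.+∈ z-int (I.-∈ (R⊆integral s∈))) (numerator i s e)))
        where
        divide : (∃ λ t → R t × fromℤ i ≈ λ₀ * t) → R z
        divide (t , t∈ , e′) = R∈.resp (*-cancelˡ λ≉0 (begin
          λ₀ * (t + s)  ≈⟨ distribˡ λ₀ t s ⟩
          λ₀ * t + λ₀ * s  ≈⟨ +-congʳ e′ ⟨
          fromℤ i + λ₀ * s  ≈⟨ e ⟨
          λ₀ * z  ∎)) (R∈.+∈ t∈ s∈)

    -- The cyclotomic ring at primes q other than p

    module PrimeNotP {q} (q-prime : Prime q) (q≢p : ¬ (q ≡ p)) where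
      p∤q : ¬ (p ℕ.∣ q)
      p∤q d with prime⇒irreducible q-prime d
      ... | inj₂ p≡q = q≢p (≡.sym p≡q)

      -- By Fermat the exponent p - 1 makes `Q` congruent to 1 modulo p, so the `Q`-th power fixes ζ
      -- and, being additive modulo q, all residues of R.
      Q : ℕ
      Q = q ℕ.^ p-1

      private
        instance _ = prime⇒nonZero q-prime
        fermat-q = fermat-unit p-prime q p∤q

      j : ℕ
      j = proj₁ fermat-q

      Q≡1+pj : Q ≡ 1 ℕ.+ p ℕ.* j
      Q≡1+pj = proj₂ fermat-q

      N : ℕ
      N = Q ∸ 2

      Q≡2+N : Q ≡ 2 ℕ.+ N
      Q≡2+N = ≡.sym (ℕ.m+[n∸m]≡n (ℕ.≤-trans (ℕ.nonTrivial⇒n>1 q {{prime⇒nonTrivial q-prime}})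
        (ℕ.≤-trans (ℕ.≤-reflexive (≡.sym (ℕ.*-identityʳ q))) (ℕ.^-monoʳ-≤ q {1} {p-1} (s≤s z≤n)))))

      ζ^Q≈ζ : ζ ^ Q ≈ ζ
      ζ^Q≈ζ = begin
        ζ ^ Q  ≡⟨ ≡.cong (ζ ^_) Q≡1+pj ⟩
        ζ * ζ ^ (p ℕ.* j)  ≈⟨ *-congˡ (^-assocʳ ζ p j) ⟨
        ζ * (ζ ^ p) ^ j  ≈⟨ *-congˡ (trans (^-congˡ j ζ^p≈1) (1^ j)) ⟩
        ζ * 1#  ≈⟨ *-identityʳ ζ ⟩
        ζ  ∎

      open SubringRing ｛ ζ ｝ public
      module Mod = Residue q-prime
      private
        module 𝕄 = CommutativeRing Mod.residueRing

      fixed : ∀ s → Mod.Fixed.IsFixed 𝔹.1# p-1 s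
      fixed = Mod.fixed-generators⇒fixed 𝔹.1# p-1 λ { {g} g∈@≡.refl → 𝕄.*-congˡ {𝔹.1#} {(g , gen g∈) Mod.^ₘ Q} {g , gen g∈}
        (Mod.≈⇒≈ₘ {(g , gen g∈) Mod.^ₘ Q} {g , gen g∈} (trans (reflexive (Mod.proj₁-^ₘ (g , gen g∈) Q)) ζ^Q≈ζ)) }

      regular : ∀ s → s 𝔹.* s Mod.^ₘ suc N 𝕄.≈ s
      regular s = Mod.fixed⇒regular p-1 N s Q≡2+N (fixed s)

      R-frobenius : ∀ {r} → R r → ∃ λ t → R t × r ^ Q ≈ r + ι q * t
      R-frobenius {r} r∈ = go (regular (r , r∈))
        where
        go : (r , r∈) 𝔹.* (r , r∈) Mod.^ₘ suc N 𝕄.≈ (r , r∈) → ∃ λ t → R t × r ^ Q ≈ r + ι q * t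
        go ((t , t∈) , e) = t , t∈ , (begin
          r ^ Q  ≡⟨ ≡.cong (r ^_) Q≡2+N ⟩
          r * r ^ suc N  ≡⟨ ≡.cong (λ y → r * y) (Mod.proj₁-^ₘ (r , r∈) (suc N)) ⟨
          r * proj₁ ((r , r∈) Mod.^ₘ suc N)  ≈⟨ e ⟩
          r + ι q * t  ∎)

      R-q-closed : ∀ {z} → IntegralOver z → R (ι q * z) → R z
      R-q-closed {z} z-int r∈ = divide (Mod.numerator-nilpotent s z-int refl)
        where
        s = ι q * z , r∈
        divide : (∃ λ n → s Mod.^ₘ n 𝕄.≈ 𝕄.0#) → R z
        divide (n , nilp) = Mod.quotient∈ s refl (Adjunction.regular-nilpotent Mod.residueRing s N n (regular s) nilp)

    R-closed : ∀ n .{{_ : ℕ.NonZero n}} {z} → IntegralOver z → R (ι n * z) → R z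
    R-closed = primeSteps R∈.resp step
      where
      step : ∀ {q} → Prime q → ∀ {z} → IntegralOver z → R (ι q * z) → R z
      step {q} q-prime with q ℕ.≟ p
      ... | yes ≡.refl = λ z-int → λ-step R-subring (λ r∈ → r∈) R-λ-closed z-int
      ... | no  q≢p    = λ z-int → PrimeNotP.R-q-closed q-prime q≢p z-int

    -- Integer coefficients in R and finiteness of its residue rings

    private
      module Dζ = Degree int-subring ζ
      module Dλ = Degree int-subring λ₀

    geometric-monic : ∀ n x → Degree.Monic int-subring x n (horner 1# (replicate n 1#) x)
    geometric-monic zero    x = 0# , Degree.nil refl , sym (+-identityˡ 1#)
    geometric-monic (suc n) x = step (geometric-monic n x)
      where
      step : Degree.Monic int-subring x n (horner 1# (replicate n 1#) x) → Degree.Monic int-subring x (suc n) (horner 1# (replicate (suc n) 1#) x)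
      step (z , z∈ , e) = 1# + x * z , Degree.cons (1ℤ , sym fromℤ-1) z∈ refl ,
        trans (+-congˡ (*-congˡ e)) (solve 3 (λ x z t → con 1ℤ :+ x :* (z :+ t) := con 1ℤ :+ x :* z :+ x :* t) x z (x ^ n))

    ζ-relation : Dζ.Deg p-1 (ζ ^ p-1)
    ζ-relation = relation (geometric-monic p-1 ζ)
      where
      root : horner 1# (replicate p-1 1#) ζ ≈ 0#
      root = noZeroDivisors (λ e → λ≉0 (trans (solve 1 (λ z → con 1ℤ :- z := :- (z :- con 1ℤ)) ζ) (trans (-‿cong e) (solve 0 (:- con 0ℤ := con 0ℤ)))))
        (trans (geometric p-1 ζ) (trans (+-congʳ ζ^p≈1) (-‿inverseʳ 1#)))

      relation : Dζ.Monic p-1 (horner 1# (replicate p-1 1#) ζ) → Dζ.Deg p-1 (ζ ^ p-1)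
      relation (z , z∈ , e) = Dζ.deg-resp (begin
        - z  ≈⟨ +-identityʳ _ ⟨
        - z + 0#  ≈⟨ +-congˡ (trans (sym root) e) ⟩
        - z + (z + ζ ^ p-1)  ≈⟨ solve 2 (λ z t → :- z :+ (z :+ t) := t) z (ζ ^ p-1) ⟩
        ζ ^ p-1  ∎) (Dζ.deg-neg z∈)

    -- The substitution ζ = 1 - λ keeps the number of coefficients, as a + ζz = a + (z - λz). It is
    -- made because independence is available for the powers of λ, through the uniformiser property.
    ζ⇒λ : ∀ {n y} → Dζ.Deg n y → Dλ.Deg n y
    ζ⇒λ (Degree.nil e) = Degree.nil e
    ζ⇒λ (Degree.cons {z = z} a∈ z∈ e) = Dλ.deg-resp
      (sym (trans e (solve 3 (λ a ζ z → a :+ ζ :* z := a :+ (z :+ (:- ((con 1ℤ :- ζ) :* z)))) _ ζ z)))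
      (Dλ.deg-+ (Degree.cons a∈ (Dλ.deg-0 _) (sym (trans (+-congˡ (zeroʳ λ₀)) (+-identityʳ _))))
        (Dλ.deg-+ (Dλ.deg-suc (ζ⇒λ z∈)) (Dλ.deg-neg (Dλ.deg-x* (ζ⇒λ z∈)))))

    λ-coefficients : ∀ {r} → R r → ∃ λ cs → length cs ≡ p-1 × r ≈ evalℤ cs λ₀
    λ-coefficients {r} r∈ = deg⇒evalℤ (ζ⇒λ (Dζ.deg-resp (*-identityʳ r)
      (subring-least (Dζ.Relation.multipliers ζ-relation) (λ { ≡.refl → Dζ.Relation.x*-closed ζ-relation }) r∈
        (Degree.cons (1ℤ , sym fromℤ-1) (Dζ.deg-0 _) (sym (trans (+-congˡ (zeroʳ ζ)) (+-identityʳ 1#)))))))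

    divides⇒∣coefficients : ∀ q cs {t} → length cs ≡ p-1 → R t → evalℤ cs λ₀ ≈ ι q * t → All (q ∣∣_) cs
    divides⇒∣coefficients q cs {t} l t∈ e = go λ^p-1∣p (λ-coefficients t∈)
      where
      go : (∃ λ v → R v × ι p ≈ λ₀ ^ p-1 * v) → (∃ λ ds → length ds ≡ p-1 × t ≈ evalℤ ds λ₀) → All (q ∣∣_) cs
      go (v , v∈ , pv) (ds , l′ , e′) = divides⇒coefficients R-subring (s≤s (s≤s z≤n)) λ∈R λ≉0 v∈ pv
        (λ i z∈ e → λ-fraction i (R⊆integral z∈) e)
        q cs ds (ℕ.≤-reflexive l) (≡.trans l (≡.sym l′)) (trans e (*-congˡ e′))

    module _ {q} (q-prime : Prime q) (q≢p : ¬ (q ≡ p)) where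
      private
        module PN = PrimeNotP q-prime q≢p
        module Mod = PN.Mod
        instance _ = prime⇒nonZero q-prime

      -- Divisibility by `q` is read off the integer coefficients with respect to the powers of λ.
      -- This supplies the decision on which the search for a primitive idempotent rests.
      zero? : ∀ (s : 𝔹.Carrier) → Dec (s Mod.≈ₘ 𝔹.0#)
      zero? (s , s∈) = decide (λ-coefficients s∈)
        where
        decide : (∃ λ cs → length cs ≡ p-1 × s ≈ evalℤ cs λ₀) → Dec ((s , s∈) Mod.≈ₘ 𝔹.0#)
        decide (cs , l , e) = map′ to from (All.all? (λ c → q ℕ.∣? ℤ.∣ c ∣) cs)
          where
          to : All (q ∣∣_) cs → (s , s∈) Mod.≈ₘ 𝔹.0#
          to d = go (coefficients⇒divides q cs d)
            where
            go : (∃ λ ds → evalℤ cs λ₀ ≈ fromℤ (+ q) * evalℤ ds λ₀) → (s , s∈) Mod.≈ₘ 𝔹.0#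
            go (ds , e′) = (evalℤ ds λ₀ , evalℤ∈ ds) , trans e (trans e′ (sym (+-identityˡ _)))
              where
              evalℤ∈ : ∀ ds → R (evalℤ ds λ₀)
              evalℤ∈ []       = R∈.0∈
              evalℤ∈ (d ∷ ds) = R∈.+∈ (fromℤ∈ R-subring d) (R∈.*∈ λ∈R (evalℤ∈ ds))

          from : (s , s∈) Mod.≈ₘ 𝔹.0# → All (q ∣∣_) cs
          from ((t , t∈) , e′) = divides⇒∣coefficients q cs l t∈ (trans (sym e) (trans e′ (+-identityˡ _)))

      λᴮ : 𝔹.Carrier
      λᴮ = λ₀ , λ∈R

      residueList : ℕ → List 𝔹.Carrier
      residueList zero    = 𝔹.0# ∷ []
      residueList (suc n) = cartesianProductWith (λ c t → (ι c , ι∈ R-subring c) 𝔹.+ λᴮ 𝔹.* t) (upTo q) (residueList n)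

      reduce-coefficients : ∀ n cs → length cs ≡ n → ∃ λ t → t ∈ residueList n × ∃ λ w → R w × evalℤ cs λ₀ ≈ proj₁ t + ι q * w
      reduce-coefficients zero    []       _ = 𝔹.0# , here ≡.refl , 0# , R∈.0∈ , solve 1 (λ q → con 0ℤ := con 0ℤ :+ q :* con 0ℤ) (ι q)
      reduce-coefficients (suc n) (c ∷ cs) l = step (reduce-coefficients n cs (ℕ.suc-injective l))
        where
        c′ = c ℤ.%ℕ q
        d = c ℤ./ℕ q

        c≈ : fromℤ c ≈ ι c′ + fromℤ d * ι q
        c≈ = trans (reflexive (≡.cong fromℤ (ℤ.a≡a%ℕn+[a/ℕn]*n c q))) (trans (fromℤ-+ (+ c′) (d ℤ.* + q)) (+-congˡ (fromℤ-* d (+ q))))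

        step : (∃ λ t → t ∈ residueList n × ∃ λ w → R w × evalℤ cs λ₀ ≈ proj₁ t + ι q * w) →
               ∃ λ t → t ∈ residueList (suc n) × ∃ λ w → R w × evalℤ (c ∷ cs) λ₀ ≈ proj₁ t + ι q * w
        step (t , t∈ , w , w∈ , e) =
          (ι c′ , ι∈ R-subring c′) 𝔹.+ λᴮ 𝔹.* t ,
          ∈-cartesianProductWith⁺ _ (∈-upTo⁺ (ℤ.n%ℕd<d c q)) t∈ ,
          fromℤ d + λ₀ * w , R∈.+∈ (fromℤ∈ R-subring d) (R∈.*∈ λ∈R w∈) ,
          trans (+-cong c≈ (*-congˡ e))
            (solve 6 (λ c d q l t w → c :+ d :* q :+ l :* (t :+ q :* w) := c :+ l :* t :+ q :* (d :+ l :* w)) (ι c′) (fromℤ d) (ι q) λ₀ (proj₁ t) w)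

      exhaustive : ∀ s → Any (s Mod.≈ₘ_) (residueList p-1)
      exhaustive (s , s∈) = go (λ-coefficients s∈)
        where
        go : (∃ λ cs → length cs ≡ p-1 × s ≈ evalℤ cs λ₀) → Any ((s , s∈) Mod.≈ₘ_) (residueList p-1)
        go (cs , l , e) = find (reduce-coefficients p-1 cs l)
          where
          find : (∃ λ t → t ∈ residueList p-1 × ∃ λ w → R w × evalℤ cs λ₀ ≈ proj₁ t + ι q * w) → Any ((s , s∈) Mod.≈ₘ_) (residueList p-1)
          find (t , t∈ , w , w∈ , e′) = lose t∈ ((w , w∈) , trans e e′)

      private
        module SF = SquareFreeDivision ℤ[ ζ ] Mod.q′ (λ e → *-cancelˡ (ι≉0 q) e) zero? PN.N PN.regular (residueList p-1) exhaustive

      squareFree-divides : ∀ n {α} → Ideals.SquareFreeAsIdeal ℤ[ ζ ] α → ∀ {a} → R a →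
        (∃ λ t → R t × a ^ suc n * proj₁ α ^ n ≈ ι q ^ suc n * t) → ∃ λ b → R b × a ≈ ι q * b
      squareFree-divides n {α} sf {a} a∈ (t , t∈ , e) = unpack (SF.squareFree-divides n {a , a∈} {α} sf ((t , t∈) , (begin
          proj₁ ((a , a∈) 𝔹^.^ suc n 𝔹.* α 𝔹^.^ n)
            ≈⟨ *-cong (reflexive (PN.proj₁-^ (a , a∈) (suc n))) (reflexive (PN.proj₁-^ α n)) ⟩
          a ^ suc n * proj₁ α ^ n  ≈⟨ e ⟩
          ι q ^ suc n * t  ≈⟨ *-congʳ (reflexive (PN.proj₁-^ Mod.q′ (suc n))) ⟨
          proj₁ (Mod.q′ 𝔹^.^ suc n) * t  ∎)))
        where
        unpack : (a , a∈) Mod.≈ₘ 𝔹.0# → ∃ λ b → R b × a ≈ ι q * b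
        unpack ((b , b∈) , e) = b , b∈ , trans e (+-identityˡ _)

    -- Irreducibility keeps θ out of R

    module IrreducibleRadical where
      private
        open Polynomials ℤ[ ζ ]
        module PF = PolynomialFactor ℤ[ ζ ]
        open SubringRing ｛ ζ ｝ using (proj₁-^)

      -- If θ were in R, the polynomial Xᵖ - α would be X - θ times a cofactor that has the root ζθ,
      -- contrary to irreducibility.
      irreducible⇒θ∉R : (α : 𝔹.Carrier) → Irreducible ((X ^ᴾ p) +ᴾ constant (𝔹.- α)) →
                        ∀ {θ} → θ ^ p ≈ proj₁ α → ¬ R θ
      irreducible⇒θ∉R α irr {θ} e θ∈ = no-root s root-ζt
        where
        t s : 𝔹.Carrier
        t = θ , θ∈
        s = (ζ , ζ∈R) 𝔹.* t

        t^p≈α : t 𝔹^.^ p 𝔹.≈ α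
        t^p≈α = trans (reflexive (proj₁-^ t p)) e

        no-root : ∀ x → ¬ (proj₁ (PF.eval (PF.cofactor t p-1) x) ≈ 0#)
        no-root x root = 1≉0 (PF.irreducible⇒no-power t p-1 {α} t^p≈α irr {x} root)

        θ≉0 : ¬ (θ ≈ 0#)
        θ≉0 θ≈0 = no-root 𝔹.0# (trans (+-cong (trans (*-congʳ θ≈0) (zeroˡ _)) (zeroˡ _)) (+-identityˡ 0#))

        root-ζt : proj₁ (PF.eval (PF.cofactor t p-1) s) ≈ 0#
        root-ζt = noZeroDivisors {proj₁ (s 𝔹.- t)} ζθ≉θ (begin
          proj₁ ((s 𝔹.- t) 𝔹.* PF.eval (PF.cofactor t p-1) s)  ≈⟨ PF.eval-cofactor t p-1 s ⟩
          proj₁ (s 𝔹^.^ p) - proj₁ (t 𝔹^.^ p)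
            ≈⟨ +-cong (reflexive (proj₁-^ s p)) (-‿cong (reflexive (proj₁-^ t p))) ⟩
          (ζ * θ) ^ p - θ ^ p  ≈⟨ +-congʳ (^-distrib-* ζ θ p) ⟩
          ζ ^ p * θ ^ p - θ ^ p  ≈⟨ +-congʳ (*-congʳ ζ^p≈1) ⟩
          1# * θ ^ p - θ ^ p  ≈⟨ solve 1 (λ t → con 1ℤ :* t :- t := con 0ℤ) (θ ^ p) ⟩
          0#  ∎)
          where
          ζθ≉θ : ¬ (ζ * θ - θ ≈ 0#)
          ζθ≉θ e = θ≉0 (noZeroDivisors λ≉0 (trans (solve 2 (λ z t → (con 1ℤ :- z) :* t := :- (z :* t :- t)) ζ θ) (trans (-‿cong e) (solve 0 (:- con 0ℤ := con 0ℤ)))))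
    open IrreducibleRadical public using (irreducible⇒θ∉R)

    -- The radical extension S of R

    module Radical {α : Carrier} (α∈R : R α) {θ : Carrier} (θ^p≈α : θ ^ p ≈ α) where

      αᴿ : 𝔹.Carrier
      αᴿ = α , α∈R

      S : Pred Carrier (c ⊔ ℓ₁)
      S = ℤ[ ζ ][ θ ]

      S-subring : IsSubring S
      S-subring = subring-isSubring (R ∪ ｛ θ ｝)

      module S∈ = IsSubring S-subring
      module I∈ = IsSubring integral-subring
      module Dθ = Degree R-subring θ

      R⊆S : R ⊆ S
      R⊆S r∈ = gen (inj₁ r∈)

      θ∈S : S θ
      θ∈S = gen (inj₂ ≡.refl)

      α∈S : S α
      α∈S = R⊆S α∈R

      θ-integral : IntegralOver θ
      θ-integral = integral-root p-1 (integral-resp (sym θ^p≈α) (R⊆integral α∈R))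

      S⊆integral : S ⊆ IntegralOver
      S⊆integral = subring-least integral-subring λ { (inj₁ r∈) → R⊆integral r∈ ; (inj₂ ≡.refl) → θ-integral }

      θ-relation : Dθ.Deg p (θ ^ p)
      θ-relation = Degree.cons α∈R (Dθ.deg-0 _) (trans θ^p≈α (sym (trans (+-congˡ (zeroʳ θ)) (+-identityʳ α))))

      S⊆deg : ∀ {s} → S s → Dθ.Deg p s
      S⊆deg {s} s∈ = Dθ.deg-resp (*-identityʳ s)
        (subring-least (Dθ.Relation.multipliers θ-relation)
          (λ { (inj₁ r∈) → Dθ.Relation.A-multiplier θ-relation r∈ ; (inj₂ ≡.refl) → Dθ.Relation.x*-closed θ-relation }) s∈
          (Degree.cons R∈.1∈ (Dθ.deg-0 _) (sym (trans (+-congˡ (zeroʳ θ)) (+-identityʳ 1#)))))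

      K : Pred Carrier (c ⊔ ℓ₁)
      K = ℚ⟮ ζ , θ ⟯

      subfield-isSubring : IsSubring K
      subfield-isSubring = record
        { resp = Subfield⟨_⟩.resp ; 0∈ = Subfield⟨_⟩.0∈ ; 1∈ = Subfield⟨_⟩.1∈ ; +∈ = Subfield⟨_⟩.+∈ ; *∈ = Subfield⟨_⟩.*∈ ; -∈ = Subfield⟨_⟩.-∈ }

      R⊆K : R ⊆ K
      R⊆K = subring-least subfield-isSubring λ z → gen (inj₁ z)

      S⊆K : S ⊆ K
      S⊆K = subring-least subfield-isSubring λ { (inj₁ r∈) → R⊆K r∈ ; (inj₂ e) → gen (inj₂ e) }

      -- Independence of the powers of θ over R

      module RootIndependence (θ∉R : ¬ R θ) where

        θ≉0 : ¬ (θ ≈ 0#)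
        θ≉0 e = θ∉R (R∈.resp (sym e) R∈.0∈)

        α≉0 : ¬ (α ≈ 0#)
        α≉0 e = ^-≉0 p θ≉0 (trans θ^p≈α e)

        p∣exponent : ∀ m → ζ ^ m ≈ 1# → p ℕ.∣ m
        p∣exponent m e with m % p in eq
        ... | zero  = ℕ.m%n≡0⇒n∣m m p eq
        ... | suc r = contradiction ζ^[m%p]≈1 (proj₂ ζ-primitive (suc r) (s≤s z≤n) (≡.subst (_< p) eq (m%n<n m p)))
          where
          ζ^[m%p]≈1 : ζ ^ suc r ≈ 1#
          ζ^[m%p]≈1 = begin
            ζ ^ suc r  ≈⟨ *-identityʳ _ ⟨
            ζ ^ suc r * 1#  ≈⟨ *-congˡ (trans (^-congˡ (m / p) ζ^p≈1) (1^ (m / p))) ⟨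
            ζ ^ suc r * (ζ ^ p) ^ (m / p)
              ≈⟨ *-congˡ (trans (^-assocʳ ζ p (m / p)) (reflexive (≡.cong (ζ ^_) (ℕ.*-comm p (m / p))))) ⟩
            ζ ^ suc r * ζ ^ (m / p ℕ.* p)  ≈⟨ ^-homo-* ζ (suc r) _ ⟨
            ζ ^ (suc r ℕ.+ m / p ℕ.* p)  ≡⟨ ≡.cong (λ i → ζ ^ (i ℕ.+ m / p ℕ.* p)) eq ⟨
            ζ ^ (m % p ℕ.+ m / p ℕ.* p)  ≡⟨ ≡.cong (ζ ^_) (m≡m%n+[m/n]*n m p) ⟨
            ζ ^ m  ≈⟨ e ⟩
            1#  ∎

        rotated-root : ∀ i → (ζ ^ i * θ) ^ p ≈ α
        rotated-root i = begin
          (ζ ^ i * θ) ^ p  ≈⟨ ^-distrib-* (ζ ^ i) θ p ⟩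
          (ζ ^ i) ^ p * θ ^ p  ≈⟨ *-cong (^-comm ζ i p) θ^p≈α ⟩
          (ζ ^ p) ^ i * α  ≈⟨ *-congʳ (trans (^-congˡ i ζ^p≈1) (1^ i)) ⟩
          1# * α  ≈⟨ *-identityˡ α ⟩
          α  ∎

        Independent : ℕ → Set _
        Independent n = ∀ rs → length rs ≡ n → All R rs → horner 0# rs θ ≈ 0# → All (_≈ 0#) rs

        -- In R the coefficient `a` divides a positive integer m, so mθ is in R. As R is integrally
        -- closed, θ would be in R.
        linear-relation : ∀ {a b} → R a → R b → ¬ (a ≈ 0#) → ¬ (horner a (b ∷ []) θ ≈ 0#)
        linear-relation {a} {b} a∈ b∈ a≉0 e = go (nonzero-multiple R-subring a∈ a≉0 (R⊆integral a∈))
          where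
          go : ¬ (∃ λ m → ∃ λ t → ℕ.NonZero m × R t × a * t ≈ ι m)
          go (m , t , m≢0 , t∈ , at≈m) = θ∉R (R-closed m {{m≢0}} θ-integral (R∈.resp (begin
            - (t * b)  ≈⟨ +-identityʳ _ ⟨
            - (t * b) + 0#  ≈⟨ +-congˡ (trans (*-congˡ e) (zeroʳ t)) ⟨
            - (t * b) + t * (b + θ * a)
              ≈⟨ solve 4 (λ t b θ a → :- (t :* b) :+ t :* (b :+ θ :* a) := a :* t :* θ) t b θ a ⟩
            a * t * θ  ≈⟨ *-congʳ at≈m ⟩
            ι m * θ  ∎) (R∈.-∈ (R∈.*∈ t∈ b∈))))

        -- The minimal relation f(θ) = 0 shares no other root ζⁱθ of xᵖ - α, since
        -- f(ζⁱx) - ζⁱⁿf(x) has degree below n. So the p - 1 roots ζⁱθ all belong to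
        -- the cofactor of f, which has degree p - n: this forces n ≤ 1.
        module MinimalRelation {n′} (n<p : 2 ℕ.+ n′ < p) (independent : Independent (2 ℕ.+ n′))
          {a b : Carrier} {bs : List Carrier} (length-bs : length bs ≡ suc n′)
          (a∈ : R a) (b∈ : R b) (bs∈ : All R bs) (a≉0 : ¬ (a ≈ 0#))
          (relation : horner a (b ∷ bs) θ ≈ 0#) where

          private
            n : ℕ
            n = 2 ℕ.+ n′

            f : Carrier → Carrier
            f = horner a (b ∷ bs)

          no-rotated-root : ∀ i → 0 < i → i < p → ¬ (f (ζ ^ i * θ) ≈ 0#)
          no-rotated-root i@(suc i′) 0<i i<p root = conclude (independent (twist z 1# u (b ∷ bs))
              (≡.trans (length-twist z 1# u (b ∷ bs)) (≡.cong suc length-bs))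
              (twist∈ R-subring z∈ R∈.1∈ (R∈.^∈ n z∈) (b∈ ∷ bs∈)) twisted-relation)
            where
            z u : Carrier
            z = ζ ^ i
            u = z ^ n

            z∈ : R z
            z∈ = R∈.^∈ i ζ∈R

            twisted-relation : horner 0# (twist z 1# u (b ∷ bs)) θ ≈ 0#
            twisted-relation = begin
              horner 0# (twist z 1# u (b ∷ bs)) θ
                ≈⟨ horner-twist a z 1# u (b ∷ bs) θ (trans (*-identityˡ _) (reflexive (≡.cong (λ m → z ^ suc m) length-bs))) ⟩
              1# * f (z * θ) - u * f θ  ≈⟨ +-cong (*-congˡ root) (-‿cong (*-congˡ relation)) ⟩
              1# * 0# - u * 0#  ≈⟨ solve 1 (λ u → con 1ℤ :* con 0ℤ :- u :* con 0ℤ := con 0ℤ) u ⟩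
              0#  ∎

            u≉1 : ¬ (1# - u ≈ 0#)
            -- ζⁱⁿ = 1 would require p ∣ i n, whereas i and n both lie strictly between 0 and p.
            u≉1 e = absurd (euclidsLemma i n p-prime (p∣exponent (i ℕ.* n) (trans (sym (^-assocʳ ζ i n)) (sym (x∙y⁻¹≈ε⇒x≈y 1# u e)))))
              where
              absurd : ¬ (p ℕ.∣ i ⊎ p ℕ.∣ n)
              absurd (inj₁ d) = ℕ.>⇒∤ i<p d
              absurd (inj₂ d) = ℕ.>⇒∤ n<p d

            conclude : ¬ All (_≈ 0#) (twist z 1# u (b ∷ bs))
            -- The constant coefficient of the twisted relation is (1 - u) b, so b = 0. The original
            -- relation is then divisible by θ, and the shorter relation forces a = 0.
            conclude (e ∷ _) = a≉0 (All.head (All.++⁻ʳ bs (independent (bs ∷ʳ a) length-bs∷ʳa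
                (All.++⁺ bs∈ (a∈ ∷ [])) (trans (horner-∷ʳ bs a θ) (noZeroDivisors θ≉0 (begin
                  θ * horner a bs θ  ≈⟨ +-identityˡ _ ⟨
                  0# + θ * horner a bs θ  ≈⟨ +-congʳ (noZeroDivisors u≉1 e) ⟨
                  b + θ * horner a bs θ  ≈⟨ relation ⟩
                  0#  ∎))))))
              where
              length-bs∷ʳa : length (bs ∷ʳ a) ≡ n
              length-bs∷ʳa = ≡.trans (length-++ bs) (≡.trans (ℕ.+-comm (length bs) 1) (≡.cong suc length-bs))

          -- The quotient of xᵖ by `f` has degree p - n and so p - n + 1 coefficients. Because n is
          -- at least 2, there are at least as many roots ζⁱθ with 0 < i < p.
          j : ℕ
          j = p ∸ suc n′

          j≤p-1 : j ≤ p-1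
          j≤p-1 = ℕ.∸-monoʳ-≤ p (s≤s (z≤n {n′}))

          open PseudoDivision R-subring a∈ b∈ bs∈

          impossible : Division j → ⊥
          impossible d = absurd remainder remainder-length remainder∈ identity
            where
            open Division d

            u : Carrier
            u = a ^ j

            x^p-identity : ∀ rs → (∀ x → u * x ^ (length bs ℕ.+ j) ≈ f x * horner 0# quotient x + horner 0# rs x) →
                           ∀ x → u * x ^ p ≈ f x * horner 0# quotient x + horner 0# rs x
            x^p-identity rs id x = trans (*-congˡ (reflexive (≡.cong (x ^_) (≡.sym (≡.trans (≡.cong (ℕ._+ j) length-bs) (ℕ.m+[n∸m]≡n (ℕ.≤-trans (ℕ.n≤1+n _) (ℕ.<⇒≤ n<p)))))))) (id x)

            absurd : ∀ rs → length rs ≡ suc (length bs) → All R rs →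
                     (∀ x → u * x ^ (length bs ℕ.+ j) ≈ f x * horner 0# quotient x + horner 0# rs x) → ⊥
            absurd (r ∷ rs) l (r∈ ∷ rs∈) id = conclude (independent (r - u * α ∷ rs) (≡.trans l (≡.cong suc length-bs))
                (R∈.+∈ r∈ (R∈.-∈ (R∈.*∈ (R∈.^∈ j a∈) α∈R)) ∷ rs∈) remainder-relation)
              where
              quo rem : Carrier → Carrier
              quo = horner 0# quotient
              rem = horner 0# rs

              remainder-relation : r - u * α + θ * rem θ ≈ 0#
              remainder-relation = begin
                r - u * α + θ * rem θ
                  ≈⟨ solve 4 (λ r u α h → r :- u :* α :+ h := con 0ℤ :+ (r :+ h) :- u :* α) r u α (θ * rem θ) ⟩
                0# + (r + θ * rem θ) - u * α  ≈⟨ +-congʳ (+-congʳ (trans (*-congʳ relation) (zeroˡ (quo θ)))) ⟨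
                f θ * quo θ + (r + θ * rem θ) - u * α  ≈⟨ +-congʳ (x^p-identity (r ∷ rs) id θ) ⟨
                u * θ ^ p - u * α  ≈⟨ +-congʳ (*-congˡ θ^p≈α) ⟩
                u * α - u * α  ≈⟨ -‿inverseʳ _ ⟩
                0#  ∎

              conclude : All (_≈ 0#) (r - u * α ∷ rs) → ⊥
              -- The quotient vanishes and only the constant uα is left of the remainder. At x = 0
              -- the division identity then reads 0 = uα, although `u` and α are nonzero.
              conclude (e ∷ es) = ^-≉0 j a≉0 (noZeroDivisors α≉0 (trans (*-comm α u) (begin
                u * α  ≈⟨ r≈uα ⟨
                r  ≈⟨ solve 2 (λ r f → r := f :* con 0ℤ :+ (r :+ con 0ℤ)) r (f 0#) ⟩
                f 0# * 0# + (r + 0#)  ≈⟨ +-cong (*-congˡ (quo≈0 0#)) (+-congˡ (zeroˡ (rem 0#))) ⟨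
                f 0# * quo 0# + (r + 0# * rem 0#)  ≈⟨ x^p-identity (r ∷ rs) id 0# ⟨
                u * 0# ^ p  ≈⟨ solve 2 (λ u t → u :* (con 0ℤ :* t) := con 0ℤ) u _ ⟩
                0#  ∎)))
                where
                r≈uα : r ≈ u * α
                r≈uα = x∙y⁻¹≈ε⇒x≈y r (u * α) e

                quotient-root : ∀ i → 0 < i → i ≤ j → quo (ζ ^ i * θ) ≈ 0#
                quotient-root i 0<i i≤j = noZeroDivisors (no-rotated-root i 0<i (s≤s (ℕ.≤-trans i≤j j≤p-1))) (begin
                  f x * quo x  ≈⟨ solve 2 (λ g h → g := g :+ h :- h) (f x * quo x) (r + x * rem x) ⟩
                  f x * quo x + (r + x * rem x) - (r + x * rem x)
                    ≈⟨ +-cong (sym (x^p-identity (r ∷ rs) id x)) (-‿cong (+-cong r≈uα (trans (*-congˡ (horner-zero es x)) (zeroʳ x)))) ⟩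
                  u * x ^ p - (u * α + 0#)  ≈⟨ +-cong (*-congˡ (rotated-root i)) (-‿cong (+-identityʳ _)) ⟩
                  u * α - u * α  ≈⟨ -‿inverseʳ _ ⟩
                  0#  ∎)
                  where x = ζ ^ i * θ

                -- A list of `j` coefficients, given the leading coefficient 0 in degree `j`, meets
                -- the `j` distinct roots ζθ, ..., ζʲθ exactly.
                quo≈0 : ∀ x → quo x ≈ 0#
                quo≈0 x = trans (root-factorisation 0# quotient (rotations θ j) (≡.trans quotient-length (≡.sym (length-rotations θ j)))
                  (rotations-distinct θ≉0 j (s≤s j≤p-1)) (all-rotations θ j quotient-root) x) (zeroˡ _)

        lead≈0 : ∀ bs {a} → length bs < p → Independent (length bs) → All R bs → R a → horner a bs θ ≈ 0# → a ≈ 0#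
        lead≈0 []            _   _   _                 _  e = e
        lead≈0 (b ∷ [])      _   _   (b∈ ∷ [])         a∈ e = ≈-stable λ a≉0 → linear-relation a∈ b∈ a≉0 e
        lead≈0 (b ∷ c ∷ bs)  n<p ind (b∈ ∷ bs∈)        a∈ e = ≈-stable λ a≉0 →
          let open MinimalRelation {length bs} n<p ind ≡.refl a∈ b∈ bs∈ a≉0 e in impossible (PseudoDivision.pseudoDivision R-subring a∈ b∈ bs∈ j)

        independent : ∀ n → n ≤ p → Independent n
        independent zero    _   []       _ _   _ = []
        independent (suc n) n<p rs       l rs∈ e = go (initLast rs) l rs∈ e
          where
          go : ∀ {rs} → Data.List.Base.InitLast rs → length rs ≡ suc n → All R rs → horner 0# rs θ ≈ 0# → All (_≈ 0#) rs
          go (bs ∷ʳ′ a) l rs∈ e = All.++⁺ (IH bs length-bs (All.++⁻ˡ bs rs∈) bs-relation) (a≈0 ∷ [])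
            where
            IH : Independent n
            IH = independent n (ℕ.<⇒≤ n<p)

            length-bs : length bs ≡ n
            length-bs = ℕ.suc-injective (≡.trans (≡.trans (ℕ.+-comm 1 (length bs)) (≡.sym (length-++ bs))) l)

            relation : horner a bs θ ≈ 0#
            relation = trans (sym (horner-∷ʳ bs a θ)) e

            a≈0 : a ≈ 0#
            a≈0 = lead≈0 bs (≡.subst (_< p) (≡.sym length-bs) n<p) (≡.subst Independent (≡.sym length-bs) IH)
              (All.++⁻ˡ bs rs∈) (All.head (All.++⁻ʳ bs rs∈)) relation

            bs-relation : horner 0# bs θ ≈ 0#
            bs-relation = begin
              horner 0# bs θ  ≈⟨ +-identityʳ _ ⟨
              horner 0# bs θ + 0#  ≈⟨ +-congˡ (trans (*-congʳ a≈0) (zeroˡ _)) ⟨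
              horner 0# bs θ + a * θ ^ length bs  ≈⟨ horner-lead bs a θ ⟨
              horner a bs θ  ≈⟨ relation ⟩
              0#  ∎

        lead-coefficient≈0 : ∀ {y b} → Dθ.Deg p-1 y → R b → y + b * θ ^ p-1 ≈ 0# → b ≈ 0#
        lead-coefficient≈0 {y} {b} y∈ b∈ e = go (deg⇒horner R-subring y∈)
          where
          go : (∃ λ bs → length bs ≡ p-1 × All R bs × y ≈ horner 0# bs θ) → b ≈ 0#
          go (bs , l , bs∈ , e′) = lead≈0 bs (≡.subst (_< p) (≡.sym l) ℕ.≤-refl) (independent (length bs) (≡.subst (_≤ p) (≡.sym l) (ℕ.n≤1+n p-1))) bs∈ b∈
            (trans (horner-lead bs b θ) (trans (+-cong (sym e′) (*-congˡ (reflexive (≡.cong (θ ^_) l)))) e))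

      -- From integral closedness to the two conditions

      module IntegralClosureImplies (θ∉R : ¬ R θ) (𝓞⊆S : 𝓞 K ⊆ S) where
        open RootIndependence θ∉R using (lead-coefficient≈0; α≉0)
        open FieldDefs L using (root)
        open Ideals ℤ[ ζ ]

        square-root∈S : ∀ {w s} → K w → w * w ≈ s → S s → S w
        square-root∈S w∈K e s∈ = 𝓞⊆S (w∈K , ⇒integral (integral-root 1 (integral-resp (sym (trans (*-congˡ (*-identityʳ _)) e)) (S⊆integral s∈))))

        -- The powers of θ are independent over R, so the coefficients of θᵖ⁻¹ in the two
        -- expressions for `u * w` agree.
        lead-divides : ∀ {u y w b} → R u → R b → Dθ.Deg p-1 y → u * w ≈ y + b * θ ^ p-1 → S w → ∃ λ t → R t × b ≈ u * t
        lead-divides {u} {y} {w} {b} u∈ b∈ y∈ e w∈ = go (Dθ.deg-last (S⊆deg w∈))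
          where
          go : (∃ λ z → ∃ λ t → Dθ.Deg p-1 z × R t × w ≈ z + t * θ ^ p-1) → ∃ λ t → R t × b ≈ u * t
          go (z , t , z∈ , t∈ , e′) = t , t∈ , x∙y⁻¹≈ε⇒x≈y b (u * t)
            (lead-coefficient≈0 (Dθ.deg-+ y∈ (Dθ.deg-neg (Dθ.deg-scale u∈ z∈))) (R∈.+∈ b∈ (R∈.-∈ (R∈.*∈ u∈ t∈))) (begin
              y - u * z + (b - u * t) * θ ^ p-1
                ≈⟨ solve 6 (λ y u z b t q → y :- u :* z :+ (b :- u :* t) :* q := y :+ b :* q :- u :* (z :+ t :* q)) y u z b t (θ ^ p-1) ⟩
              y + b * θ ^ p-1 - u * (z + t * θ ^ p-1)  ≈⟨ +-cong (sym e) (-‿cong (*-congˡ (sym e′))) ⟩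
              u * w - u * w  ≈⟨ -‿inverseʳ _ ⟩
              0#  ∎))

        -- For w = y θᵖ⁻¹ / α one has w² = r θᵖ⁻², because θ²ᵖ⁻² = α θᵖ⁻². So `w` is integral, and
        -- its top coefficient y / α is in R.
        divides-by-square : ∀ {y r} → R y → R r → y * y ≈ α * r → ∀ {A⁻¹} → α * A⁻¹ ≈ 1# → ∃ λ t → R t × y ≈ α * t
        divides-by-square {y} {r} y∈ r∈ e {A⁻¹} inv =
          lead-divides α∈R y∈ (Dθ.deg-0 p-1) Aw≈ (square-root∈S w∈K w²≈ (S∈.*∈ (R⊆S r∈) (S∈.^∈ (suc k) θ∈S)))
          where
          w = A⁻¹ * (y * θ ^ p-1)

          w∈K : K w
          w∈K = KS.*∈ (Subfield⟨_⟩.inv∈ inv (R⊆K α∈R)) (KS.*∈ (R⊆K y∈) (KS.^∈ p-1 (S⊆K θ∈S)))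
            where module KS = IsSubring subfield-isSubring

          Aw≈ : α * w ≈ 0# + y * θ ^ p-1
          Aw≈ = begin
            α * (A⁻¹ * (y * θ ^ p-1))  ≈⟨ *-assoc α A⁻¹ _ ⟨
            α * A⁻¹ * (y * θ ^ p-1)  ≈⟨ *-congʳ inv ⟩
            1# * (y * θ ^ p-1)  ≈⟨ solve 1 (λ t → con 1ℤ :* t := con 0ℤ :+ t) (y * θ ^ p-1) ⟩
            0# + y * θ ^ p-1  ∎

          w²≈ : w * w ≈ r * θ ^ suc k
          w²≈ = begin
            A⁻¹ * (y * (θ * t)) * (A⁻¹ * (y * (θ * t)))
              ≈⟨ solve 4 (λ a y x t → a :* (y :* (x :* t)) :* (a :* (y :* (x :* t))) := a :* (y :* y) :* (a :* (x :* (x :* t))) :* t) A⁻¹ y θ t ⟩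
            A⁻¹ * (y * y) * (A⁻¹ * θ ^ p) * t  ≈⟨ *-congʳ (*-cong (*-congˡ e) (*-congˡ θ^p≈α)) ⟩
            A⁻¹ * (α * r) * (A⁻¹ * α) * t
              ≈⟨ solve 4 (λ b a r t → b :* (a :* r) :* (b :* a) :* t := a :* b :* (a :* b) :* (r :* t)) A⁻¹ α r t ⟩
            α * A⁻¹ * (α * A⁻¹) * (r * t)  ≈⟨ *-congʳ (*-cong inv inv) ⟩
            1# * 1# * (r * t)  ≈⟨ solve 1 (λ t → con 1ℤ :* con 1ℤ :* t := t) (r * t) ⟩
            r * t  ∎
            where t = θ ^ suc k

        squareFree : SquareFreeAsIdeal αᴿ
        -- The goal is a contradiction, so an inverse of α may be assumed although it exists only up
        -- to double negation.
        squareFree P P-prime (J , J-ideal , ⟨α⟩⊆P²J , P²J⊆⟨α⟩) = ¬¬-inverse α≉0 λ (A⁻¹ , inv) → absurd inv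
          where
          open IsPrimeIdeal P-prime
          module P = IsIdeal isIdeal
          module ∣ {x y} = RawMagma._∣ʳ_ {M = 𝔹.*-rawMagma} {x} {y}

          module _ {A⁻¹} (inv : α * A⁻¹ ≈ 1#) where
            Quotient∈P : 𝔹.Carrier → Set _
            Quotient∈P t = ∃ λ z → P z × t 𝔹.≈ αᴿ 𝔹.* z

            -- The square of xj is (x²j) j, and x²j lies in P²J and so in (α).
            cofactor : ∀ {x j} → P x → J j → ∃ λ t → R t × proj₁ (x 𝔹.* j) ≈ α * t
            cofactor {x} {j} x∈ j∈ = go (P²J⊆⟨α⟩ (prod (prod x∈ x∈) j∈))
              where
              go : ⟨ αᴿ ⟩ ((x 𝔹.* x) 𝔹.* j) → ∃ λ t → R t × proj₁ (x 𝔹.* j) ≈ α * t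
              go d = divides-by-square (proj₂ (x 𝔹.* j)) (proj₂ (q 𝔹.* j)) (begin
                x′ * j′ * (x′ * j′)  ≈⟨ solve 2 (λ x j → x :* j :* (x :* j) := x :* x :* j :* j) x′ j′ ⟩
                x′ * x′ * j′ * j′  ≈⟨ *-congʳ (∣.equality d) ⟨
                proj₁ q * α * j′  ≈⟨ solve 3 (λ q a j → q :* a :* j := a :* (q :* j)) (proj₁ q) α j′ ⟩
                α * (proj₁ q * j′)  ∎) inv
                where
                q = ∣.quotient d
                x′ = proj₁ x
                j′ = proj₁ j

            quotient-+ : ∀ s t → Quotient∈P s → Quotient∈P t → Quotient∈P (s 𝔹.+ t)
            quotient-+ s t (z , z∈ , e) (z′ , z′∈ , e′) = z 𝔹.+ z′ , P.+∈ z∈ z′∈ , trans (+-cong e e′) (sym (distribˡ α _ _))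

            quotient-resp : ∀ s t → s 𝔹.≈ t → Quotient∈P s → Quotient∈P t
            quotient-resp s t s≈t (z , z∈ , e) = z , z∈ , trans (sym s≈t) e

            quotient-0 : Quotient∈P 𝔹.0#
            quotient-0 = 𝔹.0# , P.0∈ , sym (zeroʳ α)

            P²J : ∀ {x j} → (P · P) x → J j → Quotient∈P (x 𝔹.* j)
            P²J {j = j} (resp {x} {y} x≈y p) j∈ = quotient-resp (x 𝔹.* j) (y 𝔹.* j) (*-congʳ x≈y) (P²J p j∈)
            P²J {j = j} (prod {x} {y} x∈ y∈) j∈ = go (cofactor y∈ j∈)
              where
              go : (∃ λ t → R t × proj₁ (y 𝔹.* j) ≈ α * t) → Quotient∈P ((x 𝔹.* y) 𝔹.* j)
              go (t , t∈ , e) = (t , t∈) 𝔹.* x , P.*∈ (t , t∈) x∈ , (begin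
                proj₁ x * proj₁ y * proj₁ j  ≈⟨ *-assoc _ _ _ ⟩
                proj₁ x * (proj₁ y * proj₁ j)  ≈⟨ *-congˡ e ⟩
                proj₁ x * (α * t)  ≈⟨ solve 3 (λ x a t → x :* (a :* t) := a :* (t :* x)) (proj₁ x) α t ⟩
                α * (t * proj₁ x)  ∎)
            P²J {j = j} 0∈ j∈ = quotient-resp 𝔹.0# (𝔹.0# 𝔹.* j) (sym (zeroˡ _)) quotient-0
            P²J {j = j} (+∈ {x} {y} p p′) j∈ = quotient-resp (x 𝔹.* j 𝔹.+ y 𝔹.* j) ((x 𝔹.+ y) 𝔹.* j) (sym (distribʳ _ _ _)) (quotient-+ (x 𝔹.* j) (y 𝔹.* j) (P²J p j∈) (P²J p′ j∈))

            P²J⇒quotient : ∀ {t} → (P · P · J) t → Quotient∈P t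
            P²J⇒quotient (resp {x} {y} x≈y p) = quotient-resp x y x≈y (P²J⇒quotient p)
            P²J⇒quotient (prod p j∈)  = P²J p j∈
            P²J⇒quotient 0∈           = quotient-0
            P²J⇒quotient (+∈ {x} {y} p p′)    = quotient-+ x y (P²J⇒quotient p) (P²J⇒quotient p′)

            absurd : ⊥
            absurd = go (P²J⇒quotient (⟨α⟩⊆P²J {αᴿ} (record { quotient = 𝔹.1# ; equality = *-identityˡ α })))
              where
              go : ¬ Quotient∈P αᴿ
              go (z , z∈ , e) = proper (P.resp {z} {𝔹.1#} (sym (*-cancelˡ α≉0 (trans (*-identityʳ α) e))) z∈)

        λ²-divides : ∀ {x} → (⟨ 𝔹.1# 𝔹.- root ζ ⟩ · ⟨ 𝔹.1# 𝔹.- root ζ ⟩) x → ∃ λ r → R r × proj₁ x ≈ λ₀ * λ₀ * r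
        λ²-divides (resp x≈y p) = let (r , r∈ , e) = λ²-divides p in r , r∈ , trans (sym x≈y) e
        λ²-divides (prod (q RawMagma., e) (q′ RawMagma., e′)) = proj₁ q * proj₁ q′ , R∈.*∈ (proj₂ q) (proj₂ q′) ,
          trans (*-cong (sym e) (sym e′)) (solve 3 (λ q q′ l → q :* l :* (q′ :* l) := l :* l :* (q :* q′)) (proj₁ q) (proj₁ q′) λ₀)
        λ²-divides 0∈ = 0# , R∈.0∈ , sym (zeroʳ _)
        λ²-divides (+∈ p p′) = let (r , r∈ , e) = λ²-divides p; (r′ , r′∈ , e′) = λ²-divides p′ in
          r + r′ , R∈.+∈ r∈ r′∈ , trans (+-cong e e′) (sym (distribˡ _ _ _))

        λ²∤ : ∀ {r} → R r → ¬ (α ^ p - α ≈ λ₀ * λ₀ * r)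
        λ²∤ {r} r∈ e = ¬¬-inverse λ≉0 λ (λ⁻¹ , inv) → expand inv (SubringRing.freshman-subring (R ∪ ｛ θ ｝) p-prime θ∈S (S∈.-∈ α∈S)) λ^p-1∣p
          where
          y : Carrier
          y = θ - α

          module _ {λ⁻¹} (inv : λ₀ * λ⁻¹ ≈ 1#) where
            w : Carrier
            w = λ⁻¹ * y ^ p-1

            y-monic : Dθ.Monic p-1 (y ^ p-1)
            y-monic = Dθ.monic-^ p-1 (- α , Dθ.deg-const (R∈.-∈ α∈R) , trans (+-comm θ (- α)) (+-congˡ (sym (*-identityʳ θ))))

            w∈K : K w
            w∈K = KS.*∈ (Subfield⟨_⟩.inv∈ inv (R⊆K λ∈R)) (KS.^∈ p-1 (KS.+∈ (S⊆K θ∈S) (KS.-∈ (R⊆K α∈R))))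
              where module KS = IsSubring subfield-isSubring

            expand : (∃ λ t → S t × y ^ p ≈ θ ^ p + (- α) ^ p + ι p * t) → (∃ λ v → R v × ι p ≈ λ₀ ^ p-1 * v) → ⊥
            expand (t , t∈ , e′) (v , v∈ , e″) = contradict y-monic
              where
              s : Carrier
              s = λ₀ ^ k * v * t - r

              -- As p is odd, (θ - α)ᵖ is α - αᵖ plus a multiple of p. The assumed congruence
              -- provides λ² for the difference, and λᵖ⁻¹ ∣ p with p ≥ 3 provides it for the rest.
              y^p≈ : y ^ p ≈ λ₀ * λ₀ * s
              y^p≈ = begin
                y ^ p  ≈⟨ e′ ⟩
                θ ^ p + (- α) ^ p + ι p * t  ≈⟨ +-cong (+-cong θ^p≈α (neg-^p α)) (*-congʳ e″) ⟩
                α - α ^ p + λ₀ * (λ₀ * λ₀ ^ k) * v * t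
                  ≈⟨ solve 6 (λ a b l m v t → a :- b :+ l :* (l :* m) :* v :* t := l :* (l :* m) :* v :* t :- (b :- a)) α (α ^ p) λ₀ (λ₀ ^ k) v t ⟩
                λ₀ * (λ₀ * λ₀ ^ k) * v * t - (α ^ p - α)  ≈⟨ +-congˡ (-‿cong e) ⟩
                λ₀ * (λ₀ * λ₀ ^ k) * v * t - λ₀ * λ₀ * r
                  ≈⟨ solve 5 (λ l m v t r → l :* (l :* m) :* v :* t :- l :* l :* r := l :* l :* (m :* v :* t :- r)) λ₀ (λ₀ ^ k) v t r ⟩
                λ₀ * λ₀ * s  ∎

              s∈ : S s
              s∈ = S∈.+∈ (S∈.*∈ (R⊆S (R∈.*∈ (R∈.^∈ k λ∈R) v∈)) t∈) (S∈.-∈ (R⊆S r∈))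

              w²≈ : w * w ≈ s * y ^ suc k
              w²≈ = begin
                λ⁻¹ * (y * u) * (λ⁻¹ * (y * u))
                  ≈⟨ solve 3 (λ i y u → i :* (y :* u) :* (i :* (y :* u)) := i :* i :* (y :* (y :* u)) :* u) λ⁻¹ y u ⟩
                λ⁻¹ * λ⁻¹ * y ^ p * u  ≈⟨ *-congʳ (*-congˡ y^p≈) ⟩
                λ⁻¹ * λ⁻¹ * (λ₀ * λ₀ * s) * u
                  ≈⟨ solve 4 (λ i l s u → i :* i :* (l :* l :* s) :* u := l :* i :* (l :* i) :* (s :* u)) λ⁻¹ λ₀ s u ⟩
                λ₀ * λ⁻¹ * (λ₀ * λ⁻¹) * (s * u)  ≈⟨ *-congʳ (*-cong inv inv) ⟩
                1# * 1# * (s * u)  ≈⟨ solve 1 (λ t → con 1ℤ :* con 1ℤ :* t := t) (s * u) ⟩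
                s * u  ∎
                where u = y ^ suc k

              w∈S : S w
              w∈S = square-root∈S w∈K w²≈ (S∈.*∈ s∈ (S∈.^∈ (suc k) (S∈.+∈ θ∈S (S∈.-∈ α∈S))))

              contradict : Dθ.Monic p-1 (y ^ p-1) → ⊥
              contradict (z , z∈ , e‴) = go (lead-divides λ∈R R∈.1∈ z∈ (begin
                λ₀ * (λ⁻¹ * y ^ p-1)  ≈⟨ *-assoc _ _ _ ⟨
                λ₀ * λ⁻¹ * y ^ p-1  ≈⟨ *-congʳ inv ⟩
                1# * y ^ p-1  ≈⟨ *-identityˡ _ ⟩
                y ^ p-1  ≈⟨ e‴ ⟩
                z + θ ^ p-1  ≈⟨ +-congˡ (*-identityˡ _) ⟨
                z + 1# * θ ^ p-1  ∎) w∈S)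
                where
                go : (∃ λ t → R t × 1# ≈ λ₀ * t) → ⊥
                go (t , t∈ , e) = λ-nonunit t∈ (sym e)

        not-congruent : ¬ (αᴿ ^ᴿ p ≡ αᴿ [mod ⟨ 𝔹.1# 𝔹.- root ζ ⟩ · ⟨ 𝔹.1# 𝔹.- root ζ ⟩ ])
        not-congruent cong = go (λ²-divides cong)
          where
          go : ¬ (∃ λ r → R r × proj₁ ((αᴿ ^ᴿ p) 𝔹.- αᴿ) ≈ λ₀ * λ₀ * r)
          go (r , r∈ , e) = λ²∤ r∈ (trans (+-congʳ (sym (reflexive (SubringRing.proj₁-^ ｛ ζ ｝ αᴿ p)))) e)

      -- Maximality of S at primes q other than p

      module AwayFromP (squareFree : Ideals.SquareFreeAsIdeal ℤ[ ζ ] αᴿ) {q : ℕ} (q-prime : Prime q) (q≢p : ¬ (q ≡ p)) where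
        private
          module PN = PrimeNotP q-prime q≢p
          open PN using (Q; j; N; Q≡1+pj; Q≡2+N; R-frobenius)
          G = R ∪ ｛ θ ｝
          𝕊 = subring G
          module 𝕊 = CommutativeRing 𝕊
          module SR = SubringRing G
          module Mod = SR.Residue q-prime
          module 𝕄 = CommutativeRing Mod.residueRing
          instance _ = prime⇒nonZero q-prime

        pj≡1+N : p ℕ.* j ≡ suc N
        pj≡1+N = ℕ.suc-injective (≡.trans (≡.sym Q≡1+pj) Q≡2+N)

        f : Carrier
        f = α ^ (p ℕ.* j)

        f∈R : R f
        f∈R = R∈.^∈ (p ℕ.* j) α∈R

        1-f-annihilates : ∃ λ γ → R γ × (1# - f) * α ≈ ι q * γ
        1-f-annihilates = go (R-frobenius α∈R)
          where
          go : (∃ λ t → R t × α ^ Q ≈ α + ι q * t) → ∃ λ γ → R γ × (1# - f) * α ≈ ι q * γ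
          go (t , t∈ , e) = - t , R∈.-∈ t∈ , (begin
            (1# - f) * α  ≈⟨ solve 2 (λ f a → (con 1ℤ :- f) :* a := a :- a :* f) f α ⟩
            α - α * f  ≡⟨ ≡.cong (λ i → α - α ^ i) Q≡1+pj ⟨
            α - α ^ Q  ≈⟨ +-congˡ (-‿cong e) ⟩
            α - (α + ι q * t)  ≈⟨ solve 3 (λ a q t → a :- (a :+ q :* t) := q :* (:- t)) α (ι q) t ⟩
            ι q * - t  ∎)

        private
          α′ θ′ f′ : 𝕊.Carrier
          α′ = α , α∈S
          θ′ = θ , θ∈S
          f′ = α′ Mod.^ₘ (p ℕ.* j)

          r^Q≈r : ∀ {r} (r∈ : R r) → (r , gen (inj₁ r∈)) Mod.^ₘ Q 𝕄.≈ (r , gen (inj₁ r∈))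
          r^Q≈r {r} r∈ = go (R-frobenius r∈)
            where
            go : (∃ λ t → R t × r ^ Q ≈ r + ι q * t) → (r , gen (inj₁ r∈)) Mod.^ₘ Q 𝕄.≈ (r , gen (inj₁ r∈))
            go (t , t∈ , e) = (t , R⊆S t∈) , trans (reflexive (Mod.proj₁-^ₘ (r , gen (inj₁ r∈)) Q)) e

          θ′^p≈α′ : θ′ Mod.^ₘ p 𝕄.≈ α′
          θ′^p≈α′ = Mod.≈⇒≈ₘ {θ′ Mod.^ₘ p} {α′} (trans (reflexive (Mod.proj₁-^ₘ θ′ p)) θ^p≈α)

          module AM = Adjunction Mod.residueRing
          module RF = AM.RadicalFrobenius p j Q pj≡1+N Q≡1+pj {α′} {θ′} θ′^p≈α′ (r^Q≈r α∈R)

          -- The `Q`-th power multiplies θ by αʲ modulo q. After p rounds the accumulated factor is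
          -- αᵖʲ, the idempotent itself, so the exponent of q is p times that in `Q`.
          exponent : ℕ
          exponent = p-1 ℕ.* p

          Q^p≡ : Q ℕ.^ p ≡ q ℕ.^ exponent
          Q^p≡ = ℕ.^-*-assoc q p-1 p

          fixed : ∀ s → Mod.Fixed.IsFixed f′ exponent s
          fixed = Mod.fixed-generators⇒fixed f′ exponent λ
            { {r} (inj₁ r∈) → ≡.subst (λ i → f′ 𝕊.* (r , gen (inj₁ r∈)) Mod.^ₘ i 𝕄.≈ f′ 𝕊.* (r , gen (inj₁ r∈))) Q^p≡
                (𝕄.*-congˡ {f′} {(r , gen (inj₁ r∈)) Mod.^ₘ (Q ℕ.^ p)} {r , gen (inj₁ r∈)} (AM.fixed-^ (r , gen (inj₁ r∈)) Q p (r^Q≈r r∈)))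
            ; (inj₂ ≡.refl) → ≡.subst (λ i → f′ 𝕊.* θ′ Mod.^ₘ i 𝕄.≈ f′ 𝕊.* θ′) Q^p≡ RF.support-fixes-θ
            }

          N′ : ℕ
          N′ = q ℕ.^ exponent ∸ 2

          q^exponent≡ : q ℕ.^ exponent ≡ suc (suc N′)
          q^exponent≡ = ≡.sym (ℕ.m+[n∸m]≡n (ℕ.≤-trans (ℕ.nonTrivial⇒n>1 q {{prime⇒nonTrivial q-prime}})
            (ℕ.≤-trans (ℕ.≤-reflexive (≡.sym (ℕ.*-identityʳ q))) (ℕ.^-monoʳ-≤ q {1} {exponent} (s≤s z≤n)))))

        f-part-divisible : ∀ {z} → IntegralOver z → S (ι q * z) → ∃ λ t → S t × f * (ι q * z) ≈ ι q * t
        f-part-divisible {z} z-int s∈ = go (Mod.numerator-nilpotent s z-int refl)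
          where
          s : 𝕊.Carrier
          s = ι q * z , s∈
          unpack : f′ 𝕊.* s 𝕄.≈ 𝕄.0# → ∃ λ t → S t × f * (ι q * z) ≈ ι q * t
          unpack ((t , t∈) , e) = t , t∈ , trans (*-congʳ (sym (reflexive (Mod.proj₁-^ₘ α′ (p ℕ.* j))))) (trans e (+-identityˡ _))

          go : (∃ λ n → s Mod.^ₘ n 𝕄.≈ 𝕄.0#) → ∃ λ t → S t × f * (ι q * z) ≈ ι q * t
          go (n , nilp) = unpack (AM.fixed-nilpotent f′ s N′ n (≡.subst (λ i → f′ 𝕊.* s Mod.^ₘ i 𝕄.≈ f′ 𝕊.* s) q^exponent≡ (fixed s)) nilp)

        horner∈ : ∀ {bs} → All R bs → S (horner 0# bs θ)
        horner∈ []         = S∈.0∈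
        horner∈ (b∈ ∷ bs∈) = S∈.+∈ (R⊆S b∈) (S∈.*∈ θ∈S (horner∈ bs∈))

        module _ {g γ : Carrier} (g∈ : R g) (γ∈ : R γ) (gα≈qγ : g * α ≈ ι q * γ) where

          -- Multiplying z by θᵐ moves its lowest term b θⁱ to b θᵖ⁻¹ and all others
          -- into S. The p-th power of what remains is in R, so that square-freeness
          -- of α applies to it.
          g-part∈S : ∀ {bs} → All R bs → ∀ i → i ℕ.+ length bs ≡ p → ∀ {z} → IntegralOver z → ι q * z ≈ g * (θ ^ i * horner 0# bs θ) → S z
          g-part∈S [] i _ {z} z-int e = S∈.resp (sym (noZeroDivisors (ι≉0 q) (trans e (solve 2 (λ g t → g :* (t :* con 0ℤ) := con 0ℤ) g (θ ^ i))))) S∈.0∈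
          g-part∈S {b ∷ bs} (b∈ ∷ bs∈) i i+m≡p {z} z-int e = go (squareFree-divides q-prime q≢p p-1 squareFree
              (R∈.*∈ g∈ b∈) (z′ ^ p , z′^p∈R , power))
            where
            m = length bs
            E = horner 0# bs θ

            1+i+m≡p : suc i ℕ.+ m ≡ p
            1+i+m≡p = ≡.trans (≡.sym (ℕ.+-suc i m)) i+m≡p

            z′ : Carrier
            -- In q z θᵐ every term after `b` acquires a factor θᵖ = α. Since gα = qγ, these terms
            -- add up to q γ E, which is removed.
            z′ = z * θ ^ m - γ * E

            z′-int : IntegralOver z′
            z′-int = I∈.+∈ (I∈.*∈ z-int (I∈.^∈ m θ-integral)) (I∈.-∈ (S⊆integral (S∈.*∈ (R⊆S γ∈) (horner∈ bs∈))))

            qz′≈ : ι q * z′ ≈ g * b * θ ^ p-1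
            qz′≈ = begin
              ι q * (z * θ ^ m - γ * E)
                ≈⟨ solve 5 (λ q z t c e → q :* (z :* t :- c :* e) := q :* z :* t :- q :* c :* e) (ι q) z (θ ^ m) γ E ⟩
              ι q * z * θ ^ m - ι q * γ * E
                ≈⟨ +-cong (*-congʳ e) (-‿cong (*-congʳ (trans (sym gα≈qγ) (*-congˡ (sym θ^p≈))))) ⟩
              g * (θ ^ i * (b + θ * E)) * θ ^ m - g * (θ * θ ^ i * θ ^ m) * E
                ≈⟨ solve 6 (λ g u b x e t → g :* (u :* (b :+ x :* e)) :* t :- g :* (x :* u :* t) :* e := g :* b :* (u :* t)) g (θ ^ i) b θ E (θ ^ m) ⟩
              g * b * (θ ^ i * θ ^ m)  ≈⟨ *-congˡ (^-homo-* θ i m) ⟨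
              g * b * θ ^ (i ℕ.+ m)  ≡⟨ ≡.cong (λ n → g * b * θ ^ n) (ℕ.suc-injective 1+i+m≡p) ⟩
              g * b * θ ^ p-1  ∎
              where
              θ^p≈ : θ ^ suc i * θ ^ m ≈ α
              θ^p≈ = trans (sym (^-homo-* θ (suc i) m)) (trans (reflexive (≡.cong (θ ^_) 1+i+m≡p)) θ^p≈α)

            power : (g * b) ^ p * α ^ p-1 ≈ ι q ^ p * z′ ^ p
            power = begin
              (g * b) ^ p * α ^ p-1  ≈⟨ *-congˡ (^-congˡ p-1 θ^p≈α) ⟨
              (g * b) ^ p * (θ ^ p) ^ p-1  ≈⟨ *-congˡ (^-comm θ p p-1) ⟩
              (g * b) ^ p * (θ ^ p-1) ^ p  ≈⟨ ^-distrib-* (g * b) (θ ^ p-1) p ⟨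
              (g * b * θ ^ p-1) ^ p  ≈⟨ ^-congˡ p qz′≈ ⟨
              (ι q * z′) ^ p  ≈⟨ ^-distrib-* (ι q) z′ p ⟩
              ι q ^ p * z′ ^ p  ∎

            z′^p∈R : R (z′ ^ p)
            z′^p∈R = R-closed (q ℕ.^ p) {{ℕ.m^n≢0 q p}} (I∈.^∈ p z′-int)
              (R∈.resp (trans power (*-congʳ (sym (ι-^ q p)))) (R∈.*∈ (R∈.^∈ p (R∈.*∈ g∈ b∈)) (R∈.^∈ p-1 α∈R)))

            go : (∃ λ b′ → R b′ × g * b ≈ ι q * b′) → S z
            go (b′ , b′∈ , e′) = S∈.resp (solve 2 (λ z t → z :- t :+ t := z) z (b′ * θ ^ i)) (S∈.+∈ rest b′θⁱ∈)
              where
              b′θⁱ∈ : S (b′ * θ ^ i)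
              b′θⁱ∈ = S∈.*∈ (R⊆S b′∈) (S∈.^∈ i θ∈S)

              rest : S (z - b′ * θ ^ i)
              rest = g-part∈S bs∈ (suc i) 1+i+m≡p (I∈.+∈ z-int (I∈.-∈ (S⊆integral b′θⁱ∈))) (begin
                ι q * (z - b′ * θ ^ i)
                  ≈⟨ solve 4 (λ q z b t → q :* (z :- b :* t) := q :* z :- q :* b :* t) (ι q) z b′ (θ ^ i) ⟩
                ι q * z - ι q * b′ * θ ^ i  ≈⟨ +-cong e (-‿cong (*-congʳ (sym e′))) ⟩
                g * (θ ^ i * (b + θ * E)) - g * b * θ ^ i
                  ≈⟨ solve 5 (λ g u b x e → g :* (u :* (b :+ x :* e)) :- g :* b :* u := g :* (x :* u :* e)) g (θ ^ i) b θ E ⟩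
                g * (θ * θ ^ i * E)  ∎)

        S-q-closed : ∀ {z} → IntegralOver z → S (ι q * z) → S z
        S-q-closed {z} z-int s∈ = go (f-part-divisible z-int s∈) 1-f-annihilates (deg⇒horner R-subring (S⊆deg s∈))
          where
          go : (∃ λ t → S t × f * (ι q * z) ≈ ι q * t) → (∃ λ γ → R γ × (1# - f) * α ≈ ι q * γ) →
               (∃ λ bs → length bs ≡ p × All R bs × ι q * z ≈ horner 0# bs θ) → S z
          -- z is split as t + (z - t): the part cut out by f is `t`, already in S, and q (z - t) is
          -- (1 - f) q z, to which the argument for the complement applies.
          go (t , t∈ , e) (γ , γ∈ , e′) (bs , l , bs∈ , e″) = S∈.resp (solve 2 (λ z t → z :- t :+ t := z) z t)
            (S∈.+∈ (g-part∈S (R∈.+∈ R∈.1∈ (R∈.-∈ f∈R)) γ∈ e′ bs∈ 0 l (I∈.+∈ z-int (I∈.-∈ (S⊆integral t∈))) (begin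
              ι q * (z - t)  ≈⟨ solve 3 (λ q z t → q :* (z :- t) := q :* z :- q :* t) (ι q) z t ⟩
              ι q * z - ι q * t  ≈⟨ +-congˡ (-‿cong e) ⟨
              ι q * z - f * (ι q * z)
                ≈⟨ solve 2 (λ y f → y :- f :* y := (con 1ℤ :- f) :* (con 1ℤ :* y)) (ι q * z) f ⟩
              (1# - f) * (1# * (ι q * z))  ≈⟨ *-congˡ (*-congˡ e″) ⟩
              (1# - f) * (1# * horner 0# bs θ)  ∎)) t∈)

      -- Maximality of S at λ

      open Algebra.Properties.Semiring.Mult semiring using (×-homo-+)

      infix 4 _≡λ_
      _≡λ_ : Carrier → Carrier → Set _
      x ≡λ y = ∃ λ r → R r × x ≈ y + λ₀ * r

      fermat-ι : ∀ n → ι n ^ p ≡λ ι n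
      fermat-ι n = go (fermat p-prime n) λ∣p
        where
        go : (∃ λ t → n ℕ.^ p ≡ n ℕ.+ p ℕ.* t) → (∃ λ v → R v × ι p ≈ λ₀ * v) → ι n ^ p ≡λ ι n
        go (t , e) (v , v∈ , e′) = v * ι t , R∈.*∈ v∈ (ι∈ R-subring t) , (begin
          ι n ^ p  ≈⟨ ι-^ n p ⟨
          ι (n ℕ.^ p)  ≡⟨ ≡.cong ι e ⟩
          ι (n ℕ.+ p ℕ.* t)  ≈⟨ ×-homo-+ 1# n (p ℕ.* t) ⟩
          ι n + ι (p ℕ.* t)  ≈⟨ +-congˡ (trans (ι-* p t) (*-congʳ e′)) ⟩
          ι n + λ₀ * v * ι t  ≈⟨ +-congˡ (*-assoc _ _ _) ⟩
          ι n + λ₀ * (v * ι t)  ∎)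

      fermat-fromℤ : ∀ i → fromℤ i ^ p ≡λ fromℤ i
      fermat-fromℤ (+ n)    = fermat-ι n
      fermat-fromℤ -[1+ n ] = go (fermat-ι (suc n))
        where
        go : ι (suc n) ^ p ≡λ ι (suc n) → (- ι (suc n)) ^ p ≡λ (- ι (suc n))
        go (r , r∈ , e) = - r , R∈.-∈ r∈ , trans (neg-^p (ι (suc n))) (trans (-‿cong e)
          (solve 3 (λ n l r → :- (n :+ l :* r) := :- n :+ l :* (:- r)) (ι (suc n)) λ₀ r))

      -- Modulo λ every element of R is an integer, so Fermat's little theorem carries over; the
      -- cross terms are multiples of p and hence of λ. For α it defines the quotient of αᵖ - α by
      -- λ, whose residue decides the congruence modulo λ².
      fermat-R : ∀ {r} → R r → r ^ p ≡λ r
      fermat-R {r} r∈ = reduce (R-residue r∈)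
        where
        reduce : (∃ λ i → ∃ λ s → R s × r ≈ fromℤ i + λ₀ * s) → r ^ p ≡λ r
        reduce (i , s , s∈ , e) = combine (SubringRing.freshman-subring ｛ ζ ｝ p-prime (fromℤ∈ R-subring i) (R∈.*∈ λ∈R s∈)) (fermat-fromℤ i) λ∣p
          where
          combine : (∃ λ t → R t × (fromℤ i + λ₀ * s) ^ p ≈ fromℤ i ^ p + (λ₀ * s) ^ p + ι p * t) →
                    fromℤ i ^ p ≡λ fromℤ i → (∃ λ v → R v × ι p ≈ λ₀ * v) → r ^ p ≡λ r
          combine (t , t∈ , e₁) (u , u∈ , e₂) (v , v∈ , e₃) = u - s + (s * (λ₀ * s) ^ p-1 + v * t) ,
            R∈.+∈ (R∈.+∈ u∈ (R∈.-∈ s∈)) (R∈.+∈ (R∈.*∈ s∈ (R∈.^∈ p-1 (R∈.*∈ λ∈R s∈))) (R∈.*∈ v∈ t∈)) , (begin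
              r ^ p  ≈⟨ ^-congˡ p e ⟩
              (fromℤ i + λ₀ * s) ^ p  ≈⟨ e₁ ⟩
              fromℤ i ^ p + (λ₀ * s) ^ p + ι p * t  ≈⟨ +-cong (+-congʳ e₂) (*-congʳ e₃) ⟩
              fromℤ i + λ₀ * u + λ₀ * s * w + λ₀ * v * t
                ≈⟨ solve 7 (λ i l u s w v t → i :+ l :* u :+ l :* s :* w :+ l :* v :* t := i :+ l :* s :+ l :* (u :- s :+ (s :* w :+ v :* t))) (fromℤ i) λ₀ u s w v t ⟩
              fromℤ i + λ₀ * s + λ₀ * (u - s + (s * w + v * t))  ≈⟨ +-congʳ e ⟨
              r + λ₀ * (u - s + (s * w + v * t))  ∎)
            where w = (λ₀ * s) ^ p-1

      y : Carrier
      y = θ - α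

      y∈S : S y
      y∈S = S∈.+∈ θ∈S (S∈.-∈ α∈S)

      -- θ is α + y, and α is an integer modulo λ, so y and λ together reduce S to integers.
      S-residue : ∀ {s} → S s → ∃ λ i → ∃ λ a → ∃ λ b → S a × S b × s ≈ fromℤ i + y * a + λ₀ * b
      S-residue = subring-least residues λ { (inj₁ r∈) → from-R (R-residue r∈) ; (inj₂ ≡.refl) → from-θ (R-residue α∈R) }
        where
        Residue : Pred Carrier _
        Residue s = ∃ λ i → ∃ λ a → ∃ λ b → S a × S b × s ≈ fromℤ i + y * a + λ₀ * b

        from-R : ∀ {r} → (∃ λ i → ∃ λ s → R s × r ≈ fromℤ i + λ₀ * s) → Residue r
        from-R (i , s , s∈ , e) = i , 0# , s , S∈.0∈ , R⊆S s∈ , trans e (solve 3 (λ i y t → i :+ t := i :+ y :* con 0ℤ :+ t) (fromℤ i) y (λ₀ * s))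

        from-θ : (∃ λ i → ∃ λ s → R s × α ≈ fromℤ i + λ₀ * s) → Residue θ
        from-θ (i , s , s∈ , e) = i , 1# , s , S∈.1∈ , R⊆S s∈ , (begin
          θ  ≈⟨ solve 2 (λ t a → t := a :+ (t :- a) :* con 1ℤ) θ α ⟩
          α + y * 1#  ≈⟨ +-congʳ e ⟩
          fromℤ i + λ₀ * s + y * 1#  ≈⟨ solve 3 (λ i t y → i :+ t :+ y := i :+ y :+ t) (fromℤ i) (λ₀ * s) (y * 1#) ⟩
          fromℤ i + y * 1# + λ₀ * s  ∎)

        value∈ : ∀ i {a b} → S a → S b → S (fromℤ i + y * a + λ₀ * b)
        value∈ i a∈ b∈ = S∈.+∈ (S∈.+∈ (fromℤ∈ S-subring i) (S∈.*∈ y∈S a∈)) (S∈.*∈ (R⊆S λ∈R) b∈)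

        residues : IsSubring Residue
        residues = record
          { resp = λ s≈t (i , a , b , a∈ , b∈ , e) → i , a , b , a∈ , b∈ , trans (sym s≈t) e
          ; 0∈   = 0ℤ , 0# , 0# , S∈.0∈ , S∈.0∈ , solve 2 (λ y l → con 0ℤ := con 0ℤ :+ y :* con 0ℤ :+ l :* con 0ℤ) y λ₀
          ; 1∈   = 1ℤ , 0# , 0# , S∈.0∈ , S∈.0∈ ,
              trans (solve 2 (λ y l → con 1ℤ := con 1ℤ :+ y :* con 0ℤ :+ l :* con 0ℤ) y λ₀) (+-congʳ (+-congʳ (sym fromℤ-1)))
          ; +∈   = λ (i , a , b , a∈ , b∈ , e) (j , a′ , b′ , a′∈ , b′∈ , e′) → i ℤ.+ j , a + a′ , b + b′ , S∈.+∈ a∈ a′∈ , S∈.+∈ b∈ b′∈ ,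
              trans (+-cong e e′) (trans (solve 8 (λ i a b j a′ b′ y l → i :+ y :* a :+ l :* b :+ (j :+ y :* a′ :+ l :* b′) := i :+ j :+ y :* (a :+ a′) :+ l :* (b :+ b′)) (fromℤ i) a b (fromℤ j) a′ b′ y λ₀) (+-congʳ (+-congʳ (sym (fromℤ-+ i j)))))
          ; *∈   = λ (i , a , b , a∈ , b∈ , e) (j , a′ , b′ , a′∈ , b′∈ , e′) →
              i ℤ.* j , fromℤ i * a′ + a * (fromℤ j + y * a′ + λ₀ * b′) , fromℤ i * b′ + b * (fromℤ j + y * a′ + λ₀ * b′) ,
              S∈.+∈ (S∈.*∈ (fromℤ∈ S-subring i) a′∈) (S∈.*∈ a∈ (value∈ j a′∈ b′∈)) ,
              S∈.+∈ (S∈.*∈ (fromℤ∈ S-subring i) b′∈) (S∈.*∈ b∈ (value∈ j a′∈ b′∈)) ,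
              trans (*-cong e e′) (trans (solve 8 (λ i a b j a′ b′ y l → let t = j :+ y :* a′ :+ l :* b′ in
                  (i :+ y :* a :+ l :* b) :* t := i :* j :+ y :* (i :* a′ :+ a :* t) :+ l :* (i :* b′ :+ b :* t)) (fromℤ i) a b (fromℤ j) a′ b′ y λ₀) (+-congʳ (+-congʳ (sym (fromℤ-* i j)))))
          ; -∈   = λ (i , a , b , a∈ , b∈ , e) → ℤ.- i , - a , - b , S∈.-∈ a∈ , S∈.-∈ b∈ ,
              trans (-‿cong e) (trans (solve 5 (λ i a b y l → :- (i :+ y :* a :+ l :* b) := :- i :+ y :* (:- a) :+ l :* (:- b)) (fromℤ i) a b y λ₀)
                (+-congʳ (+-congʳ (sym (fromℤ-neg i)))))
          }

      residue-^ : ∀ n {u d w} → R d → S w → u ≈ d + λ₀ * w → ∃ λ w′ → S w′ × u ^ n ≈ d ^ n + λ₀ * w′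
      residue-^ zero    _  _  _ = 0# , S∈.0∈ , solve 1 (λ l → con 1ℤ := con 1ℤ :+ l :* con 0ℤ) λ₀
      residue-^ (suc n) {u} {d} {w} d∈ w∈ e = go (residue-^ n d∈ w∈ e)
        where
        go : (∃ λ w′ → S w′ × u ^ n ≈ d ^ n + λ₀ * w′) → ∃ λ w′ → S w′ × u ^ suc n ≈ d ^ suc n + λ₀ * w′
        go (w′ , w′∈ , e′) = d * w′ + w * (d ^ n + λ₀ * w′) ,
          S∈.+∈ (S∈.*∈ (R⊆S d∈) w′∈) (S∈.*∈ w∈ (S∈.+∈ (R⊆S (R∈.^∈ n d∈)) (S∈.*∈ (R⊆S λ∈R) w′∈))) ,
          trans (*-cong e e′) (solve 5 (λ d l w t w′ → (d :+ l :* w) :* (t :+ l :* w′) := d :* t :+ l :* (d :* w′ :+ w :* (t :+ l :* w′))) d λ₀ w (d ^ n) w′)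

      λ-fraction-product : ∀ m n d e {z} → IntegralOver z → λ₀ * z ≈ fromℤ d ^ m * fromℤ e ^ n → p ℕ.∣ ℤ.∣ d ∣ ⊎ p ℕ.∣ ℤ.∣ e ∣
      λ-fraction-product m n d e z-int eq = Sum.map (λ x → prime∣^ p-prime _ m (≡.subst (p ℕ.∣_) (abs-^ d m) x)) (λ x → prime∣^ p-prime _ n (≡.subst (p ℕ.∣_) (abs-^ e n) x))
        (euclidsLemma ℤ.∣ d ℤ.^ m ∣ ℤ.∣ e ℤ.^ n ∣ p-prime (≡.subst (p ℕ.∣_) (ℤ.abs-* (d ℤ.^ m) (e ℤ.^ n))
          (λ-fraction (d ℤ.^ m ℤ.* e ℤ.^ n) z-int (trans eq (sym (trans (fromℤ-* (d ℤ.^ m) (e ℤ.^ n)) (*-cong (fromℤ-^ d m) (fromℤ-^ e n))))))))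

      -- y = θ - α is a root of an Eisenstein polynomial at λ: yᵖ = λ u, where u is
      -- congruent modulo λ to an integer d prime to p.
      module Eisenstein {u w : Carrier} {d : ℤ} (w∈ : S w) (p∤d : ¬ (p ℕ.∣ ℤ.∣ d ∣))
        (u≈ : u ≈ fromℤ d + λ₀ * w) (y^p≈λu : y ^ p ≈ λ₀ * u) where

        u∈S : S u
        u∈S = S∈.resp (sym u≈) (S∈.+∈ (fromℤ∈ S-subring d) (S∈.*∈ (R⊆S λ∈R) w∈))

        -- The p-th power of the equation contains (yᵖ)ᵖ⁻¹ = λᵖ⁻¹uᵖ⁻¹. Cancelling λᵖ⁻¹ leaves λzᵖ =
        -- uᵖ⁻¹eᵖ, congruent to dᵖ⁻¹eᵖ modulo λ; so p divides d or e, and d is excluded.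
        p∣constant : ∀ e {z} → IntegralOver z → λ₀ * z ≈ fromℤ e * y ^ p-1 → p ℕ.∣ ℤ.∣ e ∣
        p∣constant e {z} z-int eq = go (residue-^ p-1 (fromℤ∈ R-subring d) w∈ u≈)
          where
          λz^p≈ : λ₀ * z ^ p ≈ u ^ p-1 * fromℤ e ^ p
          λz^p≈ = *-cancelˡ (^-≉0 p-1 λ≉0) (begin
            λ₀ ^ p-1 * (λ₀ * z ^ p)  ≈⟨ solve 3 (λ t l z → t :* (l :* z) := l :* t :* z) (λ₀ ^ p-1) λ₀ (z ^ p) ⟩
            λ₀ ^ p * z ^ p  ≈⟨ ^-distrib-* λ₀ z p ⟨
            (λ₀ * z) ^ p  ≈⟨ ^-congˡ p eq ⟩
            (fromℤ e * y ^ p-1) ^ p  ≈⟨ ^-distrib-* (fromℤ e) (y ^ p-1) p ⟩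
            fromℤ e ^ p * (y ^ p-1) ^ p  ≈⟨ *-congˡ (^-comm y p-1 p) ⟩
            fromℤ e ^ p * (y ^ p) ^ p-1  ≈⟨ *-congˡ (trans (^-congˡ p-1 y^p≈λu) (^-distrib-* λ₀ u p-1)) ⟩
            fromℤ e ^ p * (λ₀ ^ p-1 * u ^ p-1)
              ≈⟨ solve 3 (λ e l u → e :* (l :* u) := l :* (u :* e)) (fromℤ e ^ p) (λ₀ ^ p-1) (u ^ p-1) ⟩
            λ₀ ^ p-1 * (u ^ p-1 * fromℤ e ^ p)  ∎)

          go : (∃ λ w′ → S w′ × u ^ p-1 ≈ fromℤ d ^ p-1 + λ₀ * w′) → p ℕ.∣ ℤ.∣ e ∣
          go (w′ , w′∈ , e′) = Sum.[ (λ p∣d → contradiction p∣d p∤d) , (λ p∣e → p∣e) ]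
            (λ-fraction-product p-1 p d e (I∈.+∈ (I∈.^∈ p z-int) (I∈.-∈ (S⊆integral (S∈.*∈ w′∈ (S∈.^∈ p (fromℤ∈ S-subring e)))))) (begin
              λ₀ * (z ^ p - w′ * fromℤ e ^ p)
                ≈⟨ solve 4 (λ l z w t → l :* (z :- w :* t) := l :* z :- l :* w :* t) λ₀ (z ^ p) w′ (fromℤ e ^ p) ⟩
              λ₀ * z ^ p - λ₀ * w′ * fromℤ e ^ p  ≈⟨ +-congʳ (trans λz^p≈ (*-congʳ e′)) ⟩
              (fromℤ d ^ p-1 + λ₀ * w′) * fromℤ e ^ p - λ₀ * w′ * fromℤ e ^ p
                ≈⟨ solve 3 (λ d l t → (d :+ l) :* t :- l :* t := d :* t) (fromℤ d ^ p-1) (λ₀ * w′) (fromℤ e ^ p) ⟩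
              fromℤ d ^ p-1 * fromℤ e ^ p  ∎))

        -- Write s = e + y a + λ b. After removal of the λ-term, multiplication by the complementary
        -- power of y brings e to e yᵖ⁻¹ and turns the rest into a multiple of yᵖ = λu. Hence p ∣ e,
        -- so e is a multiple of λ as well, and one more factor y comes out. At i = p the factor yᵖ
        -- provides λ itself.
        descend : ∀ m i → i ℕ.+ m ≡ p → ∀ {z s} → IntegralOver z → S s → λ₀ * z ≈ y ^ i * s → S z
        descend zero i i+0≡p {z} {s} z-int s∈ eq = S∈.resp (sym (*-cancelˡ λ≉0 (begin
          λ₀ * z  ≈⟨ eq ⟩
          y ^ i * s  ≡⟨ ≡.cong (λ n → y ^ n * s) (≡.trans (≡.sym (ℕ.+-identityʳ i)) i+0≡p) ⟩
          y ^ p * s  ≈⟨ *-congʳ y^p≈λu ⟩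
          λ₀ * u * s  ≈⟨ *-assoc _ _ _ ⟩
          λ₀ * (u * s)  ∎))) (S∈.*∈ u∈S s∈)
        descend (suc m) i i+m≡p {z} {s} z-int s∈ eq = reduce (S-residue s∈)
          where
          1+i+m≡p : suc i ℕ.+ m ≡ p
          1+i+m≡p = ≡.trans (≡.sym (ℕ.+-suc i m)) i+m≡p

          yⁱ∈S : ∀ {s} → S s → S (y ^ i * s)
          yⁱ∈S s∈ = S∈.*∈ (S∈.^∈ i y∈S) s∈

          reduce : (∃ λ e → ∃ λ a → ∃ λ b → S a × S b × s ≈ fromℤ e + y * a + λ₀ * b) → S z
          reduce (e , a , b , a∈ , b∈ , s≈) = lift (λ∣fromℤ e (p∣constant e z″-int λz″≈))
            where
            z′ z″ : Carrier
            z′ = z - y ^ i * b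
            z″ = z′ * y ^ m - u * a

            z′-int : IntegralOver z′
            z′-int = I∈.+∈ z-int (I∈.-∈ (S⊆integral (yⁱ∈S b∈)))

            z″-int : IntegralOver z″
            z″-int = I∈.+∈ (I∈.*∈ z′-int (S⊆integral (S∈.^∈ m y∈S))) (I∈.-∈ (S⊆integral (S∈.*∈ u∈S a∈)))

            λz′≈ : λ₀ * z′ ≈ y ^ i * (fromℤ e + y * a)
            λz′≈ = begin
              λ₀ * (z - y ^ i * b)
                ≈⟨ solve 4 (λ l z t b → l :* (z :- t :* b) := l :* z :- t :* (l :* b)) λ₀ z (y ^ i) b ⟩
              λ₀ * z - y ^ i * (λ₀ * b)  ≈⟨ +-congʳ (trans eq (*-congˡ s≈)) ⟩
              y ^ i * (fromℤ e + y * a + λ₀ * b) - y ^ i * (λ₀ * b)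
                ≈⟨ solve 3 (λ t x b → t :* (x :+ b) :- t :* b := t :* x) (y ^ i) (fromℤ e + y * a) (λ₀ * b) ⟩
              y ^ i * (fromℤ e + y * a)  ∎

            λz″≈ : λ₀ * z″ ≈ fromℤ e * y ^ p-1
            λz″≈ = begin
              λ₀ * (z′ * y ^ m - u * a)
                ≈⟨ solve 5 (λ l z t u a → l :* (z :* t :- u :* a) := l :* z :* t :- l :* u :* a) λ₀ z′ (y ^ m) u a ⟩
              λ₀ * z′ * y ^ m - λ₀ * u * a
                ≈⟨ +-cong (*-congʳ λz′≈) (-‿cong (*-congʳ (trans (sym y^p≈λu) (trans (reflexive (≡.cong (y ^_) (≡.sym 1+i+m≡p))) (^-homo-* y (suc i) m))))) ⟩
              y ^ i * (fromℤ e + y * a) * y ^ m - y * y ^ i * y ^ m * a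
                ≈⟨ solve 5 (λ t e y a w → t :* (e :+ y :* a) :* w :- y :* t :* w :* a := e :* (t :* w)) (y ^ i) (fromℤ e) y a (y ^ m) ⟩
              fromℤ e * (y ^ i * y ^ m)  ≈⟨ *-congˡ (^-homo-* y i m) ⟨
              fromℤ e * y ^ (i ℕ.+ m)  ≡⟨ ≡.cong (λ n → fromℤ e * y ^ n) (ℕ.suc-injective 1+i+m≡p) ⟩
              fromℤ e * y ^ p-1  ∎

            lift : (∃ λ r → R r × fromℤ e ≈ λ₀ * r) → S z
            lift (r , r∈ , e≈) = S∈.resp (solve 3 (λ z b r → z :- b :- r :+ r :+ b := z) z (y ^ i * b) (y ^ i * r))
              (S∈.+∈ (S∈.+∈ rest (yⁱ∈S (R⊆S r∈))) (yⁱ∈S b∈))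
              where
              rest : S (z′ - y ^ i * r)
              rest = descend m (suc i) 1+i+m≡p (I∈.+∈ z′-int (I∈.-∈ (S⊆integral (yⁱ∈S (R⊆S r∈))))) a∈ (begin
                λ₀ * (z′ - y ^ i * r)
                  ≈⟨ solve 4 (λ l z t r → l :* (z :- t :* r) := l :* z :- t :* (l :* r)) λ₀ z′ (y ^ i) r ⟩
                λ₀ * z′ - y ^ i * (λ₀ * r)  ≈⟨ +-cong λz′≈ (-‿cong (*-congˡ (sym e≈))) ⟩
                y ^ i * (fromℤ e + y * a) - y ^ i * fromℤ e
                  ≈⟨ solve 4 (λ t e y a → t :* (e :+ y :* a) :- t :* e := y :* t :* a) (y ^ i) (fromℤ e) y a ⟩
                y * y ^ i * a  ∎)

      S-λ-closed : (∀ {r} → R r → ¬ (α ^ p - α ≈ λ₀ * (λ₀ * r))) → ∀ {z} → IntegralOver z → S (λ₀ * z) → S z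
      S-λ-closed λ²∤ {z} z-int s∈ = fromFermat (fermat-R α∈R)
        where
        fromFermat : α ^ p ≡λ α → S z
        fromFermat (δ , δ∈ , e) = residue (R-residue (R∈.-∈ δ∈)) (SubringRing.freshman-subring (R ∪ ｛ θ ｝) p-prime θ∈S (S∈.-∈ α∈S)) λ^p-1∣p
          where
          α^p-α≈ : α ^ p - α ≈ λ₀ * δ
          α^p-α≈ = trans (+-congʳ e) (solve 2 (λ a t → a :+ t :- a := t) α (λ₀ * δ))

          residue : (∃ λ d → ∃ λ s → R s × - δ ≈ fromℤ d + λ₀ * s) →
                    (∃ λ t → S t × y ^ p ≈ θ ^ p + (- α) ^ p + ι p * t) → (∃ λ v → R v × ι p ≈ λ₀ ^ p-1 * v) → S z
          residue (d , s , s′∈ , e₁) (t , t∈ , e₂) (v , v∈ , e₃) =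
            -- The descent starts from λ z = y⁰ s, with s = λ z itself.
            Eisenstein.descend {d = d} w∈ p∤d refl y^p≈λu p 0 ≡.refl z-int s∈ (sym (*-identityˡ _))
            where
            w = s + λ₀ ^ k * v * t

            w∈ : S w
            w∈ = S∈.+∈ (R⊆S s′∈) (S∈.*∈ (R⊆S (R∈.*∈ (R∈.^∈ k λ∈R) v∈)) t∈)

            -- Modulo λ, `d` is the negative of (αᵖ - α) / λ, so p ∣ d would restore the congruence
            -- modulo λ².
            p∤d : ¬ (p ℕ.∣ ℤ.∣ d ∣)
            p∤d p∣d = go (λ∣fromℤ d p∣d)
              where
              go : ¬ (∃ λ r → R r × fromℤ d ≈ λ₀ * r)
              go (r , r∈ , e₄) = λ²∤ (R∈.-∈ (R∈.+∈ r∈ s′∈)) (begin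
                α ^ p - α  ≈⟨ α^p-α≈ ⟩
                λ₀ * δ  ≈⟨ solve 2 (λ l d → l :* d := l :* (:- (:- d))) λ₀ δ ⟩
                λ₀ * - (- δ)  ≈⟨ *-congˡ (-‿cong (trans e₁ (+-congʳ e₄))) ⟩
                λ₀ * - (λ₀ * r + λ₀ * s)
                  ≈⟨ solve 3 (λ l r s → l :* (:- (l :* r :+ l :* s)) := l :* (l :* (:- (r :+ s)))) λ₀ r s ⟩
                λ₀ * (λ₀ * - (r + s))  ∎)

            y^p≈λu : y ^ p ≈ λ₀ * (fromℤ d + λ₀ * w)
            y^p≈λu = begin
              y ^ p  ≈⟨ e₂ ⟩
              θ ^ p + (- α) ^ p + ι p * t  ≈⟨ +-cong (+-cong θ^p≈α (neg-^p α)) (*-congʳ e₃) ⟩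
              α - α ^ p + λ₀ * (λ₀ * λ₀ ^ k) * v * t
                ≈⟨ +-congʳ (trans (solve 2 (λ a b → a :- b := :- (b :- a)) α (α ^ p)) (-‿cong α^p-α≈)) ⟩
              - (λ₀ * δ) + λ₀ * (λ₀ * λ₀ ^ k) * v * t
                ≈⟨ solve 5 (λ l d m v t → :- (l :* d) :+ l :* (l :* m) :* v :* t := l :* (:- d :+ l :* (m :* v :* t))) λ₀ δ (λ₀ ^ k) v t ⟩
              λ₀ * (- δ + λ₀ * (λ₀ ^ k * v * t))  ≈⟨ *-congˡ (+-congʳ e₁) ⟩
              λ₀ * (fromℤ d + λ₀ * s + λ₀ * (λ₀ ^ k * v * t))
                ≈⟨ *-congˡ (trans (+-assoc _ _ _) (+-congˡ (sym (distribˡ λ₀ s _)))) ⟩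
              λ₀ * (fromℤ d + λ₀ * w)  ∎

      -- Denominators, and the ring of integers as S

      open FieldDefs L using (resp; 0∈; 1∈; +∈; *∈; -∈; inv∈; root)
      open Ideals ℤ[ ζ ] using (SquareFreeAsIdeal; ⟨_⟩; _·_; _≡_[mod_]; _^ᴿ_)

      -- Integer denominators are enough for the whole field, because every nonzero element of S
      -- divides a positive integer in S. With them the passage to S can proceed one rational prime
      -- at a time.
      record Fraction (x : Carrier) : Set (c ⊔ ℓ₁) where
        constructor fraction
        field
          denominator : ℕ
          nonZero     : ℕ.NonZero denominator
          numerator∈  : S (ι denominator * x)

      S-fraction : ∀ {x} → S x → Fraction x
      S-fraction {x} x∈ = fraction 1 _ (S∈.resp (sym (trans (*-congʳ fromℤ-1) (*-identityˡ x))) x∈)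

      private
        combine : ∀ m n {x} → ι (m ℕ.* n) * x ≈ ι m * (ι n * x)
        combine m n = trans (*-congʳ (ι-* m n)) (*-assoc _ _ _)

        m*n≢0 : ∀ {m n} → ℕ.NonZero m → ℕ.NonZero n → ℕ.NonZero (m ℕ.* n)
        m*n≢0 {m} {n} m≢0 n≢0 = ℕ.m*n≢0 m n {{m≢0}} {{n≢0}}

      K-fraction : ∀ {x} → K x → Fraction x
      K-fraction (gen (inj₁ e)) = S-fraction (R⊆S (gen e))
      K-fraction (gen (inj₂ e)) = S-fraction (gen (inj₂ e))
      K-fraction (resp x≈y d)   = go (K-fraction d)
        where
        go : Fraction _ → Fraction _
        go (fraction n n≢0 x∈) = fraction n n≢0 (S∈.resp (*-congˡ x≈y) x∈)
      K-fraction 0∈             = S-fraction S∈.0∈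
      K-fraction 1∈             = S-fraction S∈.1∈
      K-fraction (+∈ {x} {y} d d′) = go (K-fraction d) (K-fraction d′)
        where
        go : Fraction x → Fraction y → Fraction (x + y)
        go (fraction m m≢0 x∈) (fraction n n≢0 y∈) = fraction (m ℕ.* n) (m*n≢0 m≢0 n≢0)
          (S∈.resp (trans (solve 4 (λ m n x y → n :* (m :* x) :+ m :* (n :* y) := m :* (n :* (x :+ y))) (ι m) (ι n) x y) (sym (combine m n)))
            (S∈.+∈ (S∈.*∈ (ι∈ S-subring n) x∈) (S∈.*∈ (ι∈ S-subring m) y∈)))
      K-fraction (*∈ {x} {y} d d′) = go (K-fraction d) (K-fraction d′)
        where
        go : Fraction x → Fraction y → Fraction (x * y)
        go (fraction m m≢0 x∈) (fraction n n≢0 y∈) = fraction (m ℕ.* n) (m*n≢0 m≢0 n≢0)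
          (S∈.resp (trans (solve 4 (λ m n x y → m :* x :* (n :* y) := m :* (n :* (x :* y))) (ι m) (ι n) x y) (sym (combine m n)))
            (S∈.*∈ x∈ y∈))
      K-fraction (-∈ {x} d) = go (K-fraction d)
        where
        go : Fraction x → Fraction (- x)
        go (fraction n n≢0 x∈) = fraction n n≢0 (S∈.resp (solve 2 (λ n x → :- (n :* x) := n :* (:- x)) (ι n) x) (S∈.-∈ x∈))
      -- With x y = 1 and n x in S, the element n x divides a positive integer m, say n x t = m.
      -- Then m y = t n is in S, so m is a denominator of y.
      K-fraction (inv∈ {x} {y} xy≈1 d) = go (K-fraction d)
        where
        go : Fraction x → Fraction y
        go (fraction n n≢0 x∈) = divide (nonzero-multiple S-subring x∈ nx≉0 (S⊆integral x∈))
          where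
          nxy≈n : ι n * x * y ≈ ι n
          nxy≈n = trans (*-assoc _ _ _) (trans (*-congˡ xy≈1) (*-identityʳ _))

          nx≉0 : ¬ (ι n * x ≈ 0#)
          nx≉0 e = ι≉0 n {{n≢0}} (trans (sym nxy≈n) (trans (*-congʳ e) (zeroˡ y)))

          divide : (∃ λ m → ∃ λ t → ℕ.NonZero m × S t × ι n * x * t ≈ ι m) → Fraction y
          divide (m , t , m≢0 , t∈ , e) = fraction m m≢0 (S∈.resp (begin
            t * ι n  ≈⟨ *-congˡ nxy≈n ⟨
            t * (ι n * x * y)  ≈⟨ solve 3 (λ t x y → t :* (x :* y) := x :* t :* y) t (ι n * x) y ⟩
            ι n * x * t * y  ≈⟨ *-congʳ e ⟩
            ι m * y  ∎) (S∈.*∈ t∈ (ι∈ S-subring n)))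

      S⊆𝓞 : S ⊆ 𝓞 K
      S⊆𝓞 s∈ = S⊆K s∈ , ⇒integral (S⊆integral s∈)

      module _ (squareFree : SquareFreeAsIdeal αᴿ)
        (not-congruent : ¬ (αᴿ ^ᴿ p ≡ αᴿ [mod ⟨ 𝔹.1# 𝔹.- root ζ ⟩ · ⟨ 𝔹.1# 𝔹.- root ζ ⟩ ])) where

        λ²∤ : ∀ {r} → R r → ¬ (α ^ p - α ≈ λ₀ * (λ₀ * r))
        λ²∤ {r} r∈ e = not-congruent (Ideals.resp {x = λ′ 𝔹.* (λ′ 𝔹.* r′)} {y = (αᴿ ^ᴿ p) 𝔹.- αᴿ}
            (sym (trans (+-congʳ (reflexive (SubringRing.proj₁-^ ｛ ζ ｝ αᴿ p))) e))
            (Ideals.prod {x = λ′} {y = λ′ 𝔹.* r′} (𝔹.1# RawMagma., *-identityˡ λ₀) (r′ RawMagma., *-comm r λ₀)))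
          where
          λ′ r′ : 𝔹.Carrier
          λ′ = 𝔹.1# 𝔹.- root ζ
          r′ = r , r∈

        S-prime-closed : ∀ {q} → Prime q → ∀ {z} → IntegralOver z → S (ι q * z) → S z
        S-prime-closed {q} q-prime with q ℕ.≟ p
        ... | yes ≡.refl = λ z-int → λ-step S-subring R⊆S (S-λ-closed λ²∤) z-int
        ... | no  q≢p    = λ z-int → AwayFromP.S-q-closed squareFree q-prime q≢p z-int

        𝓞⊆S : 𝓞 K ⊆ S
        𝓞⊆S (x∈K , x-int) = go (K-fraction x∈K)
          where
          go : Fraction _ → S _
          go (fraction n n≢0 nx∈) = primeSteps S∈.resp S-prime-closed n {{n≢0}} (integral⇒ x-int) nx∈

theorem1p1 : ∀ {c ℓ₁ ℓ₂} (L : HeytingField c ℓ₁ ℓ₂) →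
    let open FieldDefs L in
    CharacteristicZero →
    (p : ℕ) → Prime p → ¬ (2 ∣ p) →
    (ζ : Carrier) → IsPrimitiveRoot ζ p →
    let module R = CommutativeRing ℤ[ ζ ] in
    let open Ideals ℤ[ ζ ] in
    let open Polynomials ℤ[ ζ ] in
    (α : R.Carrier) →
    Irreducible ((X ^ᴾ p) +ᴾ constant (R.- α)) →
    (θ : Carrier) → θ ^ p ≈ proj₁ α →
    (𝓞 ℚ⟮ ζ , θ ⟯ ≐ ℤ[ ζ ][ θ ])
    ⇔ (SquareFreeAsIdeal α ×
    ¬ (α ^ᴿ p ≡ α [mod ⟨ R.1# R.- root ζ ⟩ · ⟨ R.1# R.- root ζ ⟩ ]))
-- An odd prime is at least 3; with 0, 1 and 2 excluded, p takes the form 3 + k on which the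
-- cyclotomic part is built.
theorem1p1 L char0 0 p-prime = ⊥-elim (¬prime[0] p-prime)
theorem1p1 L char0 1 p-prime = ⊥-elim (¬prime[1] p-prime)
theorem1p1 L char0 2 p-prime p-odd = ⊥-elim (p-odd ℕ.∣-refl)
theorem1p1 L char0 (suc (suc (suc k))) p-prime p-odd ζ ζ-primitive α irreducible θ θ^p≈α = mk⇔
  (λ (𝓞⊆S , _) → let open IntegralClosureImplies (irreducible⇒θ∉R α irreducible θ^p≈α) 𝓞⊆S in squareFree , not-congruent)
  (λ (squareFree , not-congruent) → 𝓞⊆S squareFree not-congruent , S⊆𝓞)
  where
  open FieldTheory L char0
  open Cyclotomic p-prime p-odd ζ-primitive
  open Radical (proj₂ α) θ^p≈α
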